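{- Let $t$ be a positive integer and let $\mathcal{M}$ be a family of Boolean matrices none of which contains a $t\times t$ all-ones submatrix. Then the following are equivalent. (1) There exists $\gamma$ such that $\gamma_2(M)\le\gamma$ for every $M\in\mathcal{M}$. (2) There exists $b$ such that every $M\in\mathcal{M}$ is the sum of at most $b$ thin blocky matrices. (3) There exists $d$ such that every $M\in\mathcal{M}$ has degeneracy at most $d$.
   Context: A Boolean matrix is a matrix with entries in $\{0,1\}$. A submatrix is obtained by choosing an arbitrary subset of the rows and an arbitrary subset of the columns. For a real matrix $M$, $\gamma_2(M)=\min_{UV=M}\|U\|_{\mathrm{row}}\|V\|_{\mathrm{col}}$, where the minimum is over all factorizations $M=UV$ into real matrices, $\|U\|_{\mathrm{row}}$ is the maximum $\ell_2$-norm of a row of $U$, and $\|V\|_{\mathrm{col}}$ is the maximum $\ell_2$-norm of a column of $V$. A blocky matrix is a Boolean matrix $M$ whose rows and columns can be partitioned into (possibly empty for index $0$) sets $A_0,A_1,\dots,A_k$ and $B_0,B_1,\dots,B_k$, for some $k\ge 0$, such that $M[A_i\times B_i]$ is an all-ones matrix for $i=1,\dots,k$, and $M[A_i\times B_j]=0$ whenever $i\ne j$ or $i=j=0$. It is thin if for every $i=1,\dots,k$ either $|A_i|=1$ or $|B_i|=1$. The degeneracy of a Boolean matrix $M$ is the smallest nonnegative integer $d$ such that every submatrix of $M$ has a row or a column with at most $d$ one entries. -}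

module Defs where

open import Data.Bool.Base using (Bool; T; true; false; if_then_else_)
open import Data.Fin.Base using (Fin; zero; suc)
open import Data.Fin.Subset using (Subset; _∈_; _∩_; ∣_∣; Nonempty)
open import Data.Integer.Base as ℤ using (+_)
import Data.Integer.Properties as ℤ
open import Data.Nat.Base as ℕ using (ℕ; zero; suc)
import Data.Nat.Coprimality as Coprime using (sym; 1-coprimeTo)
import Data.Nat.Properties as ℕ
open import Algebra.Properties.Monoid.Sum ℕ.+-0-monoid using (sum)
open import Data.Product using (∃; ∃₂; _×_; _,_)
open import Data.Rational.Base as ℚ using (ℚ; mkℚ; 0ℚ; 1ℚ; ½; ↥_; *≤*)
import Data.Rational.Properties as ℚ
import Data.Rational.Unnormalised.Base as ℚᵘ using (*≡*)
import Data.Rational.Unnormalised.Properties as ℚᵘ using (≃-trans; ≃-sym)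
open import Data.Rational.Solver using (module +-*-Solver)
open import Data.Sum.Base using (_⊎_; inj₁; inj₂; [_,_]′)
open import Data.Vec.Base using (tabulate)
open import Data.Vec.Functional using (Vector; foldr; map; zipWith; transpose)
open import Level as Level using (Level)
open import Relation.Binary.PropositionalEquality
  using (_≡_; _≢_; refl; sym; trans; cong; subst; subst₂)
open import Relation.Nullary using (contradiction)
open import Relation.Unary using (Pred)
open +-*-Solver using (solve; _:=_; _:+_; _:*_; _:-_) renaming (:-_ to ⊖_)

------------------------------------------------------------------------
-- Rational identities and inequalities used in the Cauchy estimates

module Estimates where

  neg-sub : ∀ a b → ℚ.- (a ℚ.- b) ≡ b ℚ.- a
  neg-sub = solve 2 (λ x y → (⊖ (x :- y)) := (y :- x)) refl

  add-sub : ∀ a b → b ℚ.+ (a ℚ.- b) ≡ a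
  add-sub = solve 2 (λ x y → (y :+ (x :- y)) := x) refl

  sub-add : ∀ a b → (a ℚ.+ b) ℚ.- a ≡ b
  sub-add = solve 2 (λ x y → ((x :+ y) :- x) := y) refl

  sub-of-sums : ∀ a b c d → (a ℚ.+ b) ℚ.- (c ℚ.+ d) ≡ (a ℚ.- c) ℚ.+ (b ℚ.- d)
  sub-of-sums = solve 4 (λ a b c d →
    ((a :+ b) :- (c :+ d)) := ((a :- c) :+ (b :- d))) refl

  sub-of-products : ∀ a b c d →
    (a ℚ.* b) ℚ.- (c ℚ.* d) ≡ a ℚ.* (b ℚ.- d) ℚ.+ (a ℚ.- c) ℚ.* d
  sub-of-products = solve 4 (λ a b c d →
    ((a :* b) :- (c :* d)) := ((a :* (b :- d)) :+ ((a :- c) :* d))) refl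

  collect : ∀ b c e r → b ℚ.* (e ℚ.* r) ℚ.+ (e ℚ.* r) ℚ.* c ≡ e ℚ.* ((b ℚ.+ c) ℚ.* r)
  collect = solve 4 (λ b c e r →
    ((b :* (e :* r)) :+ ((e :* r) :* c)) := (e :* ((b :+ c) :* r))) refl

  p≤∣p∣ : ∀ p → p ℚ.≤ ℚ.∣ p ∣
  p≤∣p∣ p with ℚ.≤-total 0ℚ p
  ... | inj₁ 0≤p = ℚ.≤-reflexive (sym (ℚ.0≤p⇒∣p∣≡p 0≤p))
  ... | inj₂ p≤0 = ℚ.≤-trans p≤0 (ℚ.0≤∣p∣ p)

  ∣p∣≤ : ∀ {p e} → p ℚ.≤ e → ℚ.- p ℚ.≤ e → ℚ.∣ p ∣ ℚ.≤ e
  ∣p∣≤ {p} p≤e -p≤e with ℚ.∣p∣≡p∨∣p∣≡-p p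
  ... | inj₁ eq = subst (ℚ._≤ _) (sym eq) p≤e
  ... | inj₂ eq = subst (ℚ._≤ _) (sym eq) -p≤e

  dist⇒≤ : ∀ {a b e} → ℚ.∣ a ℚ.- b ∣ ℚ.≤ e → a ℚ.≤ b ℚ.+ e
  dist⇒≤ {a} {b} {e} h = subst (ℚ._≤ b ℚ.+ e) (add-sub a b)
    (ℚ.+-monoʳ-≤ b (ℚ.≤-trans (p≤∣p∣ (a ℚ.- b)) h))

  ≤⇒dist : ∀ {a b e} → a ℚ.≤ b ℚ.+ e → b ℚ.≤ a ℚ.+ e → ℚ.∣ a ℚ.- b ∣ ℚ.≤ e
  ≤⇒dist {a} {b} {e} h₁ h₂ = ∣p∣≤
    (subst (a ℚ.- b ℚ.≤_) (sub-add b e) (ℚ.+-monoˡ-≤ (ℚ.- b) h₁))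
    (subst₂ ℚ._≤_ (sym (neg-sub a b)) (sub-add a e) (ℚ.+-monoˡ-≤ (ℚ.- a) h₂))

  dist-sym : ∀ a b → ℚ.∣ a ℚ.- b ∣ ≡ ℚ.∣ b ℚ.- a ∣
  dist-sym a b = trans (sym (ℚ.∣-p∣≡∣p∣ (a ℚ.- b))) (cong ℚ.∣_∣ (neg-sub a b))

  halve : ∀ e → e ℚ.* ½ ℚ.+ e ℚ.* ½ ≡ e
  halve e = trans (sym (ℚ.*-distribˡ-+ e ½ ½)) (ℚ.*-identityʳ e)

  *-pos : ∀ {p q} → 0ℚ ℚ.< p → 0ℚ ℚ.< q → 0ℚ ℚ.< p ℚ.* q
  *-pos {p} {q} 0<p 0<q = ℚ.positive⁻¹ (p ℚ.* q)
    {{ℚ.pos*pos⇒pos p {{ℚ.positive 0<p}} q {{ℚ.positive 0<q}}}}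

  *-mono-≤ : ∀ {a b c d} → 0ℚ ℚ.≤ a → 0ℚ ℚ.≤ d → a ℚ.≤ b → c ℚ.≤ d → a ℚ.* c ℚ.≤ b ℚ.* d
  *-mono-≤ {a} {b} {c} {d} 0≤a 0≤d a≤b c≤d = ℚ.≤-trans
    (ℚ.*-monoˡ-≤-nonNeg a {{ℚ.nonNegative 0≤a}} c≤d)
    (ℚ.*-monoʳ-≤-nonNeg d {{ℚ.nonNegative 0≤d}} a≤b)

  0<½ : 0ℚ ℚ.< ½
  0<½ = ℚ.positive⁻¹ ½

  0<1 : 0ℚ ℚ.< 1ℚ
  0<1 = ℚ.positive⁻¹ 1ℚ

  -- η = ε / (B + C)
  split : ∀ {ε B C} → 0ℚ ℚ.< ε → 0ℚ ℚ.< B → 0ℚ ℚ.< C →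
          ∃ λ η → 0ℚ ℚ.< η × B ℚ.* η ℚ.+ η ℚ.* C ≡ ε
  split {ε} {B} {C} 0<ε 0<B 0<C = ε ℚ.* r
    , *-pos 0<ε (ℚ.positive⁻¹ r {{ℚ.1/pos⇒pos (B ℚ.+ C) {{B+C>0}}}})
    , trans (collect B C ε r)
        (trans (cong (ε ℚ.*_) (ℚ.*-inverseʳ (B ℚ.+ C) {{B+C≢0}})) (ℚ.*-identityʳ ε))
    where
    B+C>0 : ℚ.Positive (B ℚ.+ C)
    B+C>0 = ℚ.positive (ℚ.+-mono-< 0<B 0<C)
    B+C≢0 : ℚ.NonZero (B ℚ.+ C)
    B+C≢0 = ℚ.pos⇒nonZero (B ℚ.+ C) {{B+C>0}}
    r : ℚ
    r = (ℚ.1/ (B ℚ.+ C)) {{B+C≢0}}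

  sum-dist : ∀ a b c d {e f} → ℚ.∣ a ℚ.- c ∣ ℚ.≤ e → ℚ.∣ b ℚ.- d ∣ ℚ.≤ f →
             ℚ.∣ (a ℚ.+ b) ℚ.- (c ℚ.+ d) ∣ ℚ.≤ e ℚ.+ f
  sum-dist a b c d {e} {f} h₁ h₂ =
    subst (λ z → ℚ.∣ z ∣ ℚ.≤ e ℚ.+ f) (sym (sub-of-sums a b c d))
      (ℚ.≤-trans (ℚ.∣p+q∣≤∣p∣+∣q∣ (a ℚ.- c) (b ℚ.- d)) (ℚ.+-mono-≤ h₁ h₂))

  prod-dist : ∀ a b c d {B C e} → 0ℚ ℚ.≤ e → 0ℚ ℚ.≤ C → ℚ.∣ a ∣ ℚ.≤ B → ℚ.∣ d ∣ ℚ.≤ C →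
              ℚ.∣ a ℚ.- c ∣ ℚ.≤ e → ℚ.∣ b ℚ.- d ∣ ℚ.≤ e →
              ℚ.∣ a ℚ.* b ℚ.- c ℚ.* d ∣ ℚ.≤ B ℚ.* e ℚ.+ e ℚ.* C
  prod-dist a b c d {B} {C} {e} 0≤e 0≤C a≤B d≤C h₁ h₂ =
    subst (λ z → ℚ.∣ z ∣ ℚ.≤ B ℚ.* e ℚ.+ e ℚ.* C) (sym (sub-of-products a b c d))
      (ℚ.≤-trans (ℚ.∣p+q∣≤∣p∣+∣q∣ (a ℚ.* (b ℚ.- d)) ((a ℚ.- c) ℚ.* d))
        (ℚ.+-mono-≤
          (subst (ℚ._≤ B ℚ.* e) (sym (ℚ.∣p*q∣≡∣p∣*∣q∣ a (b ℚ.- d)))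
            (*-mono-≤ (ℚ.0≤∣p∣ a) 0≤e a≤B h₂))
          (subst (ℚ._≤ e ℚ.* C) (sym (ℚ.∣p*q∣≡∣p∣*∣q∣ (a ℚ.- c) d))
            (*-mono-≤ (ℚ.0≤∣p∣ (a ℚ.- c)) 0≤C h₁ d≤C))))

  max-dist : ∀ a b c d {e} → ℚ.∣ a ℚ.- c ∣ ℚ.≤ e → ℚ.∣ b ℚ.- d ∣ ℚ.≤ e →
             ℚ.∣ (a ℚ.⊔ b) ℚ.- (c ℚ.⊔ d) ∣ ℚ.≤ e
  max-dist a b c d {e} h₁ h₂ = ≤⇒dist
    (one-sided a b c d (dist⇒≤ h₁) (dist⇒≤ h₂))
    (one-sided c d a b
      (dist⇒≤ (subst (λ z → z ℚ.≤ e) (dist-sym a c) h₁))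
      (dist⇒≤ (subst (λ z → z ℚ.≤ e) (dist-sym b d) h₂)))
    where
    one-sided : ∀ a b c d → a ℚ.≤ c ℚ.+ e → b ℚ.≤ d ℚ.+ e → a ℚ.⊔ b ℚ.≤ (c ℚ.⊔ d) ℚ.+ e
    one-sided a b c d h h′ = ℚ.⊔-lub
      (ℚ.≤-trans h  (ℚ.+-monoˡ-≤ e (ℚ.p≤p⊔q c d)))
      (ℚ.≤-trans h′ (ℚ.+-monoˡ-≤ e (ℚ.p≤q⊔p c d)))

open Estimates

------------------------------------------------------------------------
-- Real numbers: Cauchy sequences of rationals, compared by _≈ʳ_ and _≤ʳ_

IsCauchy : (ℕ → ℚ) → Set
IsCauchy s = ∀ ε → 0ℚ ℚ.< ε →
  ∃ λ N → ∀ m n → N ℕ.≤ m → N ℕ.≤ n → ℚ.∣ s m ℚ.- s n ∣ ℚ.≤ ε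

record ℝ : Set where
  constructor mkℝ
  field
    seq    : ℕ → ℚ
    cauchy : IsCauchy seq

open ℝ public

infix 4 _≈ʳ_ _≤ʳ_

_≈ʳ_ : ℝ → ℝ → Set
x ≈ʳ y = ∀ ε → 0ℚ ℚ.< ε →
  ∃ λ N → ∀ n → N ℕ.≤ n → ℚ.∣ seq x n ℚ.- seq y n ∣ ℚ.≤ ε

_≤ʳ_ : ℝ → ℝ → Set
x ≤ʳ y = ∀ ε → 0ℚ ℚ.< ε →
  ∃ λ N → ∀ n → N ℕ.≤ n → seq x n ℚ.≤ seq y n ℚ.+ ε

fromℚ : ℚ → ℝ
fromℚ q = mkℝ (λ _ → q) λ ε 0<ε → 0 , λ _ _ _ _ →
  subst (ℚ._≤ ε) (sym (cong ℚ.∣_∣ (ℚ.+-inverseʳ q))) (ℚ.<⇒≤ 0<ε)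

-- The Cauchy proofs are abstract because only their types matter.
module Closure where

  both : ∀ s u → IsCauchy s → IsCauchy u → ∀ ε → 0ℚ ℚ.< ε →
    ∃ λ N → ∀ m n → N ℕ.≤ m → N ℕ.≤ n →
      ℚ.∣ s m ℚ.- s n ∣ ℚ.≤ ε × ℚ.∣ u m ℚ.- u n ∣ ℚ.≤ ε
  both s u cs cu ε 0<ε =
    let (N₁ , h₁) = cs ε 0<ε
        (N₂ , h₂) = cu ε 0<ε in
    N₁ ℕ.⊔ N₂ , λ m n N≤m N≤n →
        h₁ m n (ℕ.≤-trans (ℕ.m≤m⊔n N₁ N₂) N≤m) (ℕ.≤-trans (ℕ.m≤m⊔n N₁ N₂) N≤n)
      , h₂ m n (ℕ.≤-trans (ℕ.m≤n⊔m N₁ N₂) N≤m) (ℕ.≤-trans (ℕ.m≤n⊔m N₁ N₂) N≤n)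

  abstract
    +-cauchy : ∀ s u → IsCauchy s → IsCauchy u → IsCauchy (λ n → s n ℚ.+ u n)
    +-cauchy s u cs cu ε 0<ε =
      let (N , h) = both s u cs cu (ε ℚ.* ½) (*-pos 0<ε 0<½) in
      N , λ m n N≤m N≤n → let (h₁ , h₂) = h m n N≤m N≤n in
      subst (ℚ.∣ (s m ℚ.+ u m) ℚ.- (s n ℚ.+ u n) ∣ ℚ.≤_) (halve ε)
        (sum-dist (s m) (u m) (s n) (u n) h₁ h₂)

  abstract
    ⊔-cauchy : ∀ s u → IsCauchy s → IsCauchy u → IsCauchy (λ n → s n ℚ.⊔ u n)
    ⊔-cauchy s u cs cu ε 0<ε =
      let (N , h) = both s u cs cu ε 0<ε in
      N , λ m n N≤m N≤n → let (h₁ , h₂) = h m n N≤m N≤n in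
      max-dist (s m) (u m) (s n) (u n) h₁ h₂

  eventually-bounded : ∀ s → IsCauchy s →
    ∃₂ λ N B → 0ℚ ℚ.< B × (∀ n → N ℕ.≤ n → ℚ.∣ s n ∣ ℚ.≤ B)
  eventually-bounded s cs = let (N , h) = cs 1ℚ 0<1 in
    N , ℚ.∣ s N ∣ ℚ.+ 1ℚ , ℚ.+-mono-≤-< (ℚ.0≤∣p∣ (s N)) 0<1 , λ n N≤n →
    subst (λ p → ℚ.∣ p ∣ ℚ.≤ ℚ.∣ s N ∣ ℚ.+ 1ℚ) (add-sub (s n) (s N))
      (ℚ.≤-trans (ℚ.∣p+q∣≤∣p∣+∣q∣ (s N) (s n ℚ.- s N))
                 (ℚ.+-monoʳ-≤ ℚ.∣ s N ∣ (h n N N≤n ℕ.≤-refl)))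

  abstract
    *-cauchy : ∀ s u → IsCauchy s → IsCauchy u → IsCauchy (λ n → s n ℚ.* u n)
    *-cauchy s u cs cu ε 0<ε =
      let (N₁ , B , 0<B , hB) = eventually-bounded s cs
          (N₂ , C , 0<C , hC) = eventually-bounded u cu
          (η , 0<η , η-eq)    = split 0<ε 0<B 0<C
          (N₃ , h)            = both s u cs cu η 0<η
          N    = N₁ ℕ.⊔ (N₂ ℕ.⊔ N₃)
          N≥N₁ = ℕ.m≤m⊔n N₁ (N₂ ℕ.⊔ N₃)
          N≥N₂ = ℕ.≤-trans (ℕ.m≤m⊔n N₂ N₃) (ℕ.m≤n⊔m N₁ (N₂ ℕ.⊔ N₃))
          N≥N₃ = ℕ.≤-trans (ℕ.m≤n⊔m N₂ N₃) (ℕ.m≤n⊔m N₁ (N₂ ℕ.⊔ N₃)) in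
      N , λ m n N≤m N≤n →
        let (h₁ , h₂) = h m n (ℕ.≤-trans N≥N₃ N≤m) (ℕ.≤-trans N≥N₃ N≤n) in
        subst (ℚ.∣ s m ℚ.* u m ℚ.- s n ℚ.* u n ∣ ℚ.≤_) η-eq
          (prod-dist (s m) (u m) (s n) (u n) (ℚ.<⇒≤ 0<η) (ℚ.<⇒≤ 0<C)
            (hB m (ℕ.≤-trans N≥N₁ N≤m)) (hC n (ℕ.≤-trans N≥N₂ N≤n)) h₁ h₂)

open Closure

infixl 7 _*ʳ_
infixl 6 _+ʳ_ _⊔ʳ_

_+ʳ_ _*ʳ_ _⊔ʳ_ : ℝ → ℝ → ℝ
x +ʳ y = mkℝ (λ n → seq x n ℚ.+ seq y n) (+-cauchy (seq x) (seq y) (cauchy x) (cauchy y))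
x *ʳ y = mkℝ (λ n → seq x n ℚ.* seq y n) (*-cauchy (seq x) (seq y) (cauchy x) (cauchy y))
x ⊔ʳ y = mkℝ (λ n → seq x n ℚ.⊔ seq y n) (⊔-cauchy (seq x) (seq y) (cauchy x) (cauchy y))

0ʳ 1ʳ : ℝ
0ʳ = fromℚ 0ℚ
1ʳ = fromℚ 1ℚ

------------------------------------------------------------------------
-- Square roots

climbOnce : (δ q r : ℚ) → ℚ
climbOnce δ q r = if (r ℚ.+ δ) ℚ.* (r ℚ.+ δ) ℚ.≤ᵇ q then r ℚ.+ δ else r

climb : (δ q : ℚ) → ℕ → ℚ
climb δ q zero    = 0ℚ
climb δ q (suc k) = climbOnce δ q (climb δ q k)

mesh : ℕ → ℚ
mesh n = + 1 ℚ./ suc n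

-- The largest multiple of 1/(n+1) whose square is at most q (0 if q < 0).
-- As q ≤ ∣ ↥ q ∣, this number of steps of size 1/(n+1) suffices to reach it.
sqrtℚ : ℕ → ℚ → ℚ
sqrtℚ n q = climb (mesh n) q (suc ℤ.∣ ↥ q ∣ ℕ.* suc n)

module Sqrt where

  natℚ : ℕ → ℚ
  natℚ k = mkℚ (+ k) 0 (Coprime.sym (Coprime.1-coprimeTo k))

  natℚ-suc : ∀ k → natℚ (suc k) ≡ natℚ k ℚ.+ 1ℚ
  natℚ-suc k = ℚ.toℚᵘ-injective (ℚᵘ.≃-trans (ℚᵘ.*≡* eq)
    (ℚᵘ.≃-sym (ℚ.toℚᵘ-homo-+ (natℚ k) 1ℚ)))
    where
    eq : + suc k ℤ.* (+ 1 ℤ.* + 1) ≡ (+ k ℤ.* + 1 ℤ.+ + 1 ℤ.* + 1) ℤ.* + 1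
    eq = trans (ℤ.*-identityʳ (+ suc k)) (trans (ℤ.+-comm (+ 1) (+ k))
      (sym (trans (ℤ.*-identityʳ (+ k ℤ.* + 1 ℤ.+ + 1))
                  (cong (ℤ._+ + 1) (ℤ.*-identityʳ (+ k))))))

  natℚ-* : ∀ j k → natℚ (j ℕ.* k) ≡ natℚ j ℚ.* natℚ k
  natℚ-* j k = ℚ.toℚᵘ-injective (ℚᵘ.≃-trans
    (ℚᵘ.*≡* (cong (ℤ._* + 1) (ℤ.pos-* j k)))
    (ℚᵘ.≃-sym (ℚ.toℚᵘ-homo-* (natℚ j) (natℚ k))))

  mesh-mkℚ : ∀ n → mesh n ≡ mkℚ (+ 1) n (Coprime.1-coprimeTo (suc n))
  mesh-mkℚ n = ℚ.normalize-coprime (Coprime.1-coprimeTo (suc n))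

  natℚ*mesh : ∀ n → natℚ (suc n) ℚ.* mesh n ≡ 1ℚ
  natℚ*mesh n = trans (cong (natℚ (suc n) ℚ.*_) (mesh-mkℚ n)) (ℚ.*-inverseʳ (natℚ (suc n)))

  0≤natℚ : ∀ k → 0ℚ ℚ.≤ natℚ k
  0≤natℚ k = ℚ.nonNegative⁻¹ (natℚ k)

  0≤mesh : ∀ n → 0ℚ ℚ.≤ mesh n
  0≤mesh n = subst (0ℚ ℚ.≤_) (sym (mesh-mkℚ n)) (ℚ.nonNegative⁻¹ _)

  q≤natℚ : ∀ q → q ℚ.≤ natℚ ℤ.∣ ↥ q ∣
  q≤natℚ (mkℚ (+ a) d _) = *≤* (subst₂ ℤ._≤_ (ℤ.pos-* a 1) (ℤ.pos-* a (suc d))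
    (ℤ.+≤+ (ℕ.*-monoʳ-≤ a (ℕ.s≤s ℕ.z≤n))))
  q≤natℚ (mkℚ (ℤ.-[1+ a ]) d _) = *≤* (subst (ℤ.-[1+ a ] ℤ.* + 1 ℤ.≤_) (ℤ.pos-* (suc a) (suc d)) ℤ.-≤+)

  mesh-small : ∀ h → 0ℚ ℚ.< h → ∃ λ N → ∀ n → N ℕ.≤ n → mesh n ℚ.≤ h
  mesh-small (mkℚ (+ zero) d _) (ℚ.*<* (ℤ.+<+ ()))
  mesh-small (mkℚ (+ suc p) d c) _ = d , λ n d≤n →
    subst (ℚ._≤ mkℚ (+ suc p) d c) (sym (mesh-mkℚ n))
      (*≤* (subst₂ ℤ._≤_ (ℤ.pos-* 1 (suc d)) (ℤ.pos-* (suc p) (suc n))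
        (ℤ.+≤+ (ℕ.*-mono-≤ {1} {suc p} (ℕ.s≤s ℕ.z≤n) (ℕ.s≤s d≤n)))))
  mesh-small (mkℚ (ℤ.-[1+ _ ]) d _) (ℚ.*<* ())

  sq-mono-≤ : ∀ {a b} → 0ℚ ℚ.≤ a → a ℚ.≤ b → a ℚ.* a ℚ.≤ b ℚ.* b
  sq-mono-≤ 0≤a a≤b = *-mono-≤ 0≤a (ℚ.≤-trans 0≤a a≤b) a≤b a≤b

  -- What a step of the climb from r to r′ may do.
  data Step (δ q r : ℚ) : ℚ → Set where
    up   : (r ℚ.+ δ) ℚ.* (r ℚ.+ δ) ℚ.≤ q → Step δ q r (r ℚ.+ δ)
    stay : q ℚ.< (r ℚ.+ δ) ℚ.* (r ℚ.+ δ) → Step δ q r r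

  step : ∀ δ q r → Step δ q r (climbOnce δ q r)
  step δ q r = go _ refl
    where
    go : ∀ b → ((r ℚ.+ δ) ℚ.* (r ℚ.+ δ) ℚ.≤ᵇ q) ≡ b → Step δ q r (if b then r ℚ.+ δ else r)
    go true  eq = up (ℚ.≤ᵇ⇒≤ (subst T (sym eq) _))
    go false eq = stay (ℚ.≰⇒> λ le → subst T eq (ℚ.≤⇒≤ᵇ le))

  record Climbed (δ q : ℚ) (k : ℕ) (r : ℚ) : Set where
    field
      nonNeg : 0ℚ ℚ.≤ r
      below  : r ≡ 0ℚ ⊎ r ℚ.* r ℚ.≤ q
      above  : r ≡ natℚ k ℚ.* δ ⊎ q ℚ.< (r ℚ.+ δ) ℚ.* (r ℚ.+ δ)

  open Climbed

  climbed : ∀ {δ} q → 0ℚ ℚ.≤ δ → ∀ k → Climbed δ q k (climb δ q k)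
  climbed {δ} q 0≤δ zero = record
    { nonNeg = ℚ.≤-refl ; below = inj₁ refl ; above = inj₁ (sym (ℚ.*-zeroˡ δ)) }
  climbed {δ} q 0≤δ (suc k) = next (climbed q 0≤δ k) (step δ q (climb δ q k))
    where
    next : ∀ {r r′} → Climbed δ q k r → Step δ q r r′ → Climbed δ q (suc k) r′
    next {r} c (up le) = record
      { nonNeg = ℚ.+-mono-≤ (nonNeg c) 0≤δ
      ; below  = inj₂ le
      ; above  = [ (λ eq → inj₁ (trans (cong (ℚ._+ δ) eq) (one-more (natℚ k)
                      (natℚ (suc k)) (natℚ-suc k))))
                 , (λ lt → contradiction (ℚ.<-≤-trans lt le) (ℚ.<-irrefl refl)) ]′ (above c)
      }
      where
      one-more : ∀ x y → y ≡ x ℚ.+ 1ℚ → x ℚ.* δ ℚ.+ δ ≡ y ℚ.* δ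
      one-more x _ refl = sym (trans (ℚ.*-distribʳ-+ δ x 1ℚ)
        (cong (x ℚ.* δ ℚ.+_) (ℚ.*-identityˡ δ)))
    next c (stay lt) = record
      { nonNeg = nonNeg c ; below = below c ; above = inj₂ lt }

  sqrtℚ-climbed : ∀ n q → Climbed (mesh n) q (suc ℤ.∣ ↥ q ∣ ℕ.* suc n) (sqrtℚ n q)
  sqrtℚ-climbed n q = climbed q (0≤mesh n) (suc ℤ.∣ ↥ q ∣ ℕ.* suc n)

  sqrtℚ-above : ∀ n q → q ℚ.< (sqrtℚ n q ℚ.+ mesh n) ℚ.* (sqrtℚ n q ℚ.+ mesh n)
  sqrtℚ-above n q = [ (λ eq → far (trans eq top)) , (λ lt → lt) ]′ (above (sqrtℚ-climbed n q))
    where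
    a : ℕ
    a = ℤ.∣ ↥ q ∣
    top : natℚ (suc a ℕ.* suc n) ℚ.* mesh n ≡ natℚ (suc a)
    top = trans (cong (ℚ._* mesh n) (natℚ-* (suc a) (suc n)))
      (trans (ℚ.*-assoc (natℚ (suc a)) (natℚ (suc n)) (mesh n))
      (trans (cong (natℚ (suc a) ℚ.*_) (natℚ*mesh n)) (ℚ.*-identityʳ (natℚ (suc a)))))
    a<a+1 : natℚ a ℚ.< natℚ (suc a)
    a<a+1 = subst₂ ℚ._<_ (ℚ.+-identityʳ (natℚ a)) (sym (natℚ-suc a))
      (ℚ.+-monoʳ-< (natℚ a) 0<1)
    1≤a+1 : 1ℚ ℚ.≤ natℚ (suc a)
    1≤a+1 = subst₂ ℚ._≤_ (ℚ.+-identityˡ 1ℚ) (sym (natℚ-suc a))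
      (ℚ.+-monoˡ-≤ 1ℚ (0≤natℚ a))
    a+1≤sq : natℚ (suc a) ℚ.≤ natℚ (suc a) ℚ.* natℚ (suc a)
    a+1≤sq = subst (ℚ._≤ natℚ (suc a) ℚ.* natℚ (suc a)) (ℚ.*-identityʳ (natℚ (suc a)))
      (*-mono-≤ (0≤natℚ (suc a)) (0≤natℚ (suc a)) ℚ.≤-refl 1≤a+1)
    far : ∀ {r} → r ≡ natℚ (suc a) → q ℚ.< (r ℚ.+ mesh n) ℚ.* (r ℚ.+ mesh n)
    far refl = ℚ.<-≤-trans (ℚ.≤-<-trans (q≤natℚ q) a<a+1)
      (ℚ.≤-trans a+1≤sq (sq-mono-≤ (0≤natℚ (suc a))
        (subst (ℚ._≤ natℚ (suc a) ℚ.+ mesh n) (ℚ.+-identityʳ (natℚ (suc a)))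
          (ℚ.+-monoʳ-≤ (natℚ (suc a)) (0≤mesh n)))))

  expand : ∀ b h → (b ℚ.+ (h ℚ.+ h)) ℚ.* (b ℚ.+ (h ℚ.+ h))
    ≡ ((b ℚ.+ h) ℚ.* (b ℚ.+ h) ℚ.+ h ℚ.* h) ℚ.+ (h ℚ.+ h) ℚ.* (b ℚ.+ h)
  expand = solve 2 (λ b h → ((b :+ (h :+ h)) :* (b :+ (h :+ h)))
    := ((((b :+ h) :* (b :+ h)) :+ (h :* h)) :+ ((h :+ h) :* (b :+ h)))) refl

  -- If a² ≤ p ≤ q + h² and q < (b + δ)² with δ ≤ h, then a ≤ b + 2h.
  root-close : ∀ {a b p q δ h} → 0ℚ ℚ.≤ b → 0ℚ ℚ.≤ δ → 0ℚ ℚ.≤ h → δ ℚ.≤ h →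
    a ≡ 0ℚ ⊎ a ℚ.* a ℚ.≤ p → q ℚ.< (b ℚ.+ δ) ℚ.* (b ℚ.+ δ) → p ℚ.≤ q ℚ.+ h ℚ.* h →
    a ℚ.≤ b ℚ.+ (h ℚ.+ h)
  root-close {a} {b} {p} {q} {δ} {h} 0≤b 0≤δ 0≤h δ≤h (inj₁ refl) _ _ =
    ℚ.+-mono-≤ 0≤b (ℚ.+-mono-≤ 0≤h 0≤h)
  root-close {a} {b} {p} {q} {δ} {h} 0≤b 0≤δ 0≤h δ≤h (inj₂ a²≤p) q<b² p≤q =
    ℚ.≮⇒≥ λ b+2h<a → ℚ.<-irrefl {a ℚ.* a} refl
      (ℚ.≤-<-trans (ℚ.≤-trans a²≤p p≤q)
      (ℚ.<-≤-trans (ℚ.+-monoˡ-< (h ℚ.* h) q<b²)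
      (ℚ.≤-trans (ℚ.+-monoˡ-≤ (h ℚ.* h)
        (sq-mono-≤ (ℚ.+-mono-≤ 0≤b 0≤δ) (ℚ.+-monoʳ-≤ b δ≤h)))
      (ℚ.≤-trans sum≤ (sq-mono-≤ (ℚ.+-mono-≤ 0≤b 0≤2h) (ℚ.<⇒≤ b+2h<a))))))
    where
    0≤2h : 0ℚ ℚ.≤ h ℚ.+ h
    0≤2h = ℚ.+-mono-≤ 0≤h 0≤h
    S : ℚ
    S = (b ℚ.+ h) ℚ.* (b ℚ.+ h) ℚ.+ h ℚ.* h
    sum≤ : S ℚ.≤ (b ℚ.+ (h ℚ.+ h)) ℚ.* (b ℚ.+ (h ℚ.+ h))
    sum≤ = subst₂ ℚ._≤_ (ℚ.+-identityʳ S) (sym (expand b h))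
      (ℚ.+-monoʳ-≤ S (subst (ℚ._≤ (h ℚ.+ h) ℚ.* (b ℚ.+ h)) (ℚ.*-zeroˡ 0ℚ)
        (*-mono-≤ ℚ.≤-refl (ℚ.+-mono-≤ 0≤b 0≤h) 0≤2h (ℚ.+-mono-≤ 0≤b 0≤h))))

  abstract
    sqrt-cauchy : ∀ s → IsCauchy s → IsCauchy (λ n → sqrtℚ n (s n))
    sqrt-cauchy s cs ε 0<ε =
      let h        = ε ℚ.* ½
          0<h      = *-pos 0<ε 0<½
          (N₁ , f) = cs (h ℚ.* h) (*-pos 0<h 0<h)
          (N₂ , g) = mesh-small h 0<h
          one-sided : ∀ m n → N₁ ℕ.⊔ N₂ ℕ.≤ m → N₁ ℕ.⊔ N₂ ℕ.≤ n →
                      sqrtℚ m (s m) ℚ.≤ sqrtℚ n (s n) ℚ.+ ε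
          one-sided m n N≤m N≤n = subst (λ e → sqrtℚ m (s m) ℚ.≤ sqrtℚ n (s n) ℚ.+ e) (halve ε)
            (root-close (nonNeg (sqrtℚ-climbed n (s n))) (0≤mesh n) (ℚ.<⇒≤ 0<h)
              (g n (ℕ.≤-trans (ℕ.m≤n⊔m N₁ N₂) N≤n))
              (below (sqrtℚ-climbed m (s m))) (sqrtℚ-above n (s n))
              (dist⇒≤ (f m n (ℕ.≤-trans (ℕ.m≤m⊔n N₁ N₂) N≤m) (ℕ.≤-trans (ℕ.m≤m⊔n N₁ N₂) N≤n))))
      in N₁ ℕ.⊔ N₂ , λ m n N≤m N≤n → ≤⇒dist (one-sided m n N≤m N≤n) (one-sided n m N≤n N≤m)

open Sqrt using (sqrt-cauchy)

-- The square root of a negative number is 0 by convention.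
√ʳ : ℝ → ℝ
√ʳ x = mkℝ (λ n → sqrtℚ n (seq x n)) (sqrt-cauchy (seq x) (cauchy x))

------------------------------------------------------------------------
-- Real matrices and γ₂

Matrix : Set → ℕ → ℕ → Set
Matrix A m n = Vector (Vector A n) m

Σʳ maxʳ : ∀ {n} → Vector ℝ n → ℝ
Σʳ   = foldr _+ʳ_ 0ʳ
-- Only applied to vectors of norms, which are nonnegative, so that starting
-- from 0 affects only the empty vector.
maxʳ = foldr _⊔ʳ_ 0ʳ

‖_‖₂ : ∀ {n} → Vector ℝ n → ℝ
‖ v ‖₂ = √ʳ (Σʳ (map (λ x → x *ʳ x) v))

‖_‖row ‖_‖col : ∀ {m n} → Matrix ℝ m n → ℝ
‖ U ‖row = maxʳ (map ‖_‖₂ U)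
‖ V ‖col = maxʳ (map ‖_‖₂ (transpose V))

infixl 7 _·_
_·_ : ∀ {m k n} → Matrix ℝ m k → Matrix ℝ k n → Matrix ℝ m n
(U · V) i j = Σʳ (zipWith _*ʳ_ (U i) (transpose V j))

infix 4 _≈ᴹ_
_≈ᴹ_ : ∀ {m n} → Matrix ℝ m n → Matrix ℝ m n → Set
A ≈ᴹ B = ∀ i j → A i j ≈ʳ B i j

-- γ₂(A) is a minimum over factorizations, so it is at most γ exactly when some
-- factorization A = UV has ‖U‖row ‖V‖col at most γ. The minimum itself is not
-- formed: that it is attained is a compactness fact, not available
-- constructively, and only upper bounds on it are needed.
γ₂[_]≤_ : ∀ {m n} → Matrix ℝ m n → ℝ → Set
γ₂[_]≤_ {m} {n} A γ = ∃ λ k → ∃₂ λ (U : Matrix ℝ m k) (V : Matrix ℝ k n) →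
  (U · V ≈ᴹ A) × (‖ U ‖row *ʳ ‖ V ‖col ≤ʳ γ)

------------------------------------------------------------------------
-- Boolean matrices

BoolMatrix : ℕ → ℕ → Set
BoolMatrix = Matrix Bool

MatrixFamily : (ℓ : Level) → Set (Level.suc ℓ)
MatrixFamily ℓ = ∀ m n → Pred (BoolMatrix m n) ℓ

toReal : ∀ {m n} → BoolMatrix m n → Matrix ℝ m n
toReal M i j = if M i j then 1ʳ else 0ʳ

bit : Bool → ℕ
bit b = if b then 1 else 0

-- The submatrix of M on the rows S and the columns T is all ones.
AllOnes : ∀ {m n} → BoolMatrix m n → Subset m → Subset n → Set
AllOnes M S T = ∀ {i j} → i ∈ S → j ∈ T → M i j ≡ true

ContainsAllOnes : ℕ → ∀ {m n} → BoolMatrix m n → Set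
ContainsAllOnes t M = ∃₂ λ S T → ∣ S ∣ ≡ t × ∣ T ∣ ≡ t × AllOnes M S T

-- The number of ones in row i, restricted to the columns T, and in column j,
-- restricted to the rows S.
onesInRow : ∀ {m n} → BoolMatrix m n → Subset n → Fin m → ℕ
onesInRow M T i = ∣ T ∩ tabulate (M i) ∣

onesInCol : ∀ {m n} → BoolMatrix m n → Subset m → Fin n → ℕ
onesInCol M S j = ∣ S ∩ tabulate (transpose M j) ∣

-- Submatrices have at least one row and one column: the 0 × 0 submatrix has
-- no row or column at all, and when just one dimension is 0 the condition
-- holds trivially.
EverySubmatrixSparse : ∀ {m n} → BoolMatrix m n → ℕ → Set
EverySubmatrixSparse M d = ∀ S T → Nonempty S → Nonempty T →
    (∃ λ i → i ∈ S × onesInRow M T i ℕ.≤ d)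
  ⊎ (∃ λ j → j ∈ T × onesInCol M S j ℕ.≤ d)

IsDegeneracy : ∀ {m n} → BoolMatrix m n → ℕ → Set
IsDegeneracy M d =
  EverySubmatrixSparse M d × (∀ e → EverySubmatrixSparse M e → d ℕ.≤ e)

DegeneracyAtMost : ∀ {m n} → BoolMatrix m n → ℕ → Set
DegeneracyAtMost M d = ∃ λ e → IsDegeneracy M e × e ℕ.≤ d

-- A partition of Fin n into parts 0, 1, …, k, of which only part 0 may be empty.
record Partition (n k : ℕ) : Set where
  field
    part     : Fin (suc k) → Subset n
    cover    : ∀ x → ∃ λ i → x ∈ part i
    disjoint : ∀ {x i j} → x ∈ part i → x ∈ part j → i ≡ j
    nonempty : ∀ i → Nonempty (part (suc i))

record Blocky {m n} (M : BoolMatrix m n) : Set where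
  field
    {blocks} : ℕ
    rows     : Partition m blocks
    cols     : Partition n blocks

  A : Fin (suc blocks) → Subset m
  A = Partition.part rows

  B : Fin (suc blocks) → Subset n
  B = Partition.part cols

  field
    ones  : ∀ i → AllOnes M (A (suc i)) (B (suc i))
    zeros : ∀ {i j} → i ≢ j ⊎ (i ≡ zero × j ≡ zero) →
            ∀ {x y} → x ∈ A i → y ∈ B j → M x y ≡ false

Thin : ∀ {m n} {M : BoolMatrix m n} → Blocky M → Set
Thin P = ∀ i → ∣ A (suc i) ∣ ≡ 1 ⊎ ∣ B (suc i) ∣ ≡ 1
  where open Blocky P

ThinBlocky : ∀ {m n} → BoolMatrix m n → Set
ThinBlocky M = ∃ λ (P : Blocky M) → Thin P

IsSumOfThinBlocky≤ : ℕ → ∀ {m n} → BoolMatrix m n → Set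
IsSumOfThinBlocky≤ b {m} {n} M =
  ∃ λ k → k ℕ.≤ b × ∃ λ (L : Vector (BoolMatrix m n) k) →
    (∀ l → ThinBlocky (L l)) ×
    (∀ i j → bit (M i j) ≡ sum (λ l → bit (L l i j)))

{-# OPTIONS --safe #-}
module Submission where

-- All three conditions are equivalent to having an orientation of bounded
-- outdegree: a division of the ones of M into R + C, where the rows of R and the
-- columns of C have at most c ones. Peeling off sparse rows and columns either
-- finds one or gets stuck at a submatrix in which every row and every column has
-- more than c ones. An orientation splits M into 2c matrices with at most one
-- one per row, or per column, and these are thin blocky; it also gives
-- γ₂(M) ≤ c + 1 through M = [R ∣ I] [I ; C].
--
-- For the converse from γ₂, let M i j = ⟨u i , v j⟩ with bounded vectors, and
-- suppose that some submatrix, nearly regular in its rows, has large degrees.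
-- Let Q be the two-step random walk column → row → column on it. As M has no
-- t × t all-ones submatrix, the walk from any column hits the neighbourhood of a
-- given row with small probability. So replacing v by v − Q v hardly changes
-- ⟨u i , v j⟩ on the edges, whereas by Cauchy-Schwarz it decreases the energy
-- Σ ∣v j∣² over the edges by a fixed fraction. After boundedly many rounds the
-- energy would be negative. Only finitely many entries are involved, so rational
-- approximations of u and v suffice.

open import Defs
open Closure using (eventually-bounded)
open Estimates using (*-mono-≤; *-pos; 0<1; ∣p∣≤; p≤∣p∣; dist⇒≤; dist-sym; split)
open Sqrt using
  ( natℚ; natℚ-suc; natℚ-*; natℚ*mesh; 0≤natℚ; q≤natℚ; mesh-mkℚ; 0≤mesh; mesh-small
  ; sq-mono-≤; module Climbed; sqrtℚ-climbed; sqrtℚ-above )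
open import Algebra.Bundles using (CommutativeRing; Monoid)
open import Data.Bool.Base using (Bool; true; false; not; _∧_; if_then_else_)
import Data.Bool.Properties as Bool
open import Data.Empty using (⊥; ⊥-elim)
open import Data.Fin.Base using (Fin; zero; suc; toℕ; splitAt; _↑ˡ_; _↑ʳ_)
import Data.Fin.Properties as Fin
open import Data.Fin.Subset using (Subset; ∣_∣; _∩_) renaming (_∈_ to _∈ˢ_)
open import Data.Fin.Subset.Properties using (_∈?_; anySubset?; nonempty?)
import Data.Integer.Base as ℤ
open import Data.Nat.Base
  using (ℕ; zero; suc; _+_; _*_; _∸_; _^_; _⊔_; _≤_; _<_; z≤n; s≤s; s≤s⁻¹; NonZero; >-nonZero)
import Data.Nat.Properties as ℕ
import Data.Nat.Solver as ℕ-Solver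
open import Data.Product using (∃; ∃₂; _×_; _,_; proj₁; proj₂)
open import Data.Rational.Base as ℚ using (ℚ; 0ℚ; 1ℚ; ½; ↥_)
import Data.Rational.Properties as ℚ
import Data.Rational.Solver as ℚ-Solver
open import Data.Sum.Base using (_⊎_; inj₁; inj₂; [_,_]′)
open import Data.Vec.Base using ([]; _∷_; lookup; tabulate)
open import Data.Vec.Functional as Vector using (Vector; transpose; _++_)
open import Data.Vec.Functional.Properties using (lookup-++ˡ; lookup-++ʳ)
open import Data.Vec.Properties using ([]=⇒lookup; lookup⇒[]=; lookup∘tabulate; lookup-zipWith)
open import Function.Base using (_∘_; case_of_)
open import Function.Bundles using (_⇔_; mk⇔)
open import Relation.Binary.PropositionalEquality
open import Relation.Nullary using (¬_; Dec; yes; no; does; contradiction; _×-dec_; _⊎-dec_)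
open import Relation.Nullary.Decidable using (dec-true; dec-false; decidable-stable; ¬?; map′)
open import Relation.Unary using (Decidable; _∈_)
open import Algebra.Properties.Semiring.Sum ℕ.+-*-semiring
  using (sum; ∑-distrib-+; ∑-comm; sum-cong-≗; sum-replicate-zero; *-distribˡ-sum; *-distribʳ-sum)
open import Algebra.Properties.Semiring.Sum (CommutativeRing.semiring ℚ.+-*-commutativeRing) as ∑ℚ
  using () renaming (sum to sumℚ)
open ℕ-Solver.+-*-Solver using ()
  renaming (solve to solveℕ; _:=_ to _⊜_; _:+_ to _⊕_; _:*_ to _⊗_; con to lit)
open ℚ-Solver.+-*-Solver using (solve; _:=_; _:+_; _:*_; _:-_; con) renaming (:-_ to ⊖_)

-- The mixing estimate uses degrees that agree up to a constant factor: few rows share many ones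
-- with row i because row i has O(d) ones while all rows and columns have at least d. Peeling alone
-- gives only the lower bound. The upper bound comes from extremality: take the largest c for which
-- M has a submatrix with all degrees above 4c. Then M is orientable with 4(c + 1), so that
-- submatrix has O(c) ones per row on average, provided that it has at least as many rows as
-- columns, which a transposition arranges. Discarding the rows of degree above 16(c + 1) and
-- peeling again leaves degrees above c.
--
-- The constants are fixed in the order γ, g, number of rounds, E, D. An energy of at most β per
-- edge loses at least 1/(4α) per edge in each round, and αβ ≤ g, hence 4g + 1 rounds. The deviation
-- of the inner products can double in each round, so a mixing error of order 1/E is affordable when
-- E is exponential in the number of rounds. The absence of t × t all-ones submatrices yields that
-- error once the degrees exceed D, which is exponential in tE.

private
  variable
    c k m n : ℕ

-- Counting with Boolean vectors

sum-mono : {f g : Vector ℕ n} → (∀ i → f i ≤ g i) → sum f ≤ sum g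
sum-mono {zero}  f≤g = z≤n
sum-mono {suc n} f≤g = ℕ.+-mono-≤ (f≤g zero) (sum-mono (f≤g ∘ suc))

∧-true⁻ : ∀ {a b} → a ∧ b ≡ true → a ≡ true × b ≡ true
∧-true⁻ {a} {b} eq = Bool.∧-conicalˡ a b eq , Bool.∧-conicalʳ a b eq

∧-true⁺ : ∀ {a b} → a ≡ true → b ≡ true → a ∧ b ≡ true
∧-true⁺ refl refl = refl

bit-mono : ∀ {a b} → (a ≡ true → b ≡ true) → bit a ≤ bit b
bit-mono {false} h = z≤n
bit-mono {true}  h rewrite h refl = s≤s z≤n

infix 4 _⊑_
_⊑_ : Vector Bool n → Vector Bool n → Set
f ⊑ g = ∀ i → f i ≡ true → g i ≡ true

infix 8 #_
-- Sets of rows and columns are Boolean vectors and their sizes are sums of bits, so that double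
-- counting is an exchange of two sums.
#_ : Vector Bool n → ℕ
# f = sum (bit ∘ f)

#-mono : {f g : Vector Bool n} → f ⊑ g → # f ≤ # g
#-mono f⊑g = sum-mono (bit-mono ∘ f⊑g)

#-cong : {f g : Vector Bool n} → f ≗ g → # f ≡ # g
#-cong f≗g = sum-cong-≗ (cong bit ∘ f≗g)

#-mono-< : {f g : Vector Bool n} → f ⊑ g → ∀ i → f i ≡ false → g i ≡ true → # f < # g
#-mono-< f⊑g zero    fi gi rewrite fi | gi = s≤s (#-mono (f⊑g ∘ suc))
#-mono-< f⊑g (suc i) fi gi = ℕ.+-mono-≤-< (bit-mono (f⊑g zero)) (#-mono-< (f⊑g ∘ suc) i fi gi)

#≤n : (f : Vector Bool n) → # f ≤ n
#≤n {zero}  f = z≤n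
#≤n {suc n} f = ℕ.+-mono-≤ (bit≤1 (f zero)) (#≤n (f ∘ suc))
  where
  bit≤1 : ∀ b → bit b ≤ 1
  bit≤1 true  = s≤s z≤n
  bit≤1 false = z≤n

#-empty : {f : Vector Bool n} → (∀ i → f i ≢ true) → # f ≡ 0
#-empty {zero}  h = refl
#-empty {suc n} {f} h rewrite Bool.¬-not (h zero) = #-empty (h ∘ suc)

#-pos : {f : Vector Bool n} → ∀ i → f i ≡ true → 0 < # f
#-pos {n} {f} i fi = ℕ.≤-<-trans z≤n (#-mono-< {f = λ _ → false} (λ _ ()) i refl fi)

#-witness : {f : Vector Bool n} → 0 < # f → ∃ λ i → f i ≡ true
#-witness {suc n} {f} h with f zero in eq
... | true  = zero , eq
... | false = let (i , fi) = #-witness h in suc i , fi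

remove : Fin n → Vector Bool n → Vector Bool n
remove i f x = if does (x Fin.≟ i) then false else f x

remove-⊑ : ∀ i (f : Vector Bool n) → remove i f ⊑ f
remove-⊑ i f x eq with does (x Fin.≟ i)
... | false = eq
remove-⊑ i f x () | true

#-remove : ∀ i {f : Vector Bool n} → f i ≡ true → # remove i f < # f
#-remove i {f} fi = #-mono-< (remove-⊑ i f) i removed fi
  where
  removed : remove i f i ≡ false
  removed rewrite dec-true (i Fin.≟ i) refl = refl

-- Sparse orientations and dense submatrices

record Rich (c : ℕ) (M : BoolMatrix m n) (σ : Vector Bool m) (τ : Vector Bool n) : Set where
  field
    someRow : ∃ λ i → σ i ≡ true
    someCol : ∃ λ j → τ j ≡ true
    rows    : ∀ i → σ i ≡ true → c < # (λ j → τ j ∧ M i j)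
    cols    : ∀ j → τ j ≡ true → c < # (λ i → σ i ∧ M i j)

RichWithin : ℕ → BoolMatrix m n → Vector Bool m → Vector Bool n → Set
RichWithin c M σ τ = ∃₂ λ σ′ τ′ → σ′ ⊑ σ × τ′ ⊑ τ × Rich c M σ′ τ′

-- Every one of M is charged to its row (byRow) or to its column.
record Orientation (c : ℕ) (M : BoolMatrix m n) (σ : Vector Bool m) (τ : Vector Bool n) : Set where
  field
    byRow : BoolMatrix m n
    rows  : ∀ i → σ i ≡ true → # (λ j → τ j ∧ M i j ∧ byRow i j) ≤ c
    cols  : ∀ j → τ j ≡ true → # (λ i → σ i ∧ M i j ∧ not (byRow i j)) ≤ c

all : Vector Bool n
all _ = true

Orientation-transpose : {M : BoolMatrix m n} {σ : Vector Bool m} {τ : Vector Bool n} →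
  Orientation c M σ τ → Orientation c (transpose M) τ σ
Orientation-transpose {M = M} {σ} {τ} o = record
  { byRow = λ j i → not (byRow i j)
  ; rows  = cols
  ; cols  = λ i σi → subst (_≤ _)
      (#-cong λ j → cong (λ b → τ j ∧ M i j ∧ b) (sym (Bool.not-involutive (byRow i j))))
      (rows i σi)
  }
  where open Orientation o

Orientation-weaken : ∀ {c d} {M : BoolMatrix m n} {σ : Vector Bool m} {τ : Vector Bool n} →
  c ≤ d → Orientation c M σ τ → Orientation d M σ τ
Orientation-weaken c≤d o = record
  { byRow = byRow
  ; rows  = λ i σi → ℕ.≤-trans (rows i σi) c≤d
  ; cols  = λ j τj → ℕ.≤-trans (cols j τj) c≤d
  }
  where open Orientation o

Orientation-restrict : {M : BoolMatrix m n} {σ σ′ : Vector Bool m} {τ τ′ : Vector Bool n} →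
  σ′ ⊑ σ → τ′ ⊑ τ → Orientation c M σ τ → Orientation c M σ′ τ′
Orientation-restrict σ′⊑σ τ′⊑τ o = record
  { byRow = byRow
  ; rows  = λ i σi → ℕ.≤-trans
      (#-mono λ j eq → let (t , r) = ∧-true⁻ eq in ∧-true⁺ (τ′⊑τ j t) r) (rows i (σ′⊑σ i σi))
  ; cols  = λ j τj → ℕ.≤-trans
      (#-mono λ i eq → let (s , r) = ∧-true⁻ eq in ∧-true⁺ (σ′⊑σ i s) r) (cols j (τ′⊑τ j τj))
  }
  where open Orientation o

-- All ones of the returned row are charged to that row, where there are at most `c` of them, so no
-- column count grows.
Orientation-addRow : {M : BoolMatrix m n} {σ : Vector Bool m} {τ : Vector Bool n} → ∀ i →
  # (λ j → τ j ∧ M i j) ≤ c → Orientation c M (remove i σ) τ → Orientation c M σ τ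
Orientation-addRow {m} {n} {c} {M} {σ} {τ} i deg≤c o = record
  { byRow = byRow′ ; rows = rows′ ; cols = cols′ }
  where
  open Orientation o
  byRow′ : BoolMatrix m n
  byRow′ x y = if does (x Fin.≟ i) then true else byRow x y
  rows′ : ∀ x → σ x ≡ true → # (λ j → τ j ∧ M x j ∧ byRow′ x j) ≤ c
  rows′ x σx with x Fin.≟ i | rows x
  ... | yes refl | _ = subst (_≤ c)
    (#-cong λ j → cong (τ j ∧_) (sym (Bool.∧-identityʳ (M i j)))) deg≤c
  ... | no _     | h = h σx
  cols′ : ∀ y → τ y ≡ true → # (λ x → σ x ∧ M x y ∧ not (byRow′ x y)) ≤ c
  cols′ y τy = ℕ.≤-trans (#-mono charged) (cols y τy)
    where
    charged : (λ x → σ x ∧ M x y ∧ not (byRow′ x y)) ⊑ (λ x → remove i σ x ∧ M x y ∧ not (byRow x y))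
    charged x eq with does (x Fin.≟ i)
    ... | false = eq
    ... | true  = contradiction (proj₂ (∧-true⁻ {M x y} (proj₂ (∧-true⁻ {σ x} eq)))) λ ()

Orientation-addCol : {M : BoolMatrix m n} {σ : Vector Bool m} {τ : Vector Bool n} → ∀ j →
  # (λ i → σ i ∧ M i j) ≤ c → Orientation c M σ (remove j τ) → Orientation c M σ τ
Orientation-addCol j deg≤c o =
  Orientation-transpose (Orientation-addRow j deg≤c (Orientation-transpose o))

Orientation-empty : {M : BoolMatrix m n} {σ : Vector Bool m} {τ : Vector Bool n} →
  (∀ i → σ i ≢ true) → Orientation c M σ τ
Orientation-empty {c = c} {M = M} {σ} ∄i = record
  { byRow = λ _ _ → true
  ; rows  = λ i σi → contradiction σi (∄i i)
  ; cols  = λ j _ → subst (_≤ c)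
      (sym (#-empty {f = λ i → σ i ∧ M i j ∧ false} λ i eq → ∄i i (proj₁ (∧-true⁻ eq)))) z≤n
  }

-- The alternatives are not exclusive: for `c = 1` the 2 × 2 all-ones matrix satisfies both. An
-- orientation excludes only `Rich (c + c)`, whence the factors of two in the translations between
-- the conditions.
dichotomy : ∀ c (M : BoolMatrix m n) σ τ → RichWithin c M σ τ ⊎ Orientation c M σ τ
dichotomy c M σ τ = go _ σ τ ℕ.≤-refl
  where
  widen : ∀ {σ σ′ τ τ′} → σ′ ⊑ σ → τ′ ⊑ τ → RichWithin c M σ′ τ′ → RichWithin c M σ τ
  widen s t (_ , _ , s′ , t′ , r) = _ , _ , (λ i → s i ∘ s′ i) , (λ j → t j ∘ t′ j) , r

  -- `k` bounds the number of rows and columns left and decreases with each removal, which makes the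
  -- recursion structural.
  go : ∀ k σ τ → # σ + # τ ≤ k → RichWithin c M σ τ ⊎ Orientation c M σ τ
  go k σ τ le with Fin.any? (λ i → σ i Bool.≟ true) | Fin.any? (λ j → τ j Bool.≟ true)
  ... | no ∄i | _     = inj₂ (Orientation-empty λ i σi → ∄i (i , σi))
  ... | yes _ | no ∄j = inj₂ (Orientation-transpose (Orientation-empty λ j τj → ∄j (j , τj)))
  ... | yes someRow | yes someCol
      with Fin.any? (λ i → (σ i Bool.≟ true) ×-dec (# (λ j → τ j ∧ M i j) ℕ.≤? c))
         | Fin.any? (λ j → (τ j Bool.≟ true) ×-dec (# (λ i → σ i ∧ M i j) ℕ.≤? c))
  go zero σ τ le | yes (i , σi) | _ | yes _ | _ =
    contradiction (ℕ.≤-trans (ℕ.≤-trans (#-pos i σi) (ℕ.m≤m+n _ _)) le) λ ()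
  go zero σ τ le | yes (i , σi) | _ | no _ | yes _ =
    contradiction (ℕ.≤-trans (ℕ.≤-trans (#-pos i σi) (ℕ.m≤m+n _ _)) le) λ ()
  go (suc k) σ τ le | _ | _ | yes (i , σi , deg≤c) | _ =
    case go k (remove i σ) τ (s≤s⁻¹ (ℕ.<-≤-trans (ℕ.+-monoˡ-< (# τ) (#-remove i σi)) le)) of λ where
      (inj₁ r) → inj₁ (widen (remove-⊑ i σ) (λ _ t → t) r)
      (inj₂ o) → inj₂ (Orientation-addRow i deg≤c o)
  go (suc k) σ τ le | _ | _ | no _ | yes (j , τj , deg≤c) =
    case go k σ (remove j τ) (s≤s⁻¹ (ℕ.<-≤-trans (ℕ.+-monoʳ-< (# σ) (#-remove j τj)) le)) of λ where
      (inj₁ r) → inj₁ (widen (λ _ s → s) (remove-⊑ j τ) r)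
      (inj₂ o) → inj₂ (Orientation-addCol j deg≤c o)
  go k σ τ le | yes someRow | yes someCol | no ∄row | no ∄col =
    inj₁ (σ , τ , (λ _ s → s) , (λ _ t → t) , record
      { someRow = someRow
      ; someCol = someCol
      ; rows    = λ i σi → ℕ.≰⇒> λ deg≤c → ∄row (i , σi , deg≤c)
      ; cols    = λ j τj → ℕ.≰⇒> λ deg≤c → ∄col (j , τj , deg≤c)
      })

edges : BoolMatrix m n → Vector Bool m → Vector Bool n → ℕ
edges M σ τ = sum λ i → # (λ j → σ i ∧ τ j ∧ M i j)

edges-transpose : (M : BoolMatrix m n) → ∀ σ τ → edges M σ τ ≡ edges (transpose M) τ σ
edges-transpose M σ τ = trans (∑-comm (λ i j → bit (σ i ∧ τ j ∧ M i j)))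
  (sum-cong-≗ λ j → #-cong λ i → swap (σ i) (τ j))
  where
  swap : ∀ a b {x} → a ∧ b ∧ x ≡ b ∧ a ∧ x
  swap false false = refl
  swap false true  = refl
  swap true  false = refl
  swap true  true  = refl

∑-guard-≤ : (σ : Vector Bool m) (f : BoolMatrix m n) → (∀ i → σ i ≡ true → # f i ≤ c) →
  sum (λ i → # (λ j → σ i ∧ f i j)) ≤ # σ * c
∑-guard-≤ {m} {n} {c} σ f h = subst (_ ≤_) (sym (*-distribʳ-sum c (bit ∘ σ)))
  (sum-mono λ i → guard (σ i) (h i))
  where
  guard : ∀ b {g : Vector Bool n} → (b ≡ true → # g ≤ c) → # (λ j → b ∧ g j) ≤ bit b * c
  guard false h = ℕ.≤-reflexive (sum-replicate-zero n)
  guard true  h = ℕ.≤-trans (h refl) (ℕ.m≤m+n c 0)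

∑-guard-≥ : (σ : Vector Bool m) (f : BoolMatrix m n) → (∀ i → σ i ≡ true → c ≤ # f i) →
  # σ * c ≤ sum (λ i → # (λ j → σ i ∧ f i j))
∑-guard-≥ {m} {n} {c} σ f h = subst (_≤ _) (sym (*-distribʳ-sum c (bit ∘ σ)))
  (sum-mono λ i → guard (σ i) (h i))
  where
  guard : ∀ b {g : Vector Bool n} → (b ≡ true → c ≤ # g) → bit b * c ≤ # (λ j → b ∧ g j)
  guard false h = z≤n
  guard true  h = ℕ.≤-trans (ℕ.≤-reflexive (ℕ.+-identityʳ c)) (h refl)

-- Each one is counted among the at most `c` charged to its row or among the at most `c` charged to
-- its column.
Orientation⇒edges≤ : {M : BoolMatrix m n} {σ : Vector Bool m} {τ : Vector Bool n} →
  Orientation c M σ τ → edges M σ τ ≤ c * (# σ + # τ)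
Orientation⇒edges≤ {m} {n} {c} {M} {σ} {τ} o = begin
  edges M σ τ
    ≤⟨ sum-mono (λ i → sum-mono (λ j → charge (σ i) (τ j) (M i j) (byRow i j))) ⟩
  sum (λ i → sum (λ j → bit (σ i ∧ R i j) + bit (τ j ∧ C j i)))
    ≡⟨ sum-cong-≗ (λ i → ∑-distrib-+ (λ j → bit (σ i ∧ R i j)) (λ j → bit (τ j ∧ C j i))) ⟩
  sum (λ i → # (λ j → σ i ∧ R i j) + # (λ j → τ j ∧ C j i))
    ≡⟨ ∑-distrib-+ (λ i → # (λ j → σ i ∧ R i j)) (λ i → # (λ j → τ j ∧ C j i)) ⟩
  sum (λ i → # (λ j → σ i ∧ R i j)) + sum (λ i → # (λ j → τ j ∧ C j i))
    ≡⟨ cong (sum (λ i → # (λ j → σ i ∧ R i j)) +_) (∑-comm (λ i j → bit (τ j ∧ C j i))) ⟩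
  sum (λ i → # (λ j → σ i ∧ R i j)) + sum (λ j → # (λ i → τ j ∧ C j i))
    ≤⟨ ℕ.+-mono-≤ (∑-guard-≤ σ R rows) (∑-guard-≤ τ C cols) ⟩
  # σ * c + # τ * c
    ≡⟨ trans (sym (ℕ.*-distribʳ-+ c (# σ) (# τ))) (ℕ.*-comm (# σ + # τ) c) ⟩
  c * (# σ + # τ) ∎
  where
  open ℕ.≤-Reasoning
  open Orientation o
  R : BoolMatrix m n
  R i j = τ j ∧ M i j ∧ byRow i j
  C : BoolMatrix n m
  C j i = σ i ∧ M i j ∧ not (byRow i j)
  charge : ∀ s t x r → bit (s ∧ t ∧ x) ≤ bit (s ∧ t ∧ x ∧ r) + bit (t ∧ s ∧ x ∧ not r)
  charge false t     x     r     = z≤n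
  charge true  false x     r     = z≤n
  charge true  true  false r     = z≤n
  charge true  true  true  true  = s≤s z≤n
  charge true  true  true  false = s≤s z≤n

-- Adding up all row degrees and all column degrees counts every one twice. With degrees of at least
-- 2c + 1 the result exceeds twice the allowed number of ones, strictly so because the submatrix is
-- nonempty.
¬Rich-if-few-edges : {M : BoolMatrix m n} {σ : Vector Bool m} {τ : Vector Bool n} →
  edges M σ τ ≤ c * (# σ + # τ) → ¬ Rich (c + c) M σ τ
¬Rich-if-few-edges {m} {n} {c} {M} {σ} {τ} few r = ℕ.<-irrefl refl (begin-strict
  (c + c) * s+t               <⟨ ℕ.+-monoˡ-< ((c + c) * s+t) 0<s+t ⟩
  s+t + (c + c) * s+t         ≡⟨ ℕ.*-comm (suc (c + c)) s+t ⟩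
  s+t * suc (c + c)           ≡⟨ ℕ.*-distribʳ-+ (suc (c + c)) (# σ) (# τ) ⟩
  # σ * suc (c + c) + # τ * suc (c + c)
    ≤⟨ ℕ.+-mono-≤ (∑-guard-≥ σ (λ i j → τ j ∧ M i j) rows)
                  (∑-guard-≥ τ (λ j i → σ i ∧ M i j) cols) ⟩
  edges M σ τ + edges (transpose M) τ σ
    ≡⟨ cong (edges M σ τ +_) (sym (edges-transpose M σ τ)) ⟩
  edges M σ τ + edges M σ τ   ≤⟨ ℕ.+-mono-≤ few few ⟩
  c * s+t + c * s+t           ≡⟨ sym (ℕ.*-distribʳ-+ s+t c c) ⟩
  (c + c) * s+t               ∎)
  where
  open ℕ.≤-Reasoning
  open Rich r
  s+t : ℕ
  s+t = # σ + # τ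
  0<s+t : 0 < s+t
  0<s+t = ℕ.≤-trans (#-pos {f = σ} _ (proj₂ someRow)) (ℕ.m≤m+n (# σ) (# τ))

-- Degeneracy

∈⇒lookup : {S : Subset n} → ∀ {i} → i ∈ˢ S → lookup S i ≡ true
∈⇒lookup = []=⇒lookup

lookup⇒∈ : {S : Subset n} → ∀ {i} → lookup S i ≡ true → i ∈ˢ S
lookup⇒∈ {S = S} {i} = lookup⇒[]= i S

∈-tabulate⁺ : {f : Vector Bool n} → ∀ {i} → f i ≡ true → i ∈ˢ tabulate f
∈-tabulate⁺ {f = f} {i} fi = lookup⇒∈ (trans (lookup∘tabulate f i) fi)

∈-tabulate⁻ : {f : Vector Bool n} → ∀ {i} → i ∈ˢ tabulate f → f i ≡ true
∈-tabulate⁻ {f = f} {i} i∈ = trans (sym (lookup∘tabulate f i)) (∈⇒lookup i∈)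

∣∣≡# : (S : Subset n) → ∣ S ∣ ≡ # lookup S
∣∣≡# []          = refl
∣∣≡# (true  ∷ S) = cong suc (∣∣≡# S)
∣∣≡# (false ∷ S) = ∣∣≡# S

∣tabulate∣ : (f : Vector Bool n) → ∣ tabulate f ∣ ≡ # f
∣tabulate∣ f = trans (∣∣≡# (tabulate f)) (#-cong (lookup∘tabulate f))

onesInRow≡ : (M : BoolMatrix m n) → ∀ T i → onesInRow M T i ≡ # (λ j → lookup T j ∧ M i j)
onesInRow≡ M T i = trans (∣∣≡# (T ∩ tabulate (M i))) (#-cong λ j →
  trans (lookup-zipWith _∧_ j T (tabulate (M i)))
        (cong (lookup T j ∧_) (lookup∘tabulate (M i) j)))

onesInRow-tabulate : (M : BoolMatrix m n) → ∀ τ i →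
  onesInRow M (tabulate τ) i ≡ # (λ j → τ j ∧ M i j)
onesInRow-tabulate M τ i = trans (onesInRow≡ M (tabulate τ) i)
  (#-cong λ j → cong (_∧ M i j) (lookup∘tabulate τ j))

Sparse⇒Orientation : {M : BoolMatrix m n} → EverySubmatrixSparse M c → Orientation c M all all
Sparse⇒Orientation {c = c} {M} sparse with dichotomy c M all all
... | inj₂ o = o
... | inj₁ (σ , τ , _ , _ , r) =
  ⊥-elim ([ (λ (i , i∈ , few) → ℕ.<⇒≱ (rows i (∈-tabulate⁻ i∈))
              (subst (_≤ c) (onesInRow-tabulate M τ i) few))
          , (λ (j , j∈ , few) → ℕ.<⇒≱ (cols j (∈-tabulate⁻ j∈))
              (subst (_≤ c) (onesInRow-tabulate (transpose M) σ j) few))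
          ]′ (sparse (tabulate σ) (tabulate τ)
                (_ , ∈-tabulate⁺ (proj₂ someRow)) (_ , ∈-tabulate⁺ (proj₂ someCol))))
  where open Rich r

sparseAt? : (M : BoolMatrix m n) (c : ℕ) → ∀ S T →
  Dec ((∃ λ i → i ∈ˢ S × onesInRow M T i ≤ c) ⊎ (∃ λ j → j ∈ˢ T × onesInCol M S j ≤ c))
sparseAt? M c S T =
  Fin.any? (λ i → (i ∈? S) ×-dec (onesInRow M T i ℕ.≤? c)) ⊎-dec
  Fin.any? (λ j → (j ∈? T) ×-dec (onesInCol M S j ℕ.≤? c))

few-edges⇒Sparse : {M : BoolMatrix m n} → (∀ σ τ → edges M σ τ ≤ c * (# σ + # τ)) →
  EverySubmatrixSparse M (c + c)
few-edges⇒Sparse {c = c} {M} few S T (i₀ , i₀∈S) (j₀ , j₀∈T) =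
  decidable-stable (sparseAt? M (c + c) S T) λ dense →
    ¬Rich-if-few-edges {c = c} (few (lookup S) (lookup T)) record
      { someRow = i₀ , ∈⇒lookup i₀∈S
      ; someCol = j₀ , ∈⇒lookup j₀∈T
      ; rows    = λ i i∈S → ℕ.≰⇒> λ le → dense (inj₁
          (i , lookup⇒∈ i∈S , subst (_≤ c + c) (sym (onesInRow≡ M T i)) le))
      ; cols    = λ j j∈T → ℕ.≰⇒> λ le → dense (inj₂
          (j , lookup⇒∈ j∈T , subst (_≤ c + c) (sym (onesInRow≡ (transpose M) S j)) le))
      }

-- `DegeneracyAtMost` asks for the exact degeneracy, a least number. It can be searched for because
-- only finitely many submatrices have to be inspected.
Sparse? : (M : BoolMatrix m n) → Decidable (EverySubmatrixSparse M)
Sparse? M c = map′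
  (λ ∄ S T S≠∅ T≠∅ → decidable-stable (sparseAt? M c S T) λ dense → ∄ (S , T , S≠∅ , T≠∅ , dense))
  (λ sparse (S , T , S≠∅ , T≠∅ , dense) → dense (sparse S T S≠∅ T≠∅))
  (¬? (anySubset? λ S → anySubset? λ T →
    nonempty? S ×-dec nonempty? T ×-dec ¬? (sparseAt? M c S T)))

least : ∀ {P : ℕ → Set} → Decidable P → ∀ n → P n →
  ∃ λ e → (P e × (∀ k → P k → e ≤ k)) × e ≤ n
least P? n Pn with P? zero
... | yes P0 = zero , (P0 , λ _ _ → z≤n) , z≤n
least P? zero    Pn | no ¬P0 = contradiction Pn ¬P0
least P? (suc n) Pn | no ¬P0 =
  let (e , (Pe , min) , e≤n) = least (P? ∘ suc) n Pn in
  suc e , (Pe , λ { zero P0 → contradiction P0 ¬P0 ; (suc k) Pk → s≤s (min k Pk) }) , s≤s e≤n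

Orientation⇒degeneracy : {M : BoolMatrix m n} → Orientation c M all all → DegeneracyAtMost M (c + c)
Orientation⇒degeneracy {c = c} {M} o = least (Sparse? M) (c + c) (few-edges⇒Sparse {c = c} {M} λ σ τ →
  Orientation⇒edges≤ (Orientation-restrict (λ _ _ → refl) (λ _ _ → refl) o))

degeneracy⇒Orientation : {M : BoolMatrix m n} → DegeneracyAtMost M c → Orientation c M all all
degeneracy⇒Orientation (e , (sparse , _) , e≤c) = Orientation-weaken e≤c (Sparse⇒Orientation sparse)

-- Thin blocky matrices

#-singleton : (i : Fin n) → # (λ j → does (j Fin.≟ i)) ≡ 1
#-singleton {suc n} zero    = cong suc (#-empty {n} {f = λ _ → false} λ _ ())
#-singleton (suc i) = #-singleton i

#≤1 : {f : Vector Bool n} → (∀ i j → f i ≡ true → f j ≡ true → i ≡ j) → # f ≤ 1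
#≤1 {n} {f} unique = ℕ.≮⇒≥ λ 1<#f →
  let (i , fi) = #-witness {f = f} (ℕ.<-trans (s≤s z≤n) 1<#f)
      dropped : f ⊑ (λ j → does (j Fin.≟ i))
      dropped j fj = dec-true (j Fin.≟ i) (unique j i fj fi)
  in ℕ.<⇒≱ 1<#f (ℕ.≤-trans (#-mono dropped) (ℕ.≤-reflexive (#-singleton i)))
does-true : ∀ {p} {P : Set p} {P? : Dec P} → does P? ≡ true → P
does-true {P? = yes p} _ = p

∣S∣≡1⇒unique : {S : Subset n} → ∣ S ∣ ≡ 1 → ∀ {i j} → i ∈ˢ S → j ∈ˢ S → i ≡ j
∣S∣≡1⇒unique {S = S} ∣S∣≡1 {i} {j} i∈S j∈S = decidable-stable (i Fin.≟ j) λ i≢j →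
  ℕ.<⇒≱ (#-remove i {lookup S} (∈⇒lookup i∈S))
    (ℕ.≤-trans (ℕ.≤-reflexive (trans (sym (∣∣≡# S)) ∣S∣≡1))
      (#-pos {f = remove i (lookup S)} j
        (trans (cong (if_then false else lookup S j) (dec-false (j Fin.≟ i) (i≢j ∘ sym))) (∈⇒lookup j∈S))))

module _ {M : BoolMatrix m n} (P : Blocky M) where
  open Blocky P

  blockOf : ∀ {x y} → M x y ≡ true → ∃ λ i → x ∈ˢ A (suc i) × y ∈ˢ B (suc i)
  blockOf {x} {y} eq with Partition.cover rows x | Partition.cover cols y
  ... | i , x∈A | j , y∈B with i Fin.≟ j
  ...   | no i≢j = contradiction (trans (sym eq) (zeros (inj₁ i≢j) x∈A y∈B)) λ ()
  blockOf eq | zero  , x∈A | _ , y∈B | yes refl =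
    contradiction (trans (sym eq) (zeros (inj₂ (refl , refl)) x∈A y∈B)) λ ()
  blockOf eq | suc i , x∈A | _ , y∈B | yes refl = i , x∈A , y∈B

  -- A one is charged to its row when the block of that row has a single column. Otherwise thinness
  -- makes the block a single row, and the column contains no other one.
  Thin⇒Orientation : Thin P → Orientation 1 M all all
  Thin⇒Orientation thin = record
    { byRow = byRow′
    ; rows  = λ x _ → #≤1 (rowUnique x)
    ; cols  = λ y _ → #≤1 (colUnique y)
    }
    where
    inColumnBlock? : ∀ x → Dec (∃ λ i → x ∈ˢ A (suc i) × ∣ B (suc i) ∣ ≡ 1)
    inColumnBlock? x = Fin.any? λ i → (x ∈? A (suc i)) ×-dec (∣ B (suc i) ∣ ℕ.≟ 1)
    byRow′ : BoolMatrix m n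
    byRow′ x y = does (inColumnBlock? x)
    rowUnique : ∀ x y z → M x y ∧ byRow′ x y ≡ true → M x z ∧ byRow′ x z ≡ true → y ≡ z
    rowUnique x y z My Mz
      with blockOf (proj₁ (∧-true⁻ My)) | blockOf (proj₁ (∧-true⁻ Mz))
         | does-true {P? = inColumnBlock? x} (proj₂ (∧-true⁻ {M x y} My))
    ... | i , x∈Ai , y∈Bi | j , x∈Aj , z∈Bj | k , x∈Ak , ∣Bk∣≡1
      with Partition.disjoint rows x∈Ai x∈Ak | Partition.disjoint rows x∈Aj x∈Ak
    ... | refl | refl = ∣S∣≡1⇒unique ∣Bk∣≡1 y∈Bi z∈Bj
    colUnique : ∀ y x z → M x y ∧ not (byRow′ x y) ≡ true → M z y ∧ not (byRow′ z y) ≡ true → x ≡ z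
    colUnique y x z Mx Mz
      with blockOf (proj₁ (∧-true⁻ Mx)) | blockOf (proj₁ (∧-true⁻ Mz))
    ... | i , x∈Ai , y∈Bi | j , z∈Aj , y∈Bj
      with Partition.disjoint cols y∈Bi y∈Bj
    ... | refl with thin i
    ...   | inj₁ ∣A∣≡1 = ∣S∣≡1⇒unique ∣A∣≡1 x∈Ai z∈Aj
    ...   | inj₂ ∣B∣≡1 = contradiction
      (trans (sym (proj₂ (∧-true⁻ {M x y} Mx)))
             (cong not (dec-true (inColumnBlock? x) (i , x∈Ai , ∣B∣≡1)))) λ ()

sum-≤-const : ∀ {k c} {f : Vector ℕ k} → (∀ i → f i ≤ c) → sum f ≤ k * c
sum-≤-const {zero}  f≤c = z≤n
sum-≤-const {suc k} f≤c = ℕ.+-mono-≤ (f≤c zero) (sum-≤-const (f≤c ∘ suc))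

-- The number of ones in a submatrix is additive over the summands, and each summand has an
-- orientation with bound 1, which every submatrix inherits.
thinSum⇒few-edges : {M : BoolMatrix m n} → IsSumOfThinBlocky≤ c M →
  ∀ σ τ → edges M σ τ ≤ c * (# σ + # τ)
thinSum⇒few-edges {m} {n} {c} {M} (k , k≤c , L , thinL , M≡ΣL) σ τ = begin
  edges M σ τ
    ≡⟨ sum-cong-≗ (λ i → sum-cong-≗ λ j → spread (σ i) (τ j) (M≡ΣL i j)) ⟩
  sum (λ i → sum λ j → sum λ l → bit (σ i ∧ τ j ∧ L l i j))
    ≡⟨ sum-cong-≗ (λ i → ∑-comm (λ j l → bit (σ i ∧ τ j ∧ L l i j))) ⟩
  sum (λ i → sum λ l → # (λ j → σ i ∧ τ j ∧ L l i j))
    ≡⟨ ∑-comm (λ i l → # (λ j → σ i ∧ τ j ∧ L l i j)) ⟩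
  sum (λ l → edges (L l) σ τ)
    ≤⟨ sum-≤-const (λ l → Orientation⇒edges≤
         (Orientation-restrict (λ _ _ → refl) (λ _ _ → refl)
           (Thin⇒Orientation (proj₁ (thinL l)) (proj₂ (thinL l))))) ⟩
  k * (1 * (# σ + # τ))
    ≤⟨ ℕ.*-mono-≤ k≤c (ℕ.≤-reflexive (ℕ.*-identityˡ (# σ + # τ))) ⟩
  c * (# σ + # τ) ∎
  where
  open ℕ.≤-Reasoning
  spread : ∀ s t {x} {y : Vector Bool k} → bit x ≡ sum (bit ∘ y) →
    bit (s ∧ t ∧ x) ≡ sum (λ l → bit (s ∧ t ∧ y l))
  spread false t     eq = sym (sum-replicate-zero k)
  spread true  false eq = sym (sum-replicate-zero k)
  spread true  true  eq = eq

thinSum⇒Orientation : {M : BoolMatrix m n} → IsSumOfThinBlocky≤ c M → Orientation (c + c) M all all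
thinSum⇒Orientation {c = c} {M} S with dichotomy (c + c) M all all
... | inj₂ o = o
... | inj₁ (σ , τ , _ , _ , r) = contradiction r (¬Rich-if-few-edges {c = c} (thinSum⇒few-edges S σ τ))

-- Splitting an orientation into thin blocky matrices

-- The parts of a `Partition` other than part 0 must be nonempty, so the blocks have to be numbered
-- by the nonzero columns alone.
record Enumeration (f : Vector Bool n) : Set where
  field
    size      : ℕ
    at        : Fin size → Fin n
    holds     : ∀ i → f (at i) ≡ true
    found     : ∀ j → f j ≡ true → ∃ λ i → at i ≡ j
    injective : ∀ {i j} → at i ≡ at j → i ≡ j

enumerate : (f : Vector Bool n) → Enumeration f
enumerate {zero}  f = record
  { size = 0 ; at = λ () ; holds = λ () ; found = λ () ; injective = λ {} }
enumerate {suc n} f with f zero in f0 | enumerate (f ∘ suc)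
... | false | e = record
  { size      = size
  ; at        = suc ∘ at
  ; holds     = holds
  ; found     = λ { zero fj → contradiction (trans (sym f0) fj) λ ()
                  ; (suc j) fj → let (i , eq) = found j fj in i , cong suc eq }
  ; injective = injective ∘ Fin.suc-injective
  }
  where open Enumeration e
... | true | e = record
  { size      = suc size
  ; at        = λ { zero → zero ; (suc i) → suc (at i) }
  ; holds     = λ { zero → f0 ; (suc i) → holds i }
  ; found     = λ { zero _ → zero , refl
                  ; (suc j) fj → let (i , eq) = found j fj in suc i , cong suc eq }
  ; injective = λ { {zero} {zero} _ → refl ; {suc i} {suc j} eq → cong suc (injective (Fin.suc-injective eq)) }
  }
  where open Enumeration e

-- A matrix with at most one one in each row has the fibres of its nonzero
-- columns as blocks.
module _ (F : BoolMatrix m n) (unique : ∀ x y z → F x y ≡ true → F x z ≡ true → y ≡ z) where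

  private
    nonzeroRow? : ∀ x → Dec (∃ λ y → F x y ≡ true)
    nonzeroRow? x = Fin.any? λ y → F x y Bool.≟ true

    nonzeroCol? : ∀ y → Dec (∃ λ x → F x y ≡ true)
    nonzeroCol? y = Fin.any? λ x → F x y Bool.≟ true

    open Enumeration (enumerate (does ∘ nonzeroCol?))

    witness : ∀ i → ∃ λ x → F x (at i) ≡ true
    witness i = does-true {P? = nonzeroCol? (at i)} (holds i)

    numbered : ∀ {x y} → F x y ≡ true → ∃ λ i → at i ≡ y
    numbered {x} {y} Fxy = found y (dec-true (nonzeroCol? y) (x , Fxy))

    rowPart : Fin (suc size) → Vector Bool m
    rowPart zero    x = not (does (nonzeroRow? x))
    rowPart (suc i) x = F x (at i)

    colPart : Fin (suc size) → Vector Bool n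
    colPart zero    y = not (does (nonzeroCol? y))
    colPart (suc i) y = does (y Fin.≟ at i)

    rowDisjoint : ∀ {x} i j → rowPart i x ≡ true → rowPart j x ≡ true → i ≡ j
    rowDisjoint zero zero p q = refl
    rowDisjoint {x} (suc i) zero p q =
      contradiction (trans (sym q) (cong not (dec-true (nonzeroRow? x) (_ , p)))) λ ()
    rowDisjoint {x} zero (suc j) p q =
      contradiction (trans (sym p) (cong not (dec-true (nonzeroRow? x) (_ , q)))) λ ()
    rowDisjoint (suc i) (suc j) p q = cong suc (injective (unique _ _ _ p q))

    colDisjoint : ∀ {y} i j → colPart i y ≡ true → colPart j y ≡ true → i ≡ j
    colDisjoint zero zero p q = refl
    colDisjoint {y} (suc i) zero p q with does-true {P? = y Fin.≟ at i} p
    ... | refl = contradiction (trans (sym q) (cong not (holds i))) λ ()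
    colDisjoint {y} zero (suc j) p q with does-true {P? = y Fin.≟ at j} q
    ... | refl = contradiction (trans (sym p) (cong not (holds j))) λ ()
    colDisjoint {y} (suc i) (suc j) p q = cong suc (injective
      (trans (sym (does-true {P? = y Fin.≟ at i} p)) (does-true {P? = y Fin.≟ at j} q)))

    rowCover : ∀ x → ∃ λ i → rowPart i x ≡ true
    rowCover x with nonzeroRow? x in eq
    ... | no _          = zero , cong (not ∘ does) eq
    ... | yes (y , Fxy) = let (i , at≡) = numbered Fxy in
      suc i , trans (cong (F x) at≡) Fxy

    colCover : ∀ y → ∃ λ i → colPart i y ≡ true
    colCover y with nonzeroCol? y in eq
    ... | no _          = zero , cong (not ∘ does) eq
    ... | yes (x , Fxy) = let (i , at≡) = numbered Fxy in
      suc i , dec-true (y Fin.≟ at i) (sym at≡)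

    blockRow : ∀ i j {x y} → rowPart i x ≡ true → colPart j y ≡ true → F x y ≡ true →
      ∃ λ k → i ≡ suc k × j ≡ suc k
    blockRow i j {x} {y} x∈ y∈ Fxy = let (k , at≡) = numbered Fxy in
      k , rowDisjoint i (suc k) x∈ (trans (cong (F x) at≡) Fxy)
        , colDisjoint j (suc k) y∈ (dec-true (y Fin.≟ at k) (sym at≡))

  uniqueInRows⇒Blocky : Blocky F
  uniqueInRows⇒Blocky = record
    { rows = record
      { part     = tabulate ∘ rowPart
      ; cover    = λ x → let (i , p) = rowCover x in i , ∈-tabulate⁺ p
      ; disjoint = λ {x} {i} {j} p q → rowDisjoint i j (∈-tabulate⁻ p) (∈-tabulate⁻ q)
      ; nonempty = λ i → let (x , p) = witness i in x , ∈-tabulate⁺ p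
      }
    ; cols = record
      { part     = tabulate ∘ colPart
      ; cover    = λ y → let (i , p) = colCover y in i , ∈-tabulate⁺ p
      ; disjoint = λ {y} {i} {j} p q → colDisjoint i j (∈-tabulate⁻ p) (∈-tabulate⁻ q)
      ; nonempty = λ i → at i , ∈-tabulate⁺ (dec-true (at i Fin.≟ at i) refl)
      }
    ; ones  = λ i {x} {y} p q →
        trans (cong (F x) (does-true {P? = y Fin.≟ at i} (∈-tabulate⁻ q))) (∈-tabulate⁻ p)
    ; zeros = λ {i} {j} distinct p q → Bool.¬-not λ Fxy →
        case blockRow i j (∈-tabulate⁻ p) (∈-tabulate⁻ q) Fxy of λ where
          (k , refl , refl) → [ (λ k≢k → k≢k refl) , (λ ()) ]′ distinct
    }

  uniqueInRows⇒ThinBlocky : ThinBlocky F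
  uniqueInRows⇒ThinBlocky = uniqueInRows⇒Blocky , λ i → inj₂
    (trans (∣tabulate∣ (colPart (suc i))) (#-singleton (at i)))

ThinBlocky-transpose : {M : BoolMatrix m n} → ThinBlocky M → ThinBlocky (transpose M)
ThinBlocky-transpose (P , thin) = record
  { rows  = cols
  ; cols  = rows
  ; ones  = λ i p q → ones i q p
  ; zeros = λ where
      (inj₁ i≢j) p q        → zeros (inj₁ (i≢j ∘ sym)) q p
      (inj₂ (i≡0 , j≡0)) p q → zeros (inj₂ (j≡0 , i≡0)) q p
  } , λ i → [ inj₂ , inj₁ ]′ (thin i)
  where open Blocky P

firstOne afterFirstOne : Vector Bool n → Vector Bool n
firstOne {suc n} f zero    = f zero
firstOne {suc n} f (suc j) = if f zero then false else firstOne (f ∘ suc) j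
afterFirstOne {suc n} f zero    = false
afterFirstOne {suc n} f (suc j) = if f zero then f (suc j) else afterFirstOne (f ∘ suc) j

firstOne-split : (f : Vector Bool n) → ∀ j →
  bit (f j) ≡ bit (firstOne f j) + bit (afterFirstOne f j)
firstOne-split {suc n} f zero    = sym (ℕ.+-identityʳ _)
firstOne-split {suc n} f (suc j) with f zero
... | true  = refl
... | false = firstOne-split (f ∘ suc) j

firstOne-unique : (f : Vector Bool n) → ∀ i j → firstOne f i ≡ true → firstOne f j ≡ true → i ≡ j
firstOne-unique {suc n} f zero    zero    _ _ = refl
firstOne-unique {suc n} f zero    (suc j) p q with f zero
firstOne-unique {suc n} f zero    (suc j) _ () | true
firstOne-unique {suc n} f zero    (suc j) () _ | false
firstOne-unique {suc n} f (suc i) zero    p q with f zero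
firstOne-unique {suc n} f (suc i) zero    () _ | true
firstOne-unique {suc n} f (suc i) zero    _ () | false
firstOne-unique {suc n} f (suc i) (suc j) p q with f zero
firstOne-unique {suc n} f (suc i) (suc j) () _ | true
firstOne-unique {suc n} f (suc i) (suc j) p q  | false = cong suc (firstOne-unique (f ∘ suc) i j p q)

#-afterFirstOne : (f : Vector Bool n) → # f ≤ suc c → # afterFirstOne f ≤ c
#-afterFirstOne {zero}  f le = z≤n
#-afterFirstOne {suc n} f le with f zero
... | true  = s≤s⁻¹ le
... | false = #-afterFirstOne (f ∘ suc) le

-- Keeps only the one of `f` that has exactly `l` ones before it, if there is such a one.
layer : ℕ → Vector Bool n → Vector Bool n
layer zero    f = firstOne f
layer (suc l) f = layer l (afterFirstOne f)

layer-unique : ∀ l (f : Vector Bool n) → ∀ i j → layer l f i ≡ true → layer l f j ≡ true → i ≡ j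
layer-unique zero    f = firstOne-unique f
layer-unique (suc l) f = layer-unique l (afterFirstOne f)

∑-layers : ∀ c (f : Vector Bool n) → # f ≤ c → ∀ j → bit (f j) ≡ sum {c} (λ l → bit (layer (toℕ l) f j))
∑-layers zero f #f≤0 j with f j in eq
... | false = refl
... | true  = contradiction (ℕ.<-≤-trans (#-pos j eq) #f≤0) λ ()
∑-layers (suc c) f #f≤c j = trans (firstOne-split f j)
  (cong (bit (firstOne f j) +_) (∑-layers c (afterFirstOne f) (#-afterFirstOne f #f≤c) j))

module _ {a ℓ} (𝕄 : Monoid a ℓ) where
  open Monoid 𝕄
  open import Algebra.Properties.Monoid.Sum 𝕄 renaming (sum to ∑)

  sum-splitAt : ∀ k l (f : Vector Carrier (k + l)) →
    ∑ f ≈ (∑ (λ i → f (i ↑ˡ l)) ∙ ∑ (λ i → f (k ↑ʳ i)))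
  sum-splitAt zero    l f = Monoid.sym 𝕄 (identityˡ _)
  sum-splitAt (suc k) l f =
    Monoid.trans 𝕄 (∙-congˡ (sum-splitAt k l (f ∘ suc))) (Monoid.sym 𝕄 (assoc _ _ _))

Orientation⇒thinSum : {M : BoolMatrix m n} → Orientation c M all all → IsSumOfThinBlocky≤ (c + c) M
Orientation⇒thinSum {m} {n} {c} {M} o = c + c , ℕ.≤-refl , L , thinL , λ i j → begin
  bit (M i j)
    ≡⟨ charge (M i j) (byRow i j) ⟩
  bit (R i j) + bit (C j i)
    ≡⟨ cong₂ _+_ (∑-layers c (R i) (rows i refl) j) (∑-layers c (C j) (cols j refl) i) ⟩
  sum (λ l → bit (Lᴿ l i j)) + sum (λ l → bit (Lᶜ l i j))
    ≡⟨ sym (cong₂ _+_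
         (sum-cong-≗ λ l → cong (λ N → bit (N i j)) (lookup-++ˡ Lᴿ Lᶜ l))
         (sum-cong-≗ λ l → cong (λ N → bit (N i j)) (lookup-++ʳ Lᴿ Lᶜ l))) ⟩
  sum (λ l → bit (L (l ↑ˡ c) i j)) + sum (λ l → bit (L (c ↑ʳ l) i j))
    ≡⟨ sym (sum-splitAt ℕ.+-0-monoid c c (λ l → bit (L l i j))) ⟩
  sum (λ l → bit (L l i j)) ∎
  where
  open ≡-Reasoning
  open Orientation o
  R : BoolMatrix m n
  R i j = M i j ∧ byRow i j
  C : BoolMatrix n m
  C j i = M i j ∧ not (byRow i j)
  Lᴿ Lᶜ : Vector (BoolMatrix m n) c
  Lᴿ l i j = layer (toℕ l) (R i) j
  Lᶜ l i j = layer (toℕ l) (C j) i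
  L : Vector (BoolMatrix m n) (c + c)
  L = Lᴿ ++ Lᶜ
  thinL : ∀ l → ThinBlocky (L l)
  thinL l with splitAt c l
  ... | inj₁ k = uniqueInRows⇒ThinBlocky (Lᴿ k) λ i → layer-unique (toℕ k) (R i)
  ... | inj₂ k = ThinBlocky-transpose
    (uniqueInRows⇒ThinBlocky (transpose (Lᶜ k)) λ j → layer-unique (toℕ k) (C j))
  charge : ∀ x r → bit x ≡ bit (x ∧ r) + bit (x ∧ not r)
  charge false r     = refl
  charge true  true  = refl
  charge true  false = refl

#-split : (f g : Vector Bool n) → # f ≡ # (λ i → f i ∧ g i) + # (λ i → f i ∧ not (g i))
#-split f g = trans (sum-cong-≗ λ i → at (f i) (g i))
  (∑-distrib-+ (λ i → bit (f i ∧ g i)) (λ i → bit (f i ∧ not (g i))))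
  where
  at : ∀ a b → bit a ≡ bit (a ∧ b) + bit (a ∧ not b)
  at false b     = refl
  at true  true  = refl
  at true  false = refl

-- Passing to nearly regular rows

edges-mono : (M : BoolMatrix m n) {σ σ′ : Vector Bool m} → ∀ τ → σ ⊑ σ′ → edges M σ τ ≤ edges M σ′ τ
edges-mono {n = n} M τ σ⊑σ′ = sum-mono λ i → #-mono {n = n} λ j eq →
  let (s , r) = ∧-true⁻ eq in ∧-true⁺ (σ⊑σ′ i s) r

-- As an orientation bounds the number of ones, at most half of the rows have
-- degree above 16 (c + 1), and the others carry too many ones for an orientation
-- with the smaller bound c.
regular-rows : (M : BoolMatrix m n) → ∀ {σ τ} → Rich (4 * c) M σ τ → Orientation (4 * suc c) M σ τ →
  # τ ≤ # σ → ∃₂ λ σ′ τ′ → Rich c M σ′ τ′ × (∀ i → σ′ i ≡ true → # (λ j → τ′ j ∧ M i j) ≤ 16 * suc c)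
regular-rows {m} {n} {c} M {σ} {τ} rich o #τ≤#σ with dichotomy c M light τ
  where
  light? : Vector Bool m
  light? i = does (# (λ j → τ j ∧ M i j) ℕ.≤? 16 * suc c)
  light : Vector Bool m
  light i = σ i ∧ light? i
... | inj₁ (σ′ , τ′ , σ′⊑light , τ′⊑τ , rich′) = σ′ , τ′ , rich′ , λ i σ′i → ℕ.≤-trans
  (#-mono λ j eq → let (t , r) = ∧-true⁻ eq in ∧-true⁺ (τ′⊑τ j t) r)
  (does-true {P? = _ ℕ.≤? _} (proj₂ (∧-true⁻ {σ i} (σ′⊑light i σ′i))))
... | inj₂ o′ = ⊥-elim (ℕ.<⇒≱ 4cx<edges edges≤)
  where
  open ℕ.≤-Reasoning
  open Rich rich
  d : ℕ
  d = suc c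
  light? light heavy : Vector Bool m
  light? i = does (# (λ j → τ j ∧ M i j) ℕ.≤? 16 * d)
  light i = σ i ∧ light? i
  heavy i = σ i ∧ not (light? i)
  x y s t : ℕ
  x = # light
  y = # heavy
  s = # σ
  t = # τ
  heavy-degree : ∀ i → heavy i ≡ true → 16 * d ≤ # (λ j → τ j ∧ M i j)
  heavy-degree i eq = ℕ.≰⇒≥ λ le → contradiction
    (trans (sym (proj₂ (∧-true⁻ {σ i} eq))) (cong not (dec-true (_ ℕ.≤? _) le))) λ ()
  y*8d≤ : (y + y) * (8 * d) ≤ s * (8 * d)
  y*8d≤ = begin
    (y + y) * (8 * d)    ≡⟨ solveℕ 2 (λ y d → (y ⊕ y) ⊗ (lit 8 ⊗ d) ⊜ y ⊗ (lit 16 ⊗ d)) refl y d ⟩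
    y * (16 * d)         ≤⟨ ∑-guard-≥ heavy (λ i j → τ j ∧ M i j) heavy-degree ⟩
    edges M heavy τ      ≤⟨ edges-mono M {heavy} {σ} τ (λ i → proj₁ ∘ ∧-true⁻) ⟩
    edges M σ τ          ≤⟨ Orientation⇒edges≤ o ⟩
    4 * d * (s + t)      ≤⟨ ℕ.*-monoʳ-≤ (4 * d) (ℕ.+-monoʳ-≤ s #τ≤#σ) ⟩
    4 * d * (s + s)      ≡⟨ solveℕ 2 (λ s d → lit 4 ⊗ d ⊗ (s ⊕ s) ⊜ s ⊗ (lit 8 ⊗ d)) refl s d ⟩
    s * (8 * d)          ∎
  s≡x+y : s ≡ x + y
  s≡x+y = #-split σ light?
  y≤x : y ≤ x
  y≤x = ℕ.+-cancelʳ-≤ y y x (ℕ.≤-trans (ℕ.*-cancelʳ-≤ (y + y) s (8 * d) y*8d≤) (ℕ.≤-reflexive s≡x+y))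
  s≤2x : s ≤ x + x
  s≤2x = ℕ.≤-trans (ℕ.≤-reflexive s≡x+y) (ℕ.+-monoʳ-≤ x y≤x)
  0<x : 0 < x
  0<x = ℕ.n≢0⇒n>0 λ x≡0 → ℕ.<⇒≱ (#-pos {f = σ} _ (proj₂ someRow))
    (subst (λ x → s ≤ x + x) x≡0 s≤2x)
  edges≤ : edges M light τ ≤ x * (4 * c)
  edges≤ = begin
    edges M light τ      ≤⟨ Orientation⇒edges≤ o′ ⟩
    -- Here x + t ≤ 3x, as the light rows are at least half of `σ` and `τ` is no larger than `σ`.
    -- The factor 4 in `Rich (4 * c)` leaves room for this.
    c * (x + t)          ≤⟨ ℕ.*-monoʳ-≤ c (ℕ.+-monoʳ-≤ x (ℕ.≤-trans #τ≤#σ s≤2x)) ⟩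
    c * (x + (x + x))    ≤⟨ ℕ.*-monoʳ-≤ c (ℕ.m≤n+m (x + (x + x)) x) ⟩
    c * (x + (x + (x + x)))  ≡⟨ solveℕ 2 (λ c x → c ⊗ (x ⊕ (x ⊕ (x ⊕ x))) ⊜ x ⊗ (lit 4 ⊗ c)) refl c x ⟩
    x * (4 * c)          ∎
  4cx<edges : x * (4 * c) < edges M light τ
  4cx<edges = begin-strict
    x * (4 * c)          <⟨ ℕ.m<m+n (x * (4 * c)) 0<x ⟩
    x * (4 * c) + x      ≡⟨ solveℕ 2 (λ x k → x ⊗ k ⊕ x ⊜ x ⊗ (lit 1 ⊕ k)) refl x (4 * c) ⟩
    x * suc (4 * c)      ≤⟨ ∑-guard-≥ light (λ i j → τ j ∧ M i j) (λ i eq → rows i (proj₁ (∧-true⁻ eq))) ⟩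
    edges M light τ      ∎

-- Rows with large intersections

shrink : ∀ k (f : Vector Bool n) → k ≤ # f → ∃ λ g → g ⊑ f × # g ≡ k
shrink {n} zero f _ = (λ _ → false) , (λ _ ()) , #-empty {n} {f = λ _ → false} λ _ ()
shrink {suc n} (suc k) f k<#f with f zero in f0
... | true  = let (g , g⊑f , #g) = shrink k (f ∘ suc) (s≤s⁻¹ k<#f) in
  true Vector.∷ g , (λ { zero _ → f0 ; (suc i) → g⊑f i }) , cong suc #g
... | false = let (g , g⊑f , #g) = shrink (suc k) (f ∘ suc) k<#f in
  false Vector.∷ g , (λ { (suc i) → g⊑f i }) , #g

-- Pigeonhole on the 2 ^ # ν patterns of the columns X on the rows ν.
common-pattern : ∀ {t} (M : BoolMatrix m n) ν X s → 0 < t →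
  (∀ j → X j ≡ true → s ≤ # (λ i → ν i ∧ M i j)) → t * 2 ^ # ν ≤ # X →
  ∃₂ λ σ τ → # σ ≡ s × # τ ≡ t × τ ⊑ X × (∀ i j → σ i ≡ true → τ j ≡ true → M i j ≡ true)
common-pattern {m} {t = t} M ν X zero 0<t h le =
  let (τ , τ⊑X , #τ) = shrink t X (ℕ.≤-trans (ℕ.m≤m*n t (2 ^ # ν) {{ℕ.m^n≢0 2 (# ν)}}) le)
  in (λ _ → false) , τ , #-empty {m} {f = λ _ → false} (λ _ ()) , #τ , τ⊑X , λ _ _ ()
common-pattern {zero} {t = t} M ν X (suc s) 0<t h le =
  let (j , Xj) = #-witness {f = X} (ℕ.<-≤-trans (subst (0 <_) (sym (ℕ.*-identityʳ t)) 0<t) le)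
  in contradiction (h j Xj) λ ()
common-pattern {suc m} {n} {t} M ν X (suc s) 0<t h le with ν zero
... | false =
  let (σ , τ , #σ , #τ , τ⊑X , ones) = common-pattern (M ∘ suc) (ν ∘ suc) X (suc s) 0<t h le
  in false Vector.∷ σ , τ , #σ , #τ , τ⊑X , λ { (suc i) → ones i }
-- Row zero divides the columns `X` into two classes, one of which keeps half of the required
-- number. Only the class with a one there adds the row to `σ` and lowers `s`.
... | true with t * 2 ^ # (ν ∘ suc) ℕ.≤? # (λ j → X j ∧ M zero j)
...   | yes le₁ =
  let (σ , τ , #σ , #τ , τ⊑X₁ , ones) = common-pattern (M ∘ suc) (ν ∘ suc) (λ j → X j ∧ M zero j) s 0<t
        (λ j X₁j → let (Xj , M₀j) = ∧-true⁻ X₁j in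
          s≤s⁻¹ (subst (λ b → suc s ≤ bit b + # (λ i → ν (suc i) ∧ M (suc i) j)) M₀j (h j Xj))) le₁
  in true Vector.∷ σ , τ , cong suc #σ , #τ , (λ j → proj₁ ∘ ∧-true⁻ ∘ τ⊑X₁ j)
    , λ { zero j _ τj → proj₂ (∧-true⁻ {X j} (τ⊑X₁ j τj)) ; (suc i) → ones i }
...   | no ≰₁ =
  let (σ , τ , #σ , #τ , τ⊑X₀ , ones) = common-pattern (M ∘ suc) (ν ∘ suc) (λ j → X j ∧ not (M zero j)) (suc s) 0<t
        (λ j X₀j → let (Xj , ¬M₀j) = ∧-true⁻ X₀j in
          subst (λ b → suc s ≤ bit b + # (λ i → ν (suc i) ∧ M (suc i) j)) (Bool.not-injective ¬M₀j) (h j Xj)) le₀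
  in false Vector.∷ σ , τ , #σ , #τ , (λ j → proj₁ ∘ ∧-true⁻ ∘ τ⊑X₀ j) , λ { (suc i) → ones i }
  where
  p : ℕ
  p = t * 2 ^ # (ν ∘ suc)
  le₀ : p ≤ # (λ j → X j ∧ not (M zero j))
  le₀ = ℕ.≮⇒≥ λ <₀ → ℕ.<⇒≱ (ℕ.+-mono-< (ℕ.≰⇒> ≰₁) <₀) (begin
    p + p   ≡⟨ solveℕ 2 (λ t q → t ⊗ q ⊕ t ⊗ q ⊜ t ⊗ (lit 2 ⊗ q)) refl t (2 ^ # (ν ∘ suc)) ⟩
    t * 2 ^ suc (# (ν ∘ suc))  ≤⟨ le ⟩
    # X     ≡⟨ #-split X (M zero) ⟩
    # (λ j → X j ∧ M zero j) + # (λ j → X j ∧ not (M zero j)) ∎)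
    where open ℕ.≤-Reasoning

allOnes⇒Contains : {M : BoolMatrix m n} → ∀ {t σ τ} → # σ ≡ t → # τ ≡ t →
  (∀ i j → σ i ≡ true → τ j ≡ true → M i j ≡ true) → ContainsAllOnes t M
allOnes⇒Contains {σ = σ} {τ} #σ #τ ones = tabulate σ , tabulate τ
  , trans (∣tabulate∣ σ) #σ , trans (∣tabulate∣ τ) #τ
  , λ i∈ j∈ → ones _ _ (∈-tabulate⁻ i∈) (∈-tabulate⁻ j∈)

-- Double counting of the ones in the rows ν and the columns X, split at the
-- columns with at least t of them.
few-overlapping-rows : ∀ {t E d} (M : BoolMatrix m n) → 0 < t → 0 < E → ¬ ContainsAllOnes t M →
  2 * E * (t * 2 ^ (32 * t * E)) ≤ d → ∀ ν X → # X ≤ 16 * d →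
  (∀ i → ν i ≡ true → d ≤ E * # (λ j → X j ∧ M i j)) → # ν < 32 * t * E
few-overlapping-rows {m} {n} {t} {E} {d} M 0<t 0<E free d-large ν₀ X #X≤ overlaps₀ =
  ℕ.≰⇒> λ N≤#ν₀ → let (ν , ν⊑ν₀ , #ν) = shrink N ν₀ N≤#ν₀ in
    contains ν #ν (λ i νi → overlaps₀ i (ν⊑ν₀ i νi))
  where
  -- With this many rows, the columns outside `Z` contribute at most E · 16d · t = N · d / 2 to the
  -- double count. The other half forces at least d / (2E) columns into `Z`, enough for the
  -- pigeonhole.
  N : ℕ
  N = 32 * t * E
  contains : ∀ ν → # ν ≡ N → (∀ i → ν i ≡ true → d ≤ E * # (λ j → X j ∧ M i j)) → ⊥
  contains ν #ν overlaps =
    let (σ , τ , #σ , #τ , _ , ones) = common-pattern M ν Z t 0<t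
          (λ j Zj → does-true {P? = t ℕ.≤? # (λ i → ν i ∧ M i j)} (proj₂ (∧-true⁻ {X j} Zj)))
          (subst (λ N → t * 2 ^ N ≤ # Z) (sym #ν) many-columns)
    in free (allOnes⇒Contains #σ #τ ones)
    where
    open ℕ.≤-Reasoning
    Z : Vector Bool n
    Z j = X j ∧ does (t ℕ.≤? # (λ i → ν i ∧ M i j))
    below : N * d ≤ E * edges M ν X
    below = begin
      N * d                              ≡⟨ cong (_* d) (sym #ν) ⟩
      # ν * d                            ≡⟨ *-distribʳ-sum d (bit ∘ ν) ⟩
      sum (λ i → bit (ν i) * d)          ≤⟨ sum-mono (λ i → at (ν i) (overlaps i)) ⟩
      sum (λ i → E * # (λ j → ν i ∧ X j ∧ M i j))
        ≡⟨ *-distribˡ-sum E (λ i → # (λ j → ν i ∧ X j ∧ M i j)) ⟨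
      E * edges M ν X                    ∎
      where
      at : ∀ b {f : Vector Bool n} → (b ≡ true → d ≤ E * # f) → bit b * d ≤ E * # (λ j → b ∧ f j)
      at false h = z≤n
      at true  h = ℕ.≤-trans (ℕ.≤-reflexive (ℕ.+-identityʳ d)) (h refl)
    above : edges M ν X ≤ # Z * N + # X * t
    above = begin
      edges M ν X                        ≡⟨ edges-transpose M ν X ⟩
      sum (λ j → # (λ i → X j ∧ ν i ∧ M i j))
        ≤⟨ sum-mono (λ j → at (X j) (λ i → ν i ∧ M i j) λ i → proj₁ ∘ ∧-true⁻) ⟩
      sum (λ j → bit (Z j) * N + bit (X j) * t)
        ≡⟨ ∑-distrib-+ (λ j → bit (Z j) * N) (λ j → bit (X j) * t) ⟩
      sum (λ j → bit (Z j) * N) + sum (λ j → bit (X j) * t)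
        ≡⟨ cong₂ _+_ (sym (*-distribʳ-sum N (bit ∘ Z))) (sym (*-distribʳ-sum t (bit ∘ X))) ⟩
      # Z * N + # X * t                  ∎
      where
      at : ∀ b (f : Vector Bool m) → f ⊑ ν →
        # (λ i → b ∧ f i) ≤ bit (b ∧ does (t ℕ.≤? # f)) * N + bit b * t
      at false f f⊑ν = ℕ.≤-reflexive (#-empty {f = λ (i : Fin m) → false} λ _ ())
      at true  f f⊑ν = by (t ℕ.≤? # f)
        where
        by : (t≤? : Dec (t ≤ # f)) → # f ≤ bit (does t≤?) * N + (t + 0)
        by (yes _)   = begin
          # f              ≤⟨ #-mono f⊑ν ⟩
          # ν              ≡⟨ #ν ⟩
          N                ≤⟨ ℕ.m≤m+n N 0 ⟩
          N + 0            ≤⟨ ℕ.m≤m+n (N + 0) (t + 0) ⟩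
          N + 0 + (t + 0)  ∎
        by (no t≰#f) = ℕ.≤-trans (ℕ.<⇒≤ (ℕ.≰⇒> t≰#f)) (ℕ.m≤m+n t 0)
    κ : ℕ
    κ = 16 * t * E
    instance
      κ≢0 : NonZero κ
      κ≢0 = ℕ.m*n≢0 (16 * t) E {{ℕ.m*n≢0 16 t {{_}} {{>-nonZero 0<t}}}} {{>-nonZero 0<E}}
      double≢0 : NonZero (2 * E)
      double≢0 = ℕ.m*n≢0 2 E {{_}} {{>-nonZero 0<E}}
    d≤2EZ : d ≤ 2 * E * # Z
    d≤2EZ = ℕ.*-cancelˡ-≤ κ (ℕ.+-cancelʳ-≤ (κ * d) (κ * d) (κ * (2 * E * # Z)) (begin
      κ * d + κ * d
        ≡⟨ solveℕ 3 (λ t E d → lit 16 ⊗ t ⊗ E ⊗ d ⊕ lit 16 ⊗ t ⊗ E ⊗ d ⊜ lit 32 ⊗ t ⊗ E ⊗ d) refl t E d ⟩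
      N * d                              ≤⟨ below ⟩
      E * edges M ν X                    ≤⟨ ℕ.*-monoʳ-≤ E above ⟩
      E * (# Z * N + # X * t)            ≤⟨ ℕ.*-monoʳ-≤ E (ℕ.+-monoʳ-≤ (# Z * N) (ℕ.*-monoˡ-≤ t #X≤)) ⟩
      E * (# Z * N + 16 * d * t)
        ≡⟨ solveℕ 4 (λ t E d Z → E ⊗ (Z ⊗ (lit 32 ⊗ t ⊗ E) ⊕ lit 16 ⊗ d ⊗ t)
             ⊜ lit 16 ⊗ t ⊗ E ⊗ (lit 2 ⊗ E ⊗ Z) ⊕ lit 16 ⊗ t ⊗ E ⊗ d) refl t E d (# Z) ⟩
      κ * (2 * E * # Z) + κ * d          ∎))
    many-columns : t * 2 ^ N ≤ # Z
    many-columns = ℕ.*-cancelˡ-≤ (2 * E) (ℕ.≤-trans d-large d≤2EZ)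

-- Natural numbers among the rationals, and reals read at one index

natℚ-+ : ∀ j k → natℚ (j + k) ≡ natℚ j ℚ.+ natℚ k
natℚ-+ zero    k = sym (ℚ.+-identityˡ (natℚ k))
natℚ-+ (suc j) k = begin
  natℚ (suc (j + k))               ≡⟨ natℚ-suc (j + k) ⟩
  natℚ (j + k) ℚ.+ 1ℚ              ≡⟨ cong (ℚ._+ 1ℚ) (natℚ-+ j k) ⟩
  (natℚ j ℚ.+ natℚ k) ℚ.+ 1ℚ       ≡⟨ swap (natℚ j) (natℚ k) ⟩
  (natℚ j ℚ.+ 1ℚ) ℚ.+ natℚ k       ≡⟨ cong (ℚ._+ natℚ k) (sym (natℚ-suc j)) ⟩
  natℚ (suc j) ℚ.+ natℚ k          ∎
  where
  open ≡-Reasoning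
  swap : ∀ x y → (x ℚ.+ y) ℚ.+ 1ℚ ≡ (x ℚ.+ 1ℚ) ℚ.+ y
  swap = solve 2 (λ x y → ((x :+ y) :+ con 1ℚ) := ((x :+ con 1ℚ) :+ y)) refl

natℚ-mono : ∀ {j k} → j ≤ k → natℚ j ℚ.≤ natℚ k
natℚ-mono {j} {k} j≤k = subst₂ ℚ._≤_ (ℚ.+-identityʳ (natℚ j))
  (trans (sym (natℚ-+ j _)) (cong natℚ (ℕ.m+[n∸m]≡n j≤k)))
  (ℚ.+-monoʳ-≤ (natℚ j) (0≤natℚ (k ∸ j)))

natℚ-sum : (f : Vector ℕ n) → natℚ (sum f) ≡ sumℚ (natℚ ∘ f)
natℚ-sum {zero}  f = refl
natℚ-sum {suc n} f = trans (natℚ-+ (f zero) _) (cong (natℚ (f zero) ℚ.+_) (natℚ-sum (f ∘ suc)))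

bitℚ : Bool → ℚ
bitℚ b = natℚ (bit b)

seq-Σʳ : (x : Vector ℝ n) → ∀ N → seq (Σʳ x) N ≡ sumℚ (λ i → seq (x i) N)
seq-Σʳ {zero}  x N = refl
seq-Σʳ {suc n} x N = cong (seq (x zero) N ℚ.+_) (seq-Σʳ (x ∘ suc) N)

seq-maxʳ-≤ : (x : Vector ℝ n) → ∀ N i → seq (x i) N ℚ.≤ seq (maxʳ x) N
seq-maxʳ-≤ x N zero    = ℚ.p≤p⊔q _ _
seq-maxʳ-≤ x N (suc i) = ℚ.≤-trans (seq-maxʳ-≤ (x ∘ suc) N i) (ℚ.p≤q⊔p (seq (x zero) N) _)

0≤seq-maxʳ : (x : Vector ℝ n) → ∀ N → 0ℚ ℚ.≤ seq (maxʳ x) N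
0≤seq-maxʳ {zero}  x N = ℚ.≤-refl
0≤seq-maxʳ {suc n} x N = ℚ.≤-trans (0≤seq-maxʳ (x ∘ suc) N) (ℚ.p≤q⊔p (seq (x zero) N) _)

-- Factorizations from orientations

bitʳ : Bool → ℝ
bitʳ b = if b then 1ʳ else 0ʳ

seq-bitʳ : ∀ b N → seq (bitʳ b) N ≡ bitℚ b
seq-bitʳ true  N = refl
seq-bitʳ false N = refl

seq-bitʳ-* : ∀ a b N → seq (bitʳ a *ʳ bitʳ b) N ≡ bitℚ (a ∧ b)
seq-bitʳ-* true  b N = trans (ℚ.*-identityˡ _) (seq-bitʳ b N)
seq-bitʳ-* false b N = ℚ.*-zeroˡ (seq (bitʳ b) N)

seq-dot-bits : (f g : Vector Bool k) → ∀ N →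
  seq (Σʳ λ l → bitʳ (f l) *ʳ bitʳ (g l)) N ≡ natℚ (# λ l → f l ∧ g l)
seq-dot-bits f g N = begin
  seq (Σʳ λ l → bitʳ (f l) *ʳ bitʳ (g l)) N      ≡⟨ seq-Σʳ (λ l → bitʳ (f l) *ʳ bitʳ (g l)) N ⟩
  sumℚ (λ l → seq (bitʳ (f l) *ʳ bitʳ (g l)) N)  ≡⟨ ∑ℚ.sum-cong-≗ (λ l → seq-bitʳ-* (f l) (g l) N) ⟩
  sumℚ (λ l → bitℚ (f l ∧ g l))                  ≡⟨ natℚ-sum (λ l → bit (f l ∧ g l)) ⟨
  natℚ (# λ l → f l ∧ g l)                       ∎
  where open ≡-Reasoning

-- Says that r is at most the square root of q, without the root. `sqrtℚ` approximates from below,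
-- so this form holds at every index of the sequences and no limit is taken.
SmallRoot : ℚ → ℚ → Set
SmallRoot q r = 0ℚ ℚ.≤ r × r ℚ.* r ℚ.≤ q

sqrtℚ-small : ∀ N {p q} → 0ℚ ℚ.≤ q → p ℚ.≤ q → SmallRoot q (sqrtℚ N p)
sqrtℚ-small N {p} {q} 0≤q p≤q = nonNeg , [ small , (λ r²≤p → ℚ.≤-trans r²≤p p≤q) ]′ below
  where
  open Climbed (sqrtℚ-climbed N p)
  small : sqrtℚ N p ≡ 0ℚ → sqrtℚ N p ℚ.* sqrtℚ N p ℚ.≤ q
  small eq rewrite eq = 0≤q

seq-maxʳ-small : ∀ N {q} → 0ℚ ℚ.≤ q → (x : Vector ℝ n) →
  (∀ i → SmallRoot q (seq (x i) N)) → SmallRoot q (seq (maxʳ x) N)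
seq-maxʳ-small {zero}  N 0≤q x h = ℚ.≤-refl , 0≤q
seq-maxʳ-small {suc n} N 0≤q x h with ℚ.⊔-sel (seq (x zero) N) (seq (maxʳ (x ∘ suc)) N)
... | inj₁ eq = subst (SmallRoot _) (sym eq) (h zero)
... | inj₂ eq = subst (SmallRoot _) (sym eq) (seq-maxʳ-small N 0≤q (x ∘ suc) (h ∘ suc))

-- The product is at most the square of the larger factor.
SmallRoot-* : ∀ {q r s} → SmallRoot q r → SmallRoot q s → r ℚ.* s ℚ.≤ q
SmallRoot-* {q} {r} {s} (0≤r , r²≤q) (0≤s , s²≤q) with ℚ.≤-total r s
... | inj₁ r≤s = ℚ.≤-trans (*-mono-≤ 0≤r 0≤s r≤s ℚ.≤-refl) s²≤q
... | inj₂ s≤r = ℚ.≤-trans (*-mono-≤ 0≤r 0≤r ℚ.≤-refl s≤r) r²≤q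

#-splitAt : ∀ k l (f : Vector Bool (k + l)) → # f ≡ # (λ i → f (i ↑ˡ l)) + # (λ i → f (k ↑ʳ i))
#-splitAt k l f = sum-splitAt ℕ.+-0-monoid k l (bit ∘ f)

#-at : (f : Vector Bool n) → ∀ i → # (λ j → does (j Fin.≟ i) ∧ f j) ≡ bit (f i)
#-at {suc n} f zero = trans
  (cong (bit (f zero) +_) (#-empty {n} {f = λ _ → false} λ _ ())) (ℕ.+-identityʳ _)
#-at f (suc i) = #-at (f ∘ suc) i

-- The rows of [R ∣ I] and the columns of [I ; C] have at most c + 1 ones, so their norms are at
-- most the square root of c + 1. The entries are constant sequences, so the product is exact at
-- every index.
Orientation⇒γ₂ : {M : BoolMatrix m n} → Orientation c M all all → γ₂[ toReal M ]≤ fromℚ (natℚ (suc c))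
Orientation⇒γ₂ {m} {n} {c} {M} o = n + m , (λ i l → bitʳ (U i l)) , (λ l j → bitʳ (V l j))
  , (λ i j → equal i j) , bounded
  where
  open Orientation o
  I : ∀ {k} → BoolMatrix k k
  I i j = does (j Fin.≟ i)
  R C : BoolMatrix m n
  R i j = M i j ∧ byRow i j
  C i j = M i j ∧ not (byRow i j)
  U : BoolMatrix m (n + m)
  U i = R i ++ I i
  Vᵀ : BoolMatrix n (n + m)
  Vᵀ j = I j ++ transpose C j
  V : BoolMatrix (n + m) n
  V = transpose Vᵀ

  dot : ∀ i j → # (λ l → U i l ∧ V l j) ≡ bit (M i j)
  dot i j = begin
    # (λ l → U i l ∧ V l j)
      ≡⟨ #-splitAt n m (λ l → U i l ∧ V l j) ⟩
    # (λ k → U i (k ↑ˡ m) ∧ V (k ↑ˡ m) j) + # (λ k → U i (n ↑ʳ k) ∧ V (n ↑ʳ k) j)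
      ≡⟨ cong₂ _+_
           (#-cong λ k → cong₂ _∧_ (lookup-++ˡ (R i) (I i) k) (lookup-++ˡ (I j) (transpose C j) k))
           (#-cong λ k → cong₂ _∧_ (lookup-++ʳ (R i) (I i) k) (lookup-++ʳ (I j) (transpose C j) k)) ⟩
    # (λ k → R i k ∧ I j k) + # (λ k → I i k ∧ C k j)
      ≡⟨ cong₂ _+_ (trans (#-cong λ k → Bool.∧-comm (R i k) (I j k)) (#-at (R i) j))
                   (#-at (transpose C j) i) ⟩
    bit (R i j) + bit (C i j)
      ≡⟨ sym (charge (M i j) (byRow i j)) ⟩
    bit (M i j) ∎
    where
    open ≡-Reasoning
    charge : ∀ x r → bit x ≡ bit (x ∧ r) + bit (x ∧ not r)
    charge false r     = refl
    charge true  true  = refl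
    charge true  false = refl

  equal : ∀ i j → Σʳ (λ l → bitʳ (U i l) *ʳ bitʳ (V l j)) ≈ʳ toReal M i j
  equal i j ε 0<ε = 0 , λ N _ → subst (ℚ._≤ ε) (sym (distance N)) (ℚ.<⇒≤ 0<ε)
    where
    distance : ∀ N → ℚ.∣ seq (Σʳ (λ l → bitʳ (U i l) *ʳ bitʳ (V l j))) N ℚ.- seq (toReal M i j) N ∣ ≡ 0ℚ
    distance N = cong ℚ.∣_∣ (trans
      (cong₂ ℚ._-_ (trans (seq-dot-bits (U i) (transpose V j) N) (cong natℚ (dot i j)))
                   (seq-bitʳ (M i j) N))
      (ℚ.+-inverseʳ (bitℚ (M i j))))

  norm : ∀ {f : Vector Bool (n + m)} → # f ≤ suc c → ∀ N → SmallRoot (natℚ (suc c)) (seq ‖ bitʳ ∘ f ‖₂ N)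
  norm {f} #f≤ N = sqrtℚ-small N (0≤natℚ (suc c)) (subst (ℚ._≤ natℚ (suc c))
    (sym (trans (seq-dot-bits f f N) (cong natℚ (#-cong λ l → Bool.∧-idem (f l))))) (natℚ-mono #f≤))

  #U : ∀ i → # (U i) ≤ suc c
  #U i = begin
    # (U i)            ≡⟨ #-splitAt n m (U i) ⟩
    # (λ k → U i (k ↑ˡ m)) + # (λ k → U i (n ↑ʳ k))
      ≡⟨ cong₂ _+_ (#-cong (lookup-++ˡ (R i) (I i))) (#-cong (lookup-++ʳ (R i) (I i))) ⟩
    # (R i) + # (I i)  ≤⟨ ℕ.+-mono-≤ (rows i refl) (ℕ.≤-reflexive (#-singleton i)) ⟩
    c + 1              ≡⟨ ℕ.+-comm c 1 ⟩
    suc c              ∎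
    where open ℕ.≤-Reasoning

  #V : ∀ j → # (Vᵀ j) ≤ suc c
  #V j = begin
    # (Vᵀ j)           ≡⟨ #-splitAt n m (Vᵀ j) ⟩
    # (λ k → Vᵀ j (k ↑ˡ m)) + # (λ k → Vᵀ j (n ↑ʳ k))
      ≡⟨ cong₂ _+_ (#-cong (lookup-++ˡ (I j) (transpose C j))) (#-cong (lookup-++ʳ (I j) (transpose C j))) ⟩
    # (I j) + # (transpose C j)
      ≤⟨ ℕ.+-mono-≤ (ℕ.≤-reflexive (#-singleton j)) (cols j refl) ⟩
    suc c              ∎
    where open ℕ.≤-Reasoning

  bounded : ‖ (λ i l → bitʳ (U i l)) ‖row *ʳ ‖ (λ l j → bitʳ (V l j)) ‖col ≤ʳ fromℚ (natℚ (suc c))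
  bounded ε 0<ε = 0 , λ N _ → ℚ.≤-trans
    (SmallRoot-*
      (seq-maxʳ-small N (0≤natℚ (suc c)) (λ i → ‖ bitʳ ∘ U i ‖₂) λ i → norm (#U i) N)
      (seq-maxʳ-small N (0≤natℚ (suc c)) (λ j → ‖ bitʳ ∘ Vᵀ j ‖₂) λ j → norm (#V j) N))
    (subst (ℚ._≤ natℚ (suc c) ℚ.+ ε) (ℚ.+-identityʳ (natℚ (suc c)))
      (ℚ.+-monoʳ-≤ (natℚ (suc c)) (ℚ.<⇒≤ 0<ε)))

-- Rational approximate factorizations

-- A factorization read at a single index of its Cauchy sequences. Only the product of the bounds
-- `α` and `β` is controlled, as U may be scaled up and V down. The coordinate comes first because
-- the walk acts on each `v l` as a function on the columns.
record RationalFactorization (g : ℕ) (ε : ℚ) (M : BoolMatrix m n) : Set where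
  field
    {dim} : ℕ
    u     : Fin dim → Fin m → ℚ
    v     : Fin dim → Fin n → ℚ
    α β   : ℚ
    0<α   : 0ℚ ℚ.< α
    0<β   : 0ℚ ℚ.< β
    αβ≤g  : α ℚ.* β ℚ.≤ natℚ g
    ∣u∣²≤α : ∀ i → sumℚ (λ l → u l i ℚ.* u l i) ℚ.≤ α
    ∣v∣²≤β : ∀ j → sumℚ (λ l → v l j ℚ.* v l j) ℚ.≤ β
    approx : ∀ i j → ℚ.∣ sumℚ (λ l → u l i ℚ.* v l j) ℚ.- bitℚ (M i j) ∣ ℚ.≤ ε

RationalFactorization-transpose : ∀ {g ε} {M : BoolMatrix m n} →
  RationalFactorization g ε M → RationalFactorization g ε (transpose M)
RationalFactorization-transpose {g = g} {ε} {M} r = record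
  { u = v ; v = u ; α = β ; β = α ; 0<α = 0<β ; 0<β = 0<α
  ; αβ≤g   = subst (ℚ._≤ natℚ g) (ℚ.*-comm α β) αβ≤g
  ; ∣u∣²≤α = ∣v∣²≤β
  ; ∣v∣²≤β = ∣u∣²≤α
  ; approx = λ j i → subst (λ x → ℚ.∣ x ℚ.- bitℚ (M i j) ∣ ℚ.≤ ε)
      (∑ℚ.sum-cong-≗ λ l → ℚ.*-comm (u l i) (v l j)) (approx i j)
  }
  where open RationalFactorization r

eventually-all : ∀ {n} {P : Fin n → ℕ → Set} → (∀ i → ∃ λ N → ∀ k → N ≤ k → P i k) →
  ∃ λ N → ∀ k → N ≤ k → ∀ i → P i k
eventually-all {zero}  h = 0 , λ _ _ ()
eventually-all {suc n} h =
  let (N₁ , h₁) = h zero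
      (N₂ , h₂) = eventually-all (h ∘ suc)
  in N₁ ⊔ N₂ , λ { k N≤k zero    → h₁ k (ℕ.≤-trans (ℕ.m≤m⊔n N₁ N₂) N≤k)
                 ; k N≤k (suc i) → h₂ k (ℕ.≤-trans (ℕ.m≤n⊔m N₁ N₂) N≤k) i }

eventually-both : ∀ {P Q : ℕ → Set} → (∃ λ N → ∀ k → N ≤ k → P k) → (∃ λ N → ∀ k → N ≤ k → Q k) →
  ∃ λ N → ∀ k → N ≤ k → P k × Q k
eventually-both (N₁ , h₁) (N₂ , h₂) = N₁ ⊔ N₂ , λ k N≤k →
    h₁ k (ℕ.≤-trans (ℕ.m≤m⊔n N₁ N₂) N≤k)
  , h₂ k (ℕ.≤-trans (ℕ.m≤n⊔m N₁ N₂) N≤k)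

0<mesh : ∀ N → 0ℚ ℚ.< mesh N
0<mesh N = subst (0ℚ ℚ.<_) (sym (mesh-mkℚ N)) (ℚ.positive⁻¹ _)

-- The approximate root may fall short of the true one by up to the mesh, which therefore has to be
-- added before squaring.
square-norm-< : (x : Vector ℝ k) → ∀ N {a} → seq ‖ x ‖₂ N ℚ.≤ a →
  sumℚ (λ l → seq (x l) N ℚ.* seq (x l) N) ℚ.≤ (a ℚ.+ mesh N) ℚ.* (a ℚ.+ mesh N)
square-norm-< x N {a} r≤a = ℚ.≤-trans
  (ℚ.≤-reflexive (sym (seq-Σʳ (λ l → x l *ʳ x l) N)))
  (ℚ.≤-trans (ℚ.<⇒≤ (sqrtℚ-above N q))
    (sq-mono-≤ (ℚ.+-mono-≤ (Climbed.nonNeg (sqrtℚ-climbed N q)) (0≤mesh N))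
      (ℚ.+-monoˡ-≤ (mesh N) r≤a)))
  where
  q : ℚ
  q = seq (Σʳ λ l → x l *ʳ x l) N

-- The bound `g` depends on `γ` alone, so that `ε` can be chosen afterwards in terms of `g`. The
-- index at which the sequences are read depends on `M` and its factorization. The square in `g * g`
-- appears because `α` and `β` bound squared norms.
γ₂⇒RationalFactorization : ∀ γ → ∃ λ g → ∀ ε → 0ℚ ℚ.< ε → ∀ {m n} (M : BoolMatrix m n) →
  γ₂[ toReal M ]≤ γ → RationalFactorization g ε M
γ₂⇒RationalFactorization γ = g * g , factor
  where
  γ-bound : ∃₂ λ N B → 0ℚ ℚ.< B × (∀ n → N ≤ n → ℚ.∣ seq γ n ∣ ℚ.≤ B)
  γ-bound = eventually-bounded (seq γ) (cauchy γ)
  B : ℚ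
  B = proj₁ (proj₂ γ-bound)
  g : ℕ
  -- One unit is the tolerance of `≤ʳ` at the chosen index, the other pays for adding the mesh to
  -- both norms.
  g = ℤ.∣ ↥ ((B ℚ.+ 1ℚ) ℚ.+ 1ℚ) ∣

  factor : ∀ ε → 0ℚ ℚ.< ε → ∀ {m n} (M : BoolMatrix m n) →
    γ₂[ toReal M ]≤ γ → RationalFactorization (g * g) ε M
  factor ε 0<ε M (k , U , V , UV≈M , small) =
    let (N₁ , Bᵃ , 0<Bᵃ , a≤Bᵃ) = eventually-bounded (seq ‖ U ‖row) (cauchy ‖ U ‖row)
        (N₂ , Bᵇ , 0<Bᵇ , b≤Bᵇ) = eventually-bounded (seq ‖ V ‖col) (cauchy ‖ V ‖col)
        -- Adding at most `η` to both norms, with `η` chosen like this and the mesh at most 1,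
        -- raises their product by at most 1.
        (η , 0<η , η-eq) = split {B = Bᵃ ℚ.+ 1ℚ} {C = Bᵇ} 0<1 (ℚ.+-mono-< 0<Bᵃ 0<1) 0<Bᵇ
        (N , h) = eventually-both
          (eventually-both (eventually-both (N₁ , a≤Bᵃ) (N₂ , b≤Bᵇ))
                           (eventually-both (mesh-small η 0<η) (mesh-small 1ℚ 0<1)))
          (eventually-both (eventually-all λ i → eventually-all λ j → UV≈M i j ε 0<ε)
                           (eventually-both (small 1ℚ 0<1) (proj₁ γ-bound , proj₂ (proj₂ (proj₂ γ-bound)))))
        (((a≤ , b≤) , δ≤η , δ≤1) , close , ab≤ , γ≤) = h N ℕ.≤-refl
    in at N a≤ b≤ η-eq 0<η δ≤η δ≤1 close ab≤ γ≤
    where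
    module _ (N : ℕ) where
      a b δ : ℚ
      a = seq ‖ U ‖row N
      b = seq ‖ V ‖col N
      δ = mesh N

      at : ∀ {Bᵃ Bᵇ η} → ℚ.∣ a ∣ ℚ.≤ Bᵃ → ℚ.∣ b ∣ ℚ.≤ Bᵇ → (Bᵃ ℚ.+ 1ℚ) ℚ.* η ℚ.+ η ℚ.* Bᵇ ≡ 1ℚ →
        0ℚ ℚ.< η → δ ℚ.≤ η → δ ℚ.≤ 1ℚ →
        (∀ i j → ℚ.∣ seq ((U · V) i j) N ℚ.- seq (toReal M i j) N ∣ ℚ.≤ ε) →
        a ℚ.* b ℚ.≤ seq γ N ℚ.+ 1ℚ → ℚ.∣ seq γ N ∣ ℚ.≤ B → RationalFactorization (g * g) ε M
      at {Bᵃ} {Bᵇ} {η} a≤ b≤ η-eq 0<η δ≤η δ≤1 close ab≤ γ≤ = record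
        { u = λ l i → seq (U i l) N
        ; v = λ l j → seq (V l j) N
        ; α = a⁺ ℚ.* a⁺
        ; β = b⁺ ℚ.* b⁺
        ; 0<α = *-pos 0<a⁺ 0<a⁺
        ; 0<β = *-pos 0<b⁺ 0<b⁺
        ; αβ≤g = begin
            (a⁺ ℚ.* a⁺) ℚ.* (b⁺ ℚ.* b⁺)  ≡⟨ interchange a⁺ b⁺ ⟩
            (a⁺ ℚ.* b⁺) ℚ.* (a⁺ ℚ.* b⁺)  ≤⟨ sq-mono-≤ (ℚ.<⇒≤ (*-pos 0<a⁺ 0<b⁺)) a⁺b⁺≤g ⟩
            natℚ g ℚ.* natℚ g            ≡⟨ natℚ-* g g ⟨
            natℚ (g * g)               ∎
        ; ∣u∣²≤α = λ i → square-norm-< (U i) N (seq-maxʳ-≤ (λ i → ‖ U i ‖₂) N i)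
        ; ∣v∣²≤β = λ j → square-norm-< (transpose V j) N (seq-maxʳ-≤ (λ j → ‖ transpose V j ‖₂) N j)
        ; approx = λ i j → subst₂ (λ x y → ℚ.∣ x ℚ.- y ∣ ℚ.≤ ε)
            (seq-Σʳ (λ l → U i l *ʳ V l j) N) (seq-bitʳ (M i j) N) (close i j)
        }
        where
        open ℚ.≤-Reasoning
        a⁺ b⁺ : ℚ
        a⁺ = a ℚ.+ δ
        b⁺ = b ℚ.+ δ
        0≤a : 0ℚ ℚ.≤ a
        0≤a = 0≤seq-maxʳ (λ i → ‖ U i ‖₂) N
        0≤b : 0ℚ ℚ.≤ b
        0≤b = 0≤seq-maxʳ (λ j → ‖ transpose V j ‖₂) N
        0<a⁺ : 0ℚ ℚ.< a⁺
        0<a⁺ = ℚ.+-mono-≤-< 0≤a (0<mesh N)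
        0<b⁺ : 0ℚ ℚ.< b⁺
        0<b⁺ = ℚ.+-mono-≤-< 0≤b (0<mesh N)
        interchange : ∀ x y → (x ℚ.* x) ℚ.* (y ℚ.* y) ≡ (x ℚ.* y) ℚ.* (x ℚ.* y)
        interchange = solve 2 (λ x y → ((x :* x) :* (y :* y)) := ((x :* y) :* (x :* y))) refl
        expand-shift : ∀ x y d → (x ℚ.+ d) ℚ.* (y ℚ.+ d) ≡ x ℚ.* y ℚ.+ ((x ℚ.+ d) ℚ.* d ℚ.+ d ℚ.* y)
        expand-shift = solve 3 (λ x y d →
          ((x :+ d) :* (y :+ d)) := ((x :* y) :+ (((x :+ d) :* d) :+ (d :* y)))) refl
        a⁺b⁺≤g : a⁺ ℚ.* b⁺ ℚ.≤ natℚ g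
        a⁺b⁺≤g = begin
          a⁺ ℚ.* b⁺                                ≡⟨ expand-shift a b δ ⟩
          a ℚ.* b ℚ.+ (a⁺ ℚ.* δ ℚ.+ δ ℚ.* b)
            ≤⟨ ℚ.+-mono-≤ ab≤ (ℚ.+-mono-≤
                 (*-mono-≤ (ℚ.<⇒≤ 0<a⁺) (ℚ.<⇒≤ 0<η) (ℚ.+-mono-≤ (ℚ.≤-trans (p≤∣p∣ a) a≤) δ≤1) δ≤η)
                 (*-mono-≤ (0≤mesh N) (ℚ.≤-trans 0≤b (ℚ.≤-trans (p≤∣p∣ b) b≤)) δ≤η (ℚ.≤-trans (p≤∣p∣ b) b≤))) ⟩
          (seq γ N ℚ.+ 1ℚ) ℚ.+ ((Bᵃ ℚ.+ 1ℚ) ℚ.* η ℚ.+ η ℚ.* Bᵇ)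
            ≡⟨ cong ((seq γ N ℚ.+ 1ℚ) ℚ.+_) η-eq ⟩
          (seq γ N ℚ.+ 1ℚ) ℚ.+ 1ℚ
            ≤⟨ ℚ.+-monoˡ-≤ 1ℚ (ℚ.+-monoˡ-≤ 1ℚ (ℚ.≤-trans (p≤∣p∣ (seq γ N)) γ≤)) ⟩
          (B ℚ.+ 1ℚ) ℚ.+ 1ℚ                        ≤⟨ q≤natℚ ((B ℚ.+ 1ℚ) ℚ.+ 1ℚ) ⟩
          natℚ g                                   ∎

sumℚ-mono : {x y : Vector ℚ n} → (∀ i → x i ℚ.≤ y i) → sumℚ x ℚ.≤ sumℚ y
sumℚ-mono {zero}  x≤y = ℚ.≤-refl
sumℚ-mono {suc n} x≤y = ℚ.+-mono-≤ (x≤y zero) (sumℚ-mono (x≤y ∘ suc))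

0≤sumℚ : {x : Vector ℚ n} → (∀ i → 0ℚ ℚ.≤ x i) → 0ℚ ℚ.≤ sumℚ x
0≤sumℚ {zero}  0≤x = ℚ.≤-refl
0≤sumℚ {suc n} 0≤x = ℚ.+-mono-≤ (0≤x zero) (0≤sumℚ (0≤x ∘ suc))

0≤p² : ∀ p → 0ℚ ℚ.≤ p ℚ.* p
0≤p² p with ℚ.≤-total 0ℚ p
... | inj₁ 0≤p = subst (ℚ._≤ p ℚ.* p) (ℚ.*-zeroʳ p) (ℚ.*-monoˡ-≤-nonNeg p {{ℚ.nonNegative 0≤p}} 0≤p)
... | inj₂ p≤0 = subst (ℚ._≤ p ℚ.* p) (ℚ.*-zeroʳ p) (ℚ.*-monoˡ-≤-nonPos p {{ℚ.nonPositive p≤0}} p≤0)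

0≤p*q : ∀ {p q} → 0ℚ ℚ.≤ p → 0ℚ ℚ.≤ q → 0ℚ ℚ.≤ p ℚ.* q
0≤p*q {p} {q} 0≤p 0≤q = subst (ℚ._≤ p ℚ.* q) (ℚ.*-zeroʳ p) (ℚ.*-monoˡ-≤-nonNeg p {{ℚ.nonNegative 0≤p}} 0≤q)

-- Sums and averages over the support of a Boolean vector

sumOver : Vector Bool n → Vector ℚ n → ℚ
sumOver f x = sumℚ λ j → bitℚ (f j) ℚ.* x j

sumOver-cong : (f : Vector Bool n) {x y : Vector ℚ n} → x ≗ y → sumOver f x ≡ sumOver f y
sumOver-cong f x≗y = ∑ℚ.sum-cong-≗ λ j → cong (bitℚ (f j) ℚ.*_) (x≗y j)

sumOver-+ : (f : Vector Bool n) (x y : Vector ℚ n) →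
  sumOver f (λ j → x j ℚ.+ y j) ≡ sumOver f x ℚ.+ sumOver f y
sumOver-+ f x y = trans
  (∑ℚ.sum-cong-≗ λ j → ℚ.*-distribˡ-+ (bitℚ (f j)) (x j) (y j))
  (∑ℚ.∑-distrib-+ (λ j → bitℚ (f j) ℚ.* x j) (λ j → bitℚ (f j) ℚ.* y j))

sumOver-* : (f : Vector Bool n) (a : ℚ) (x : Vector ℚ n) →
  sumOver f (λ j → a ℚ.* x j) ≡ a ℚ.* sumOver f x
sumOver-* f a x = trans
  (∑ℚ.sum-cong-≗ λ j → swap (bitℚ (f j)) a (x j))
  (sym (∑ℚ.*-distribˡ-sum a (λ j → bitℚ (f j) ℚ.* x j)))
  where
  swap : ∀ b a x → b ℚ.* (a ℚ.* x) ≡ a ℚ.* (b ℚ.* x)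
  swap = solve 3 (λ b a x → (b :* (a :* x)) := (a :* (b :* x))) refl

sumOver-const : (f : Vector Bool n) (a : ℚ) → sumOver f (λ _ → a) ≡ natℚ (# f) ℚ.* a
sumOver-const f a = trans
  (sym (∑ℚ.*-distribʳ-sum a (λ j → bitℚ (f j))))
  (cong (ℚ._* a) (sym (natℚ-sum (λ j → bit (f j)))))

sumOver-sum : (f : Vector Bool n) (x : Fin k → Vector ℚ n) →
  sumOver f (λ j → sumℚ λ l → x l j) ≡ sumℚ (λ l → sumOver f (x l))
sumOver-sum f x = trans
  (∑ℚ.sum-cong-≗ λ j → ∑ℚ.*-distribˡ-sum (bitℚ (f j)) (λ l → x l j))
  (∑ℚ.∑-comm (λ j l → bitℚ (f j) ℚ.* x l j))

sumOver-mono : (f : Vector Bool n) {x y : Vector ℚ n} → (∀ j → f j ≡ true → x j ℚ.≤ y j) →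
  sumOver f x ℚ.≤ sumOver f y
sumOver-mono f {x} {y} x≤y = sumℚ-mono λ j → at (f j) (x≤y j)
  where
  at : ∀ b {p q} → (b ≡ true → p ℚ.≤ q) → bitℚ b ℚ.* p ℚ.≤ bitℚ b ℚ.* q
  at false {p} {q} h = ℚ.≤-reflexive (trans (ℚ.*-zeroˡ p) (sym (ℚ.*-zeroˡ q)))
  at true  {p} {q} h = subst₂ ℚ._≤_ (sym (ℚ.*-identityˡ p)) (sym (ℚ.*-identityˡ q)) (h refl)

0≤sumOver : (f : Vector Bool n) {x : Vector ℚ n} → (∀ j → 0ℚ ℚ.≤ x j) → 0ℚ ℚ.≤ sumOver f x
0≤sumOver f 0≤x = 0≤sumℚ λ j → 0≤p*q (0≤natℚ (bit (f j))) (0≤x j)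

∣sumOver∣≤ : (f : Vector Bool n) {x : Vector ℚ n} {e : ℚ} → (∀ j → f j ≡ true → ℚ.∣ x j ∣ ℚ.≤ e) →
  ℚ.∣ sumOver f x ∣ ℚ.≤ natℚ (# f) ℚ.* e
∣sumOver∣≤ f {x} {e} ∣x∣≤e = ∣p∣≤
  (ℚ.≤-trans (sumOver-mono f λ j fj → ℚ.≤-trans (p≤∣p∣ (x j)) (∣x∣≤e j fj))
    (ℚ.≤-reflexive (sumOver-const f e)))
  (ℚ.≤-trans (ℚ.≤-reflexive negate)
    (ℚ.≤-trans (sumOver-mono f λ j fj →
        ℚ.≤-trans (p≤∣p∣ (ℚ.- 1ℚ ℚ.* x j)) (ℚ.≤-trans (ℚ.≤-reflexive (∣-1*∣ (x j))) (∣x∣≤e j fj)))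
      (ℚ.≤-reflexive (sumOver-const f e))))
  where
  neg : ∀ y → ℚ.- y ≡ ℚ.- 1ℚ ℚ.* y
  neg = solve 1 (λ y → (⊖ y) := ((⊖ con 1ℚ) :* y)) refl
  negate : ℚ.- sumOver f x ≡ sumOver f (λ j → ℚ.- 1ℚ ℚ.* x j)
  negate = trans (neg (sumOver f x)) (sym (sumOver-* f (ℚ.- 1ℚ) x))
  ∣-1*∣ : ∀ y → ℚ.∣ ℚ.- 1ℚ ℚ.* y ∣ ≡ ℚ.∣ y ∣
  ∣-1*∣ y = trans (cong ℚ.∣_∣ (sym (neg y))) (ℚ.∣-p∣≡∣p∣ y)

-- 1/0 = 0, so that the average over the empty set is 0.
inverse : ℕ → ℚ
inverse zero    = 0ℚ
inverse (suc k) = mesh k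

0≤inverse : ∀ k → 0ℚ ℚ.≤ inverse k
0≤inverse zero    = ℚ.≤-refl
0≤inverse (suc k) = 0≤mesh k

average : Vector Bool n → Vector ℚ n → ℚ
average f x = inverse (# f) ℚ.* sumOver f x

sumOver-average : (f : Vector Bool n) (x : Vector ℚ n) → sumOver f x ≡ sumOver f (λ _ → average f x)
sumOver-average {n} f x = trans (at (# f) refl) (sym (sumOver-const f (average f x)))
  where
  at : ∀ k → # f ≡ k → sumOver f x ≡ natℚ (# f) ℚ.* (inverse (# f) ℚ.* sumOver f x)
  at (suc k) eq rewrite eq = sym (trans (sym (ℚ.*-assoc (natℚ (suc k)) (mesh k) (sumOver f x)))
    (trans (cong (ℚ._* sumOver f x) (natℚ*mesh k)) (ℚ.*-identityˡ (sumOver f x))))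
  at zero eq = trans sum≡0 (sym (trans (cong (λ k → natℚ k ℚ.* average f x) eq) (ℚ.*-zeroˡ (average f x))))
    where
    sum≡0 : sumOver f x ≡ 0ℚ
    sum≡0 = trans
      (∑ℚ.sum-cong-≗ λ j → trans (cong (λ b → natℚ b ℚ.* x j) (bit≡0 j)) (ℚ.*-zeroˡ (x j)))
      (∑ℚ.sum-replicate-zero n)
      where
      bit≡0 : ∀ j → bit (f j) ≡ 0
      bit≡0 j with f j in fj
      ... | false = refl
      ... | true  = contradiction (subst (0 <_) eq (#-pos {f = f} j fj)) λ ()

average-cong : (f : Vector Bool n) {x y : Vector ℚ n} → x ≗ y → average f x ≡ average f y
average-cong f x≗y = cong (inverse (# f) ℚ.*_) (sumOver-cong f x≗y)

average-combination : (f : Vector Bool n) (a : Vector ℚ k) (x : Fin k → Vector ℚ n) →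
  average f (λ j → sumℚ λ l → a l ℚ.* x l j) ≡ sumℚ (λ l → a l ℚ.* average f (x l))
average-combination f a x = begin
  inverse (# f) ℚ.* sumOver f (λ j → sumℚ λ l → a l ℚ.* x l j)
    ≡⟨ cong (inverse (# f) ℚ.*_) (trans (sumOver-sum f (λ l j → a l ℚ.* x l j))
         (∑ℚ.sum-cong-≗ λ l → sumOver-* f (a l) (x l))) ⟩
  inverse (# f) ℚ.* sumℚ (λ l → a l ℚ.* sumOver f (x l))
    ≡⟨ ∑ℚ.*-distribˡ-sum (inverse (# f)) (λ l → a l ℚ.* sumOver f (x l)) ⟩
  sumℚ (λ l → inverse (# f) ℚ.* (a l ℚ.* sumOver f (x l)))
    ≡⟨ ∑ℚ.sum-cong-≗ (λ l → swap (inverse (# f)) (a l) (sumOver f (x l))) ⟩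
  sumℚ (λ l → a l ℚ.* average f (x l)) ∎
  where
  open ≡-Reasoning
  swap : ∀ b a x → b ℚ.* (a ℚ.* x) ≡ a ℚ.* (b ℚ.* x)
  swap = solve 3 (λ b a x → (b :* (a :* x)) := (a :* (b :* x))) refl

average-+ : (f : Vector Bool n) (x y : Vector ℚ n) →
  average f (λ j → x j ℚ.+ y j) ≡ average f x ℚ.+ average f y
average-+ f x y = trans (cong (inverse (# f) ℚ.*_) (sumOver-+ f x y))
  (ℚ.*-distribˡ-+ (inverse (# f)) (sumOver f x) (sumOver f y))

inverse*≤ : ∀ k {e} → 0ℚ ℚ.≤ e → inverse k ℚ.* (natℚ k ℚ.* e) ℚ.≤ e
inverse*≤ zero    {e} 0≤e = subst (ℚ._≤ e) (sym (ℚ.*-zeroˡ (natℚ 0 ℚ.* e))) 0≤e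
inverse*≤ (suc k) {e} 0≤e = ℚ.≤-reflexive (trans (sym (ℚ.*-assoc (mesh k) (natℚ (suc k)) e))
  (trans (cong (ℚ._* e) (trans (ℚ.*-comm (mesh k) (natℚ (suc k))) (natℚ*mesh k))) (ℚ.*-identityˡ e)))

∣average∣≤ : (f : Vector Bool n) {x : Vector ℚ n} {e : ℚ} → 0ℚ ℚ.≤ e →
  (∀ j → f j ≡ true → ℚ.∣ x j ∣ ℚ.≤ e) → ℚ.∣ average f x ∣ ℚ.≤ e
∣average∣≤ f {x} {e} 0≤e ∣x∣≤e = begin
  ℚ.∣ inverse (# f) ℚ.* sumOver f x ∣
    ≡⟨ trans (ℚ.∣p*q∣≡∣p∣*∣q∣ (inverse (# f)) (sumOver f x))
             (cong (ℚ._* ℚ.∣ sumOver f x ∣) (ℚ.0≤p⇒∣p∣≡p (0≤inverse (# f)))) ⟩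
  inverse (# f) ℚ.* ℚ.∣ sumOver f x ∣
    ≤⟨ ℚ.*-monoˡ-≤-nonNeg (inverse (# f)) {{ℚ.nonNegative (0≤inverse (# f))}} (∣sumOver∣≤ f ∣x∣≤e) ⟩
  inverse (# f) ℚ.* (natℚ (# f) ℚ.* e)
    ≤⟨ inverse*≤ (# f) 0≤e ⟩
  e ∎
  where open ℚ.≤-Reasoning

-- That `μ` is the mean is expressed without division, so an empty support needs no separate case.
variance : (f : Vector Bool n) (x : Vector ℚ n) (μ : ℚ) → sumOver f x ≡ sumOver f (λ _ → μ) →
  sumOver f (λ j → (x j ℚ.- μ) ℚ.* (x j ℚ.- μ)) ℚ.+ natℚ (# f) ℚ.* (μ ℚ.* μ)
    ≡ sumOver f (λ j → x j ℚ.* x j)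
variance f x μ mean = begin
  sumOver f (λ j → (x j ℚ.- μ) ℚ.* (x j ℚ.- μ)) ℚ.+ N ℚ.* (μ ℚ.* μ)
    ≡⟨ cong (ℚ._+ N ℚ.* (μ ℚ.* μ)) (trans (sumOver-cong f λ j → square (x j) μ)
         (trans (sumOver-+ f (λ j → x j ℚ.* x j) (λ j → ℚ.- (μ ℚ.+ μ) ℚ.* x j ℚ.+ μ ℚ.* μ))
         (cong (S ℚ.+_) (trans (sumOver-+ f (λ j → ℚ.- (μ ℚ.+ μ) ℚ.* x j) (λ _ → μ ℚ.* μ))
           (cong₂ ℚ._+_ (sumOver-* f (ℚ.- (μ ℚ.+ μ)) x) (sumOver-const f (μ ℚ.* μ))))))) ⟩
  (S ℚ.+ (ℚ.- (μ ℚ.+ μ) ℚ.* sumOver f x ℚ.+ N ℚ.* (μ ℚ.* μ))) ℚ.+ N ℚ.* (μ ℚ.* μ)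
    ≡⟨ cong (λ X → (S ℚ.+ (ℚ.- (μ ℚ.+ μ) ℚ.* X ℚ.+ N ℚ.* (μ ℚ.* μ))) ℚ.+ N ℚ.* (μ ℚ.* μ))
         (trans mean (sumOver-const f μ)) ⟩
  (S ℚ.+ (ℚ.- (μ ℚ.+ μ) ℚ.* (N ℚ.* μ) ℚ.+ N ℚ.* (μ ℚ.* μ))) ℚ.+ N ℚ.* (μ ℚ.* μ)
    ≡⟨ cancel S N μ ⟩
  S ∎
  where
  open ≡-Reasoning
  N S : ℚ
  N = natℚ (# f)
  S = sumOver f (λ j → x j ℚ.* x j)
  square : ∀ x μ → (x ℚ.- μ) ℚ.* (x ℚ.- μ) ≡ x ℚ.* x ℚ.+ (ℚ.- (μ ℚ.+ μ) ℚ.* x ℚ.+ μ ℚ.* μ)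
  square = solve 2 (λ x μ →
    ((x :- μ) :* (x :- μ)) := ((x :* x) :+ (((⊖ (μ :+ μ)) :* x) :+ (μ :* μ)))) refl
  cancel : ∀ S N μ → (S ℚ.+ (ℚ.- (μ ℚ.+ μ) ℚ.* (N ℚ.* μ) ℚ.+ N ℚ.* (μ ℚ.* μ))) ℚ.+ N ℚ.* (μ ℚ.* μ) ≡ S
  cancel = solve 3 (λ S N μ →
    ((S :+ (((⊖ (μ :+ μ)) :* (N :* μ)) :+ (N :* (μ :* μ)))) :+ (N :* (μ :* μ))) := S) refl

jensen : (f : Vector Bool n) (x : Vector ℚ n) (μ : ℚ) → sumOver f x ≡ sumOver f (λ _ → μ) →
  sumOver f (λ _ → μ ℚ.* μ) ℚ.≤ sumOver f (λ j → x j ℚ.* x j)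
jensen f x μ mean = begin
  sumOver f (λ _ → μ ℚ.* μ)           ≡⟨ sumOver-const f (μ ℚ.* μ) ⟩
  natℚ (# f) ℚ.* (μ ℚ.* μ)            ≡⟨ ℚ.+-identityˡ _ ⟨
  0ℚ ℚ.+ natℚ (# f) ℚ.* (μ ℚ.* μ)
    ≤⟨ ℚ.+-monoˡ-≤ (natℚ (# f) ℚ.* (μ ℚ.* μ)) (0≤sumOver f λ j → 0≤p² (x j ℚ.- μ)) ⟩
  sumOver f (λ j → (x j ℚ.- μ) ℚ.* (x j ℚ.- μ)) ℚ.+ natℚ (# f) ℚ.* (μ ℚ.* μ)
    ≡⟨ variance f x μ mean ⟩
  sumOver f (λ j → x j ℚ.* x j)       ∎
  where open ℚ.≤-Reasoning

-- The two-step random walk on the columns of a bipartite graph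

module Walk {m n} (W : BoolMatrix m n) where

  Wᵀ : BoolMatrix n m
  Wᵀ = transpose W

  deg : Fin m → ℚ
  deg i = natℚ (# W i)

  rowMean : Vector ℚ n → Vector ℚ m
  rowMean x i = average (W i) x

  walk : Vector ℚ n → Vector ℚ n
  walk x j = average (Wᵀ j) (rowMean x)

  step : Vector ℚ n → Vector ℚ n
  step x j = x j ℚ.- walk x j

  energy : Vector ℚ n → ℚ
  energy x = sumℚ λ i → sumOver (W i) λ j → x j ℚ.* x j

  -- Equals the sum of `x j` times `walk x j` over the edges (i, j): the quadratic form of Q for the
  -- inner product weighted by column degrees, in which Q is self-adjoint.
  drop : Vector ℚ n → ℚ
  drop x = sumℚ λ i → deg i ℚ.* (rowMean x i ℚ.* rowMean x i)

  sumOver-swap : (z : Fin m → Fin n → ℚ) →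
    sumℚ (λ i → sumOver (W i) (z i)) ≡ sumℚ (λ j → sumOver (Wᵀ j) λ i → z i j)
  sumOver-swap z = ∑ℚ.∑-comm (λ i j → bitℚ (W i j) ℚ.* z i j)

  -- `step x j` is the mean of `x j` minus `rowMean x i` over the rows i at column j. Jensen's
  -- inequality at each column bounds the new energy by the squared deviations from the row means,
  -- summed over the edges. Regrouped by rows, these fall short of the old energy by exactly
  -- `drop x`.
  energy-step : ∀ x → energy (step x) ℚ.+ drop x ℚ.≤ energy x
  energy-step x = begin
    energy (step x) ℚ.+ drop x
      ≡⟨ cong (ℚ._+ drop x) (sumOver-swap λ i j → step x j ℚ.* step x j) ⟩
    sumℚ (λ j → sumOver (Wᵀ j) λ i → step x j ℚ.* step x j) ℚ.+ drop x
      ≤⟨ ℚ.+-monoˡ-≤ (drop x) (sumℚ-mono λ j → jensen (Wᵀ j) (λ i → x j ℚ.- rowMean x i) (step x j) (mean j)) ⟩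
    sumℚ (λ j → sumOver (Wᵀ j) λ i → dev i j ℚ.* dev i j) ℚ.+ drop x
      ≡⟨ cong (ℚ._+ drop x) (sym (sumOver-swap λ i j → dev i j ℚ.* dev i j)) ⟩
    sumℚ (λ i → sumOver (W i) λ j → dev i j ℚ.* dev i j) ℚ.+ drop x
      ≡⟨ sym (∑ℚ.∑-distrib-+ (λ i → sumOver (W i) λ j → dev i j ℚ.* dev i j) _) ⟩
    sumℚ (λ i → sumOver (W i) (λ j → dev i j ℚ.* dev i j) ℚ.+ deg i ℚ.* (rowMean x i ℚ.* rowMean x i))
      ≡⟨ ∑ℚ.sum-cong-≗ (λ i → variance (W i) x (rowMean x i) (sumOver-average (W i) x)) ⟩
    energy x ∎
    where
    open ℚ.≤-Reasoning
    dev : Fin m → Fin n → ℚ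
    dev i j = x j ℚ.- rowMean x i
    negate : ∀ y → ℚ.- y ≡ ℚ.- 1ℚ ℚ.* y
    negate = solve 1 (λ y → (⊖ y) := ((⊖ con 1ℚ) :* y)) refl
    sumOver-shift : ∀ (f : Vector Bool m) a y →
      sumOver f (λ i → a ℚ.- y i) ≡ sumOver f (λ _ → a) ℚ.+ ℚ.- 1ℚ ℚ.* sumOver f y
    sumOver-shift f a y = trans (sumOver-+ f (λ _ → a) (λ i → ℚ.- y i))
      (cong (sumOver f (λ _ → a) ℚ.+_)
        (trans (sumOver-cong f λ i → negate (y i)) (sumOver-* f (ℚ.- 1ℚ) y)))
    mean : ∀ j → sumOver (Wᵀ j) (λ i → x j ℚ.- rowMean x i) ≡ sumOver (Wᵀ j) (λ _ → step x j)
    mean j = trans (sumOver-shift (Wᵀ j) (x j) (rowMean x))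
      (trans (cong (λ s → sumOver (Wᵀ j) (λ _ → x j) ℚ.+ ℚ.- 1ℚ ℚ.* s)
               (sumOver-average (Wᵀ j) (rowMean x)))
             (sym (sumOver-shift (Wᵀ j) (x j) (λ _ → walk x j))))

  walk-combination : (a : Vector ℚ k) (x : Fin k → Vector ℚ n) → ∀ j →
    walk (λ j → sumℚ λ l → a l ℚ.* x l j) j ≡ sumℚ (λ l → a l ℚ.* walk (x l) j)
  walk-combination a x j = trans
    (average-cong (Wᵀ j) λ i → average-combination (W i) a x)
    (average-combination (Wᵀ j) a (λ l → rowMean (x l)))

  walk-+ : ∀ x y j → walk (λ j → x j ℚ.+ y j) j ≡ walk x j ℚ.+ walk y j
  walk-+ x y j = trans (average-cong (Wᵀ j) λ i → average-+ (W i) x y)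
    (average-+ (Wᵀ j) (rowMean x) (rowMean y))

  walk-cong : ∀ {x y} → x ≗ y → ∀ j → walk x j ≡ walk y j
  walk-cong x≗y j = average-cong (Wᵀ j) λ i → average-cong (W i) x≗y

  ∣walk∣≤ : ∀ {x e} → 0ℚ ℚ.≤ e → (∀ j → ℚ.∣ x j ∣ ℚ.≤ e) → ∀ j → ℚ.∣ walk x j ∣ ℚ.≤ e
  ∣walk∣≤ 0≤e ∣x∣≤e j = ∣average∣≤ (Wᵀ j) 0≤e λ i _ → ∣average∣≤ (W i) 0≤e λ j _ → ∣x∣≤e j

  iterate : ℕ → Vector ℚ n → Vector ℚ n
  iterate zero    x = x
  iterate (suc s) x = step (iterate s x)

  -- By linearity, iterating on the coordinates of v and then pairing with u i amounts to iterating
  -- on the scalar function ⟨u i, v j⟩ of j, which is close to row i of the matrix.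
  iterate-combination : ∀ s (a : Vector ℚ k) (x : Fin k → Vector ℚ n) → ∀ j →
    iterate s (λ j → sumℚ λ l → a l ℚ.* x l j) j ≡ sumℚ (λ l → a l ℚ.* iterate s (x l) j)
  iterate-combination zero    a x j = refl
  iterate-combination (suc s) a x j = begin
    iterate s z j ℚ.- walk (iterate s z) j
      ≡⟨ cong₂ ℚ._-_ (iterate-combination s a x j)
           (trans (walk-cong (iterate-combination s a x) j) (walk-combination a (λ l → iterate s (x l)) j)) ⟩
    A ℚ.- sumℚ (λ l → a l ℚ.* walk (iterate s (x l)) j)
      ≡⟨ cong (A ℚ.+_) (trans (negate _) (∑ℚ.*-distribˡ-sum (ℚ.- 1ℚ) (λ l → a l ℚ.* walk (iterate s (x l)) j))) ⟩
    A ℚ.+ sumℚ (λ l → ℚ.- 1ℚ ℚ.* (a l ℚ.* walk (iterate s (x l)) j))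
      ≡⟨ sym (∑ℚ.∑-distrib-+ (λ l → a l ℚ.* iterate s (x l) j) _) ⟩
    sumℚ (λ l → a l ℚ.* iterate s (x l) j ℚ.+ ℚ.- 1ℚ ℚ.* (a l ℚ.* walk (iterate s (x l)) j))
      ≡⟨ ∑ℚ.sum-cong-≗ (λ l → factor (a l) (iterate s (x l) j) (walk (iterate s (x l)) j)) ⟩
    sumℚ (λ l → a l ℚ.* step (iterate s (x l)) j) ∎
    where
    open ≡-Reasoning
    z : Vector ℚ n
    z j = sumℚ λ l → a l ℚ.* x l j
    A : ℚ
    A = sumℚ λ l → a l ℚ.* iterate s (x l) j
    negate : ∀ y → ℚ.- y ≡ ℚ.- 1ℚ ℚ.* y
    negate = solve 1 (λ y → (⊖ y) := ((⊖ con 1ℚ) :* y)) refl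
    factor : ∀ a p q → a ℚ.* p ℚ.+ ℚ.- 1ℚ ℚ.* (a ℚ.* q) ≡ a ℚ.* (p ℚ.- q)
    factor = solve 3 (λ a p q → ((a :* p) :+ ((⊖ con 1ℚ) :* (a :* q))) := (a :* (p :- q))) refl

  drift : ℚ → ℕ → ℚ
  drift δ zero    = 0ℚ
  drift δ (suc s) = (drift δ s ℚ.+ drift δ s) ℚ.+ δ

  0≤drift : ∀ {δ} → 0ℚ ℚ.≤ δ → ∀ s → 0ℚ ℚ.≤ drift δ s
  0≤drift 0≤δ zero    = ℚ.≤-refl
  0≤drift 0≤δ (suc s) = ℚ.+-mono-≤ (ℚ.+-mono-≤ (0≤drift 0≤δ s) (0≤drift 0≤δ s)) 0≤δ

  -- With d = y - x, one step takes y to a vector that differs from x by (d - Q d) - Q x. Since Q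
  -- does not increase the maximum norm, the deviation at most doubles and grows by a further `δ`.
  iterate-drift : ∀ {δ} x → 0ℚ ℚ.≤ δ → (∀ j → ℚ.∣ walk x j ∣ ℚ.≤ δ) →
    ∀ s j → ℚ.∣ iterate s x j ℚ.- x j ∣ ℚ.≤ drift δ s
  iterate-drift x 0≤δ ∣Qx∣≤δ zero    j = ℚ.≤-reflexive (cong ℚ.∣_∣ (ℚ.+-inverseʳ (x j)))
  iterate-drift {δ} x 0≤δ ∣Qx∣≤δ (suc s) j = begin
    ℚ.∣ step y j ℚ.- x j ∣
      ≡⟨ cong ℚ.∣_∣ (trans (cong (λ q → (y j ℚ.- q) ℚ.- x j) (trans (walk-cong recentre j) (walk-+ d x j)))
           (rearrange (y j) (x j) (walk d j) (walk x j))) ⟩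
    ℚ.∣ (d j ℚ.- walk d j) ℚ.- walk x j ∣
      ≤⟨ ℚ.≤-trans (ℚ.∣p-q∣≤∣p∣+∣q∣ (d j ℚ.- walk d j) (walk x j))
           (ℚ.+-mono-≤ (ℚ.≤-trans (ℚ.∣p-q∣≤∣p∣+∣q∣ (d j) (walk d j))
             (ℚ.+-mono-≤ (IH j) (∣walk∣≤ (0≤drift 0≤δ s) IH j))) (∣Qx∣≤δ j)) ⟩
    (drift δ s ℚ.+ drift δ s) ℚ.+ δ ∎
    where
    open ℚ.≤-Reasoning
    y d : Vector ℚ n
    y = iterate s x
    d j = y j ℚ.- x j
    IH : ∀ j → ℚ.∣ d j ∣ ℚ.≤ drift δ s
    IH = iterate-drift x 0≤δ ∣Qx∣≤δ s
    recentre : y ≗ λ j → d j ℚ.+ x j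
    recentre j = shift (y j) (x j)
      where
      shift : ∀ y x → y ≡ (y ℚ.- x) ℚ.+ x
      shift = solve 2 (λ y x → y := ((y :- x) :+ x)) refl
    rearrange : ∀ y x p q → (y ℚ.- (p ℚ.+ q)) ℚ.- x ≡ ((y ℚ.- x) ℚ.- p) ℚ.- q
    rearrange = solve 4 (λ y x p q → ((y :- (p :+ q)) :- x) := (((y :- x) :- p) :- q)) refl

-- The energy decrement

-- One round more than the energy can pay for: it starts at no more than β per edge and loses at
-- least 1/(4α) per edge in each round, where αβ ≤ g.
rounds : ℕ → ℕ
rounds g = suc (4 * g)

≤-sum : (f : Vector ℕ n) → ∀ i → f i ≤ sum f
≤-sum f zero    = ℕ.m≤m+n _ _
≤-sum f (suc i) = ℕ.≤-trans (≤-sum (f ∘ suc) i) (ℕ.m≤n+m _ (f zero))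

0<natℚ : ∀ {k} → 0 < k → 0ℚ ℚ.< natℚ k
0<natℚ {suc k} _ = ℚ.positive⁻¹ (natℚ (suc k))

-- Each replacement of v by v − walk v keeps the inner products ⟨u i , v j⟩ above
-- ½ on the edges, so by Cauchy-Schwarz the row means of v are not small and the
-- energy decreases by a fixed fraction of the initial energy.
module EnergyDecrement {g ε} {M W : BoolMatrix m n} (R : RationalFactorization g ε M)
  (W⊑M : ∀ i → W i ⊑ M i) {η} (0≤ε : 0ℚ ℚ.≤ ε) (0≤η : 0ℚ ℚ.≤ η)
  (mixing : ∀ i j₀ → W i j₀ ≡ true → ∀ j → ℚ.∣ Walk.walk W (bitℚ ∘ M i) j ∣ ℚ.≤ η)
  (slow : ∀ s → s ≤ rounds g → ε ℚ.+ Walk.drift W (η ℚ.+ ε) s ℚ.≤ ½)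
  where

  open Walk W
  open RationalFactorization R

  total : ℚ
  total = sumℚ deg

  x : ℕ → Fin dim → Vector ℚ n
  x s l = iterate s (v l)

  E D : ℕ → ℚ
  E s = sumℚ λ l → energy (x s l)
  D s = sumℚ λ l → drop (x s l)

  E-decreases : ∀ s → E (suc s) ℚ.+ D s ℚ.≤ E s
  E-decreases s = ℚ.≤-trans
    (ℚ.≤-reflexive (sym (∑ℚ.∑-distrib-+ (λ l → energy (x (suc s) l)) (λ l → drop (x s l)))))
    (sumℚ-mono λ l → energy-step (x s l))

  dot : Fin m → Vector ℚ n
  dot i j = sumℚ λ l → u l i ℚ.* v l j

  walk-dot : ∀ i j₀ → W i j₀ ≡ true → ∀ j → ℚ.∣ walk (dot i) j ∣ ℚ.≤ η ℚ.+ ε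
  walk-dot i j₀ Wij j = begin
    ℚ.∣ walk (dot i) j ∣
      ≡⟨ cong ℚ.∣_∣ (trans (walk-cong (λ j → recentre (dot i j) (bitℚ (M i j))) j)
           (walk-+ (bitℚ ∘ M i) (λ j → dot i j ℚ.- bitℚ (M i j)) j)) ⟩
    ℚ.∣ walk (bitℚ ∘ M i) j ℚ.+ walk (λ j → dot i j ℚ.- bitℚ (M i j)) j ∣
      ≤⟨ ℚ.≤-trans (ℚ.∣p+q∣≤∣p∣+∣q∣ (walk (bitℚ ∘ M i) j) _)
           (ℚ.+-mono-≤ (mixing i j₀ Wij j) (∣walk∣≤ 0≤ε (approx i) j)) ⟩
    η ℚ.+ ε ∎
    where
    open ℚ.≤-Reasoning
    recentre : ∀ y z → y ≡ z ℚ.+ (y ℚ.- z)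
    recentre = solve 2 (λ y z → y := (z :+ (y :- z))) refl

  -- On an edge the inner product starts within `ε` of 1, and `slow` limits that error and the later
  -- drift together to one half.
  dot-large : ∀ s → s ≤ rounds g → ∀ i j → W i j ≡ true → ½ ℚ.≤ sumℚ (λ l → u l i ℚ.* x s l j)
  dot-large s s≤r i j Wij = ℚ.≤-trans bound
    (ℚ.≤-reflexive (iterate-combination s (λ l → u l i) v j))
    where
    open ℚ.≤-Reasoning
    y : ℚ
    y = iterate s (dot i) j
    δ : ℚ
    δ = η ℚ.+ ε
    one≤ : 1ℚ ℚ.≤ y ℚ.+ ½
    one≤ = begin
      1ℚ              ≡⟨ cong bitℚ (sym (W⊑M i j Wij)) ⟩
      bitℚ (M i j)
        ≤⟨ dist⇒≤ {bitℚ (M i j)} {dot i j} (subst (ℚ._≤ ε) (dist-sym (dot i j) (bitℚ (M i j))) (approx i j)) ⟩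
      dot i j ℚ.+ ε
        ≤⟨ ℚ.+-monoˡ-≤ ε (dist⇒≤ {dot i j} {y} (subst (ℚ._≤ drift δ s) (dist-sym y (dot i j))
             (iterate-drift (dot i) (ℚ.+-mono-≤ 0≤η 0≤ε) (walk-dot i j Wij) s j))) ⟩
      (y ℚ.+ drift δ s) ℚ.+ ε
        ≡⟨ trans (ℚ.+-assoc y (drift δ s) ε) (cong (y ℚ.+_) (ℚ.+-comm (drift δ s) ε)) ⟩
      y ℚ.+ (ε ℚ.+ drift δ s)
        ≤⟨ ℚ.+-monoʳ-≤ y (slow s s≤r) ⟩
      y ℚ.+ ½         ∎
    minus-half : ∀ y → (y ℚ.+ ½) ℚ.- ½ ≡ y
    minus-half = solve 1 (λ y → ((y :+ con ½) :- con ½) := y) refl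
    bound : ½ ℚ.≤ y
    bound = subst (½ ℚ.≤_) (minus-half y) (ℚ.+-monoˡ-≤ (ℚ.- ½) one≤)

  -- `A` = 2α is the weight in the AM-GM inequality below; 1/`B` = 1/(4α) becomes the loss of energy
  -- per edge and round.
  A B : ℚ
  A = α ℚ.+ α
  B = A ℚ.+ A

  0≤B : 0ℚ ℚ.≤ B
  0≤B = ℚ.+-mono-≤ 0≤A 0≤A
    where
    0≤A : 0ℚ ℚ.≤ A
    0≤A = ℚ.+-mono-≤ (ℚ.<⇒≤ 0<α) (ℚ.<⇒≤ 0<α)

  X : ℕ → ℚ
  X s = sumℚ λ l → sumℚ λ i → deg i ℚ.* (u l i ℚ.* rowMean (x s l) i)

  X-large : ∀ s → s ≤ rounds g → total ℚ.* ½ ℚ.≤ X s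
  X-large s s≤r = begin
    total ℚ.* ½
      ≡⟨ ∑ℚ.*-distribʳ-sum ½ deg ⟩
    sumℚ (λ i → deg i ℚ.* ½)
      ≡⟨ ∑ℚ.sum-cong-≗ (λ i → sym (sumOver-const (W i) ½)) ⟩
    sumℚ (λ i → sumOver (W i) λ _ → ½)
      ≤⟨ sumℚ-mono (λ i → sumOver-mono (W i) (dot-large s s≤r i)) ⟩
    sumℚ (λ i → sumOver (W i) λ j → sumℚ λ l → u l i ℚ.* x s l j)
      ≡⟨ ∑ℚ.sum-cong-≗ (λ i → trans (sumOver-sum (W i) (λ l j → u l i ℚ.* x s l j))
           (∑ℚ.sum-cong-≗ λ l → average-out i l)) ⟩
    sumℚ (λ i → sumℚ λ l → deg i ℚ.* (u l i ℚ.* rowMean (x s l) i))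
      ≡⟨ ∑ℚ.∑-comm (λ i l → deg i ℚ.* (u l i ℚ.* rowMean (x s l) i)) ⟩
    X s ∎
    where
    open ℚ.≤-Reasoning
    swap : ∀ a b c → a ℚ.* (b ℚ.* c) ≡ b ℚ.* (a ℚ.* c)
    swap = solve 3 (λ a b c → (a :* (b :* c)) := (b :* (a :* c))) refl
    average-out : ∀ i l → sumOver (W i) (λ j → u l i ℚ.* x s l j) ≡ deg i ℚ.* (u l i ℚ.* rowMean (x s l) i)
    average-out i l = trans (sumOver-* (W i) (u l i) (x s l))
      (trans (cong (u l i ℚ.*_) (trans (sumOver-average (W i) (x s l))
               (sumOver-const (W i) (rowMean (x s l) i))))
             (swap (u l i) (deg i) (rowMean (x s l) i)))

  -- 2 ⟨u , m⟩ ≤ 2α ∣m∣² + ∣u∣² / 2α for the row means m, multiplied by 2α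
  X-small : ∀ s → B ℚ.* X s ℚ.≤ (A ℚ.* A) ℚ.* D s ℚ.+ α ℚ.* total
  X-small s = begin
    B ℚ.* X s
      ≡⟨ trans (∑ℚ.*-distribˡ-sum B (λ l → sumℚ λ i → deg i ℚ.* (u l i ℚ.* mean l i)))
           (∑ℚ.sum-cong-≗ λ l → ∑ℚ.*-distribˡ-sum B (λ i → deg i ℚ.* (u l i ℚ.* mean l i))) ⟩
    sumℚ (λ l → sumℚ λ i → B ℚ.* (deg i ℚ.* (u l i ℚ.* mean l i)))
      ≤⟨ sumℚ-mono (λ l → sumℚ-mono λ i → am-gm (deg i) (u l i) (mean l i) (0≤natℚ (# W i))) ⟩
    sumℚ (λ l → sumℚ λ i → (A ℚ.* A) ℚ.* (deg i ℚ.* (mean l i ℚ.* mean l i)) ℚ.+ deg i ℚ.* (u l i ℚ.* u l i))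
      ≡⟨ trans (∑ℚ.sum-cong-≗ λ l → ∑ℚ.∑-distrib-+
                  (λ i → (A ℚ.* A) ℚ.* (deg i ℚ.* (mean l i ℚ.* mean l i))) (λ i → deg i ℚ.* (u l i ℚ.* u l i)))
               (∑ℚ.∑-distrib-+
                  (λ l → sumℚ λ i → (A ℚ.* A) ℚ.* (deg i ℚ.* (mean l i ℚ.* mean l i)))
                  (λ l → sumℚ λ i → deg i ℚ.* (u l i ℚ.* u l i))) ⟩
    sumℚ (λ l → sumℚ λ i → (A ℚ.* A) ℚ.* (deg i ℚ.* (mean l i ℚ.* mean l i)))
      ℚ.+ sumℚ (λ l → sumℚ λ i → deg i ℚ.* (u l i ℚ.* u l i))
      ≡⟨ cong₂ ℚ._+_
           (sym (trans (∑ℚ.*-distribˡ-sum (A ℚ.* A) (λ l → drop (x s l)))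
             (∑ℚ.sum-cong-≗ λ l → ∑ℚ.*-distribˡ-sum (A ℚ.* A) (λ i → deg i ℚ.* (mean l i ℚ.* mean l i)))))
           (trans (∑ℚ.∑-comm (λ l i → deg i ℚ.* (u l i ℚ.* u l i)))
             (∑ℚ.sum-cong-≗ λ i → sym (∑ℚ.*-distribˡ-sum (deg i) (λ l → u l i ℚ.* u l i)))) ⟩
    (A ℚ.* A) ℚ.* D s ℚ.+ sumℚ (λ i → deg i ℚ.* sumℚ λ l → u l i ℚ.* u l i)
      ≤⟨ ℚ.+-monoʳ-≤ ((A ℚ.* A) ℚ.* D s) (sumℚ-mono λ i →
           ℚ.*-monoˡ-≤-nonNeg (deg i) {{ℚ.nonNegative (0≤natℚ (# W i))}} (∣u∣²≤α i)) ⟩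
    (A ℚ.* A) ℚ.* D s ℚ.+ sumℚ (λ i → deg i ℚ.* α)
      ≡⟨ cong ((A ℚ.* A) ℚ.* D s ℚ.+_) (trans (sym (∑ℚ.*-distribʳ-sum α deg)) (ℚ.*-comm total α)) ⟩
    (A ℚ.* A) ℚ.* D s ℚ.+ α ℚ.* total ∎
    where
    open ℚ.≤-Reasoning
    mean : Fin dim → Fin m → ℚ
    mean l i = rowMean (x s l) i
    am-gm : ∀ d p q → 0ℚ ℚ.≤ d → B ℚ.* (d ℚ.* (p ℚ.* q)) ℚ.≤ (A ℚ.* A) ℚ.* (d ℚ.* (q ℚ.* q)) ℚ.+ d ℚ.* (p ℚ.* p)
    am-gm d p q 0≤d = subst₂ ℚ._≤_ (ℚ.+-identityʳ _) (complete A d p q)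
      (ℚ.+-monoʳ-≤ (B ℚ.* (d ℚ.* (p ℚ.* q))) (0≤p*q 0≤d (0≤p² (A ℚ.* q ℚ.- p))))
      where
      complete : ∀ A d p q →
        (A ℚ.+ A) ℚ.* (d ℚ.* (p ℚ.* q)) ℚ.+ d ℚ.* ((A ℚ.* q ℚ.- p) ℚ.* (A ℚ.* q ℚ.- p))
          ≡ (A ℚ.* A) ℚ.* (d ℚ.* (q ℚ.* q)) ℚ.+ d ℚ.* (p ℚ.* p)
      complete = solve 4 (λ A d p q →
        (((A :+ A) :* (d :* (p :* q))) :+ (d :* (((A :* q) :- p) :* ((A :* q) :- p))))
          := (((A :* A) :* (d :* (q :* q))) :+ (d :* (p :* p)))) refl

  -- The two bounds on `X s` combine to 2α · total ≤ 4α² · D s + α · total. The weight 2α makes half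
  -- of the left side survive the subtraction, and a factor α cancels.
  total≤drop : ∀ s → s ≤ rounds g → total ℚ.≤ B ℚ.* D s
  total≤drop s s≤r = ℚ.*-cancelˡ-≤-pos α {{ℚ.positive 0<α}}
    (subst₂ ℚ._≤_ (left α total) (right α total (D s))
      (ℚ.+-monoˡ-≤ (ℚ.- (α ℚ.* total)) (ℚ.≤-trans
        (ℚ.*-monoˡ-≤-nonNeg B {{ℚ.nonNegative 0≤B}} (X-large s s≤r)) (X-small s))))
    where
    left : ∀ a e → ((a ℚ.+ a) ℚ.+ (a ℚ.+ a)) ℚ.* (e ℚ.* ½) ℚ.- a ℚ.* e ≡ a ℚ.* e
    left = solve 2 (λ a e → ((((a :+ a) :+ (a :+ a)) :* (e :* con ½)) :- (a :* e)) := (a :* e)) refl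
    right : ∀ a e d → (((a ℚ.+ a) ℚ.* (a ℚ.+ a)) ℚ.* d ℚ.+ a ℚ.* e) ℚ.- a ℚ.* e
      ≡ a ℚ.* (((a ℚ.+ a) ℚ.+ (a ℚ.+ a)) ℚ.* d)
    right = solve 3 (λ a e d → (((((a :+ a) :* (a :+ a)) :* d) :+ (a :* e)) :- (a :* e))
      := (a :* (((a :+ a) :+ (a :+ a)) :* d))) refl

  accumulated : ∀ s → s ≤ rounds g → B ℚ.* E s ℚ.+ natℚ s ℚ.* total ℚ.≤ B ℚ.* E 0
  accumulated zero    _     = ℚ.≤-reflexive
    (trans (cong (B ℚ.* E 0 ℚ.+_) (ℚ.*-zeroˡ total)) (ℚ.+-identityʳ (B ℚ.* E 0)))
  accumulated (suc s) 1+s≤r = begin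
    B ℚ.* E (suc s) ℚ.+ natℚ (suc s) ℚ.* total
      ≡⟨ cong (B ℚ.* E (suc s) ℚ.+_) (trans (cong (ℚ._* total) (natℚ-suc s))
           (trans (ℚ.*-distribʳ-+ total (natℚ s) 1ℚ) (cong (natℚ s ℚ.* total ℚ.+_) (ℚ.*-identityˡ total)))) ⟩
    B ℚ.* E (suc s) ℚ.+ (natℚ s ℚ.* total ℚ.+ total)
      ≤⟨ ℚ.+-monoʳ-≤ (B ℚ.* E (suc s)) (ℚ.+-monoʳ-≤ (natℚ s ℚ.* total) (total≤drop s s≤r)) ⟩
    B ℚ.* E (suc s) ℚ.+ (natℚ s ℚ.* total ℚ.+ B ℚ.* D s)
      ≡⟨ collect B (E (suc s)) (natℚ s ℚ.* total) (D s) ⟩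
    B ℚ.* (E (suc s) ℚ.+ D s) ℚ.+ natℚ s ℚ.* total
      ≤⟨ ℚ.+-monoˡ-≤ (natℚ s ℚ.* total) (ℚ.*-monoˡ-≤-nonNeg B {{ℚ.nonNegative 0≤B}} (E-decreases s)) ⟩
    B ℚ.* E s ℚ.+ natℚ s ℚ.* total
      ≤⟨ accumulated s s≤r ⟩
    B ℚ.* E 0 ∎
    where
    open ℚ.≤-Reasoning
    s≤r : s ≤ rounds g
    s≤r = ℕ.≤-trans (ℕ.n≤1+n s) 1+s≤r
    collect : ∀ b e t d → b ℚ.* e ℚ.+ (t ℚ.+ b ℚ.* d) ≡ b ℚ.* (e ℚ.+ d) ℚ.+ t
    collect = solve 4 (λ b e t d → ((b :* e) :+ (t :+ (b :* d))) := ((b :* (e :+ d)) :+ t)) refl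

  E₀≤ : E 0 ℚ.≤ total ℚ.* β
  E₀≤ = begin
    sumℚ (λ l → sumℚ λ i → sumOver (W i) λ j → v l j ℚ.* v l j)
      ≡⟨ ∑ℚ.∑-comm (λ l i → sumOver (W i) λ j → v l j ℚ.* v l j) ⟩
    sumℚ (λ i → sumℚ λ l → sumOver (W i) λ j → v l j ℚ.* v l j)
      ≡⟨ ∑ℚ.sum-cong-≗ (λ i → sym (sumOver-sum (W i) (λ l j → v l j ℚ.* v l j))) ⟩
    sumℚ (λ i → sumOver (W i) λ j → sumℚ λ l → v l j ℚ.* v l j)
      ≤⟨ sumℚ-mono (λ i → sumOver-mono (W i) λ j _ → ∣v∣²≤β j) ⟩
    sumℚ (λ i → sumOver (W i) λ _ → β)
      ≡⟨ trans (∑ℚ.sum-cong-≗ λ i → sumOver-const (W i) β) (sym (∑ℚ.*-distribʳ-sum β deg)) ⟩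
    total ℚ.* β ∎
    where open ℚ.≤-Reasoning

  B*E₀≤ : B ℚ.* E 0 ℚ.≤ natℚ (4 * g) ℚ.* total
  B*E₀≤ = begin
    B ℚ.* E 0              ≤⟨ ℚ.*-monoˡ-≤-nonNeg B {{ℚ.nonNegative 0≤B}} E₀≤ ⟩
    B ℚ.* (total ℚ.* β)    ≡⟨ regroup α total β ⟩
    natℚ 4 ℚ.* (α ℚ.* β) ℚ.* total
      ≤⟨ ℚ.*-monoʳ-≤-nonNeg total {{ℚ.nonNegative 0≤total}}
           (ℚ.*-monoˡ-≤-nonNeg (natℚ 4) αβ≤g) ⟩
    natℚ 4 ℚ.* natℚ g ℚ.* total  ≡⟨ cong (ℚ._* total) (natℚ-* 4 g) ⟨
    natℚ (4 * g) ℚ.* total       ∎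
    where
    open ℚ.≤-Reasoning
    0≤total : 0ℚ ℚ.≤ total
    0≤total = 0≤sumℚ λ i → 0≤natℚ (# W i)
    regroup : ∀ a t b → ((a ℚ.+ a) ℚ.+ (a ℚ.+ a)) ℚ.* (t ℚ.* b) ≡ natℚ 4 ℚ.* (a ℚ.* b) ℚ.* t
    regroup = solve 3 (λ a t b → (((a :+ a) :+ (a :+ a)) :* (t :* b)) := ((con (natℚ 4) :* (a :* b)) :* t)) refl

  no-edges : ∀ i j → W i j ≡ true → ⊥
  no-edges i j Wij = ℚ.<-irrefl refl (ℚ.<-≤-trans too-many too-few)
    where
    open ℚ.≤-Reasoning
    r : ℕ
    r = rounds g
    0<total : 0ℚ ℚ.< total
    0<total = subst (0ℚ ℚ.<_) (natℚ-sum (λ i → # W i))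
      (0<natℚ (ℕ.≤-trans (#-pos {f = W i} j Wij) (≤-sum (λ i → # W i) i)))
    0≤E : 0ℚ ℚ.≤ E r
    0≤E = 0≤sumℚ λ l → 0≤sumℚ λ i → 0≤sumOver (W i) λ j → 0≤p² (x r l j)
    too-few : natℚ r ℚ.≤ natℚ (4 * g)
    too-few = ℚ.*-cancelʳ-≤-pos total {{ℚ.positive 0<total}} (begin
      natℚ r ℚ.* total                 ≡⟨ ℚ.+-identityˡ _ ⟨
      0ℚ ℚ.+ natℚ r ℚ.* total          ≤⟨ ℚ.+-monoˡ-≤ (natℚ r ℚ.* total) (0≤p*q 0≤B 0≤E) ⟩
      B ℚ.* E r ℚ.+ natℚ r ℚ.* total   ≤⟨ accumulated r ℕ.≤-refl ⟩
      B ℚ.* E 0                        ≤⟨ B*E₀≤ ⟩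
      natℚ (4 * g) ℚ.* total           ∎)
    too-many : natℚ (4 * g) ℚ.< natℚ r
    too-many = subst₂ ℚ._<_ (ℚ.+-identityʳ (natℚ (4 * g))) (sym (natℚ-suc (4 * g)))
      (ℚ.+-monoʳ-< (natℚ (4 * g)) (ℚ.positive⁻¹ 1ℚ))

-- Mixing of the walk

≤-*inverse : ∀ {E k a} → 0 < E → E * k ≤ a → natℚ k ℚ.≤ natℚ a ℚ.* inverse E
≤-*inverse {suc e} {k} {a} _ Ek≤a = begin
  natℚ k                                 ≡⟨ ℚ.*-identityʳ (natℚ k) ⟨
  natℚ k ℚ.* 1ℚ                          ≡⟨ cong (natℚ k ℚ.*_) (natℚ*mesh e) ⟨
  natℚ k ℚ.* (natℚ (suc e) ℚ.* mesh e)   ≡⟨ regroup (natℚ k) (natℚ (suc e)) (mesh e) ⟩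
  (natℚ (suc e) ℚ.* natℚ k) ℚ.* mesh e   ≡⟨ cong (ℚ._* mesh e) (natℚ-* (suc e) k) ⟨
  natℚ (suc e * k) ℚ.* mesh e
    ≤⟨ ℚ.*-monoʳ-≤-nonNeg (mesh e) {{ℚ.nonNegative (0≤mesh e)}} (natℚ-mono Ek≤a) ⟩
  natℚ a ℚ.* mesh e                      ∎
  where
  open ℚ.≤-Reasoning
  regroup : ∀ k s d → k ℚ.* (s ℚ.* d) ≡ (s ℚ.* k) ℚ.* d
  regroup = solve 3 (λ k s d → (k :* (s :* d)) := ((s :* k) :* d)) refl

average-≤ : (f : Vector Bool n) {x : Vector ℚ n} {e : ℚ} → 0ℚ ℚ.≤ e →
  sumOver f x ℚ.≤ natℚ (# f) ℚ.* e → average f x ℚ.≤ e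
average-≤ f 0≤e le = ℚ.≤-trans
  (ℚ.*-monoˡ-≤-nonNeg (inverse (# f)) {{ℚ.nonNegative (0≤inverse (# f))}} le) (inverse*≤ (# f) 0≤e)

0≤average : (f : Vector Bool n) {x : Vector ℚ n} → (∀ j → 0ℚ ℚ.≤ x j) → 0ℚ ℚ.≤ average f x
0≤average f 0≤x = 0≤p*q (0≤inverse (# f)) (0≤sumOver f 0≤x)

sumOver-bits : (f g : Vector Bool n) → sumOver f (bitℚ ∘ g) ≡ natℚ (# (λ j → f j ∧ g j))
sumOver-bits f g = trans (∑ℚ.sum-cong-≗ λ j → at (f j) (g j)) (sym (natℚ-sum (λ j → bit (f j ∧ g j))))
  where
  at : ∀ a b → bitℚ a ℚ.* bitℚ b ≡ bitℚ (a ∧ b)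
  at true  b = ℚ.*-identityˡ (bitℚ b)
  at false b = ℚ.*-zeroˡ (bitℚ b)

bitℚ≤1 : ∀ b → bitℚ b ℚ.≤ 1ℚ
bitℚ≤1 true  = ℚ.≤-refl
bitℚ≤1 false = 0≤natℚ 1

-- For a row i of a submatrix whose rows have degrees between d and 16 d, only
-- boundedly many rows meet row i in more than 1/E of their ones, so a step
-- from a column to a row and back ends at a one of row i with probability at most 2/E.
module Mixing {t E} (M : BoolMatrix m n) (0<t : 0 < t) (0<E : 0 < E) (free : ¬ ContainsAllOnes t M)
  {c σ τ} (rich : Rich c M σ τ)
  (large : 2 * E * (t * 2 ^ (32 * t * E)) + E * (32 * t * E) ≤ suc c)
  (regular : ∀ i → σ i ≡ true → # (λ j → τ j ∧ M i j) ≤ 16 * suc c) where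

  open Rich rich

  W : BoolMatrix m n
  W i j = σ i ∧ τ j ∧ M i j

  open Walk W

  η : ℚ
  η = inverse E ℚ.+ inverse E

  0≤η : 0ℚ ℚ.≤ η
  0≤η = ℚ.+-mono-≤ (0≤inverse E) (0≤inverse E)

  N : ℕ
  N = 32 * t * E

  module _ (i : Fin m) (σi : σ i ≡ true) where

    overlap? : Vector Bool m
    overlap? k = does (# W k ℕ.≤? E * # (λ j → W k j ∧ M i j))

    overlapping : Vector Bool m
    overlapping k = σ k ∧ overlap? k

    #overlapping : # overlapping ≤ N
    #overlapping = ℕ.<⇒≤ (few-overlapping-rows M 0<t 0<E free
      (ℕ.≤-trans (ℕ.m≤m+n _ (E * N)) large) overlapping (λ j → τ j ∧ M i j) (regular i σi) overlaps)
      where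
      overlaps : ∀ k → overlapping k ≡ true → suc c ≤ E * # (λ j → (τ j ∧ M i j) ∧ M k j)
      overlaps k eq = begin
        suc c                        ≤⟨ rows k σk ⟩
        # (λ j → τ j ∧ M k j)        ≤⟨ #-mono {n = n} (λ j → ∧-true⁺ σk) ⟩
        # W k                        ≤⟨ does-true {P? = # W k ℕ.≤? _} (proj₂ (∧-true⁻ {σ k} eq)) ⟩
        E * # (λ j → W k j ∧ M i j)  ≤⟨ ℕ.*-monoʳ-≤ E (#-mono {n = n} regroup) ⟩
        E * # (λ j → (τ j ∧ M i j) ∧ M k j) ∎
        where
        open ℕ.≤-Reasoning
        σk : σ k ≡ true
        σk = proj₁ (∧-true⁻ eq)
        regroup : (λ j → W k j ∧ M i j) ⊑ (λ j → (τ j ∧ M i j) ∧ M k j)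
        regroup j eq =
          let (Wkj , Mij) = ∧-true⁻ {W k j} eq
              (τj , Mkj)  = ∧-true⁻ {τ j} (proj₂ (∧-true⁻ {σ k} Wkj))
          in ∧-true⁺ (∧-true⁺ τj Mij) Mkj

    rowMean≤ : ∀ k → σ k ≡ true → rowMean (bitℚ ∘ M i) k ℚ.≤ inverse E ℚ.+ bitℚ (overlapping k)
    rowMean≤ k σk = subst (λ b → rowMean (bitℚ ∘ M i) k ℚ.≤ inverse E ℚ.+ bitℚ (b ∧ overlap? k)) (sym σk)
      (by (# W k ℕ.≤? E * # (λ j → W k j ∧ M i j)))
      where
      open ℚ.≤-Reasoning
      by : (o? : Dec (# W k ≤ E * # (λ j → W k j ∧ M i j))) →
        rowMean (bitℚ ∘ M i) k ℚ.≤ inverse E ℚ.+ bitℚ (does o?)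
      by (yes _) = begin
        rowMean (bitℚ ∘ M i) k
          ≤⟨ average-≤ (W k) {x = bitℚ ∘ M i} (ℚ.nonNegative⁻¹ 1ℚ) (ℚ.≤-trans
               (sumOver-mono (W k) {x = bitℚ ∘ M i} λ j _ → bitℚ≤1 (M i j)) (ℚ.≤-reflexive (sumOver-const (W k) 1ℚ))) ⟩
        1ℚ                   ≡⟨ ℚ.+-identityˡ 1ℚ ⟨
        0ℚ ℚ.+ 1ℚ            ≤⟨ ℚ.+-monoˡ-≤ 1ℚ (0≤inverse E) ⟩
        inverse E ℚ.+ 1ℚ     ∎
      by (no #W≰) = begin
        rowMean (bitℚ ∘ M i) k
          ≤⟨ average-≤ (W k) {x = bitℚ ∘ M i} (0≤inverse E) (ℚ.≤-trans
               (ℚ.≤-reflexive (sumOver-bits (W k) (M i))) (≤-*inverse 0<E (ℕ.≰⇒≥ #W≰))) ⟩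
        inverse E            ≡⟨ ℚ.+-identityʳ (inverse E) ⟨
        inverse E ℚ.+ 0ℚ     ∎

    0≤walk : ∀ j → 0ℚ ℚ.≤ walk (bitℚ ∘ M i) j
    0≤walk j = 0≤average (Wᵀ j) λ k → 0≤average (W k) λ j → 0≤natℚ (bit (M i j))

    -- The two summands of `η` have different sources. Rows that overlap row i little have mean at
    -- most 1/E. The others, with mean at most 1, number at most `N`, which by `large` is at most
    -- 1/E of the degree of column j.
    walk≤ : ∀ j → τ j ≡ true → walk (bitℚ ∘ M i) j ℚ.≤ η
    walk≤ j τj = average-≤ (Wᵀ j) {x = rowMean (bitℚ ∘ M i)} 0≤η (begin
      sumOver (Wᵀ j) (rowMean (bitℚ ∘ M i))
        ≤⟨ sumOver-mono (Wᵀ j) {x = rowMean (bitℚ ∘ M i)} (λ k Wkj → rowMean≤ k (proj₁ (∧-true⁻ Wkj))) ⟩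
      sumOver (Wᵀ j) (λ k → inverse E ℚ.+ bitℚ (overlapping k))
        ≡⟨ sumOver-+ (Wᵀ j) (λ _ → inverse E) (bitℚ ∘ overlapping) ⟩
      sumOver (Wᵀ j) (λ _ → inverse E) ℚ.+ sumOver (Wᵀ j) (bitℚ ∘ overlapping)
        ≡⟨ cong₂ ℚ._+_ (sumOver-const (Wᵀ j) (inverse E)) (sumOver-bits (Wᵀ j) overlapping) ⟩
      natℚ b ℚ.* inverse E ℚ.+ natℚ (# (λ k → Wᵀ j k ∧ overlapping k))
        ≤⟨ ℚ.+-monoʳ-≤ (natℚ b ℚ.* inverse E) (≤-*inverse 0<E E*overlap≤b) ⟩
      natℚ b ℚ.* inverse E ℚ.+ natℚ b ℚ.* inverse E
        ≡⟨ ℚ.*-distribˡ-+ (natℚ b) (inverse E) (inverse E) ⟨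
      natℚ b ℚ.* η ∎)
      where
      open ℚ.≤-Reasoning
      b : ℕ
      b = # Wᵀ j
      d≤b : suc c ≤ b
      d≤b = ℕ.≤-trans (cols j τj) (#-mono {n = m} λ k eq →
        let (σk , Mkj) = ∧-true⁻ {σ k} eq in ∧-true⁺ σk (∧-true⁺ τj Mkj))
      E*overlap≤b : E * # (λ k → Wᵀ j k ∧ overlapping k) ≤ b
      E*overlap≤b = ℕ.≤-trans
        (ℕ.*-monoʳ-≤ E (ℕ.≤-trans (#-mono λ k → proj₂ ∘ ∧-true⁻ {Wᵀ j k}) #overlapping))
        (ℕ.≤-trans (ℕ.m≤n+m (E * N) _) (ℕ.≤-trans large d≤b))

  mixing : ∀ i j₀ → W i j₀ ≡ true → ∀ j → ℚ.∣ walk (bitℚ ∘ M i) j ∣ ℚ.≤ η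
  mixing i j₀ Wij₀ j with τ j Bool.≟ true
  ... | yes τj = ℚ.≤-trans (ℚ.≤-reflexive (ℚ.0≤p⇒∣p∣≡p (0≤walk i σi j))) (walk≤ i σi j τj)
    where
    σi : σ i ≡ true
    σi = proj₁ (∧-true⁻ Wij₀)
  -- A column outside `τ` has no ones in `W`, so the walk value there is an average over the empty
  -- set and the bound to check is vacuous.
  ... | no ¬τj = ∣average∣≤ (Wᵀ j) {x = rowMean (bitℚ ∘ M i)} 0≤η λ k Wkj →
    contradiction (proj₁ (∧-true⁻ (proj₂ (∧-true⁻ {σ k} Wkj)))) ¬τj

-- Adding `δ` turns the recurrence of `drift` into pure doubling.
drift-closed : (W : BoolMatrix m n) → ∀ δ s → Walk.drift W δ s ℚ.+ δ ≡ natℚ (2 ^ s) ℚ.* δ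
drift-closed W δ zero    = trans (ℚ.+-identityˡ δ) (sym (ℚ.*-identityˡ δ))
drift-closed W δ (suc s) = begin
  ((x ℚ.+ x) ℚ.+ δ) ℚ.+ δ      ≡⟨ double x δ ⟩
  natℚ 2 ℚ.* (x ℚ.+ δ)         ≡⟨ cong (natℚ 2 ℚ.*_) (drift-closed W δ s) ⟩
  natℚ 2 ℚ.* (natℚ (2 ^ s) ℚ.* δ)  ≡⟨ ℚ.*-assoc (natℚ 2) (natℚ (2 ^ s)) δ ⟨
  natℚ 2 ℚ.* natℚ (2 ^ s) ℚ.* δ    ≡⟨ cong (ℚ._* δ) (natℚ-* 2 (2 ^ s)) ⟨
  natℚ (2 ^ suc s) ℚ.* δ       ∎
  where
  open ≡-Reasoning
  x : ℚ
  x = Walk.drift W δ s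
  double : ∀ x d → ((x ℚ.+ x) ℚ.+ d) ℚ.+ d ≡ natℚ 2 ℚ.* (x ℚ.+ d)
  double = solve 2 (λ x d → (((x :+ x) :+ d) :+ d) := (con (natℚ 2) :* (x :+ d))) refl

-- Each round adds an error 3/E: two parts from mixing and one from the rational approximation.
-- Bounding the separate first term 1/E by 3/E completes the sum to 2^s · 3/E, which is at most one
-- half by the factor 6.
drift≤½ : (W : BoolMatrix m n) → ∀ {E} r → 0 < E → 6 * 2 ^ r ≤ E → ∀ s → s ≤ r →
  inverse E ℚ.+ Walk.drift W ((inverse E ℚ.+ inverse E) ℚ.+ inverse E) s ℚ.≤ ½
drift≤½ W {E} r 0<E 6·2^r≤E s s≤r = ℚ.*-cancelˡ-≤-pos (natℚ 2) (begin
  natℚ 2 ℚ.* (e ℚ.+ x)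
    ≤⟨ ℚ.*-monoˡ-≤-nonNeg (natℚ 2) (ℚ.+-monoˡ-≤ x (subst (ℚ._≤ δ) (ℚ.+-identityˡ e)
         (ℚ.+-monoˡ-≤ e (ℚ.+-mono-≤ (0≤inverse E) (0≤inverse E))))) ⟩
  natℚ 2 ℚ.* (δ ℚ.+ x)               ≡⟨ cong (natℚ 2 ℚ.*_) (trans (ℚ.+-comm δ x) (drift-closed W δ s)) ⟩
  natℚ 2 ℚ.* (natℚ (2 ^ s) ℚ.* δ)    ≡⟨ six e (natℚ (2 ^ s)) ⟩
  e ℚ.* (natℚ 6 ℚ.* natℚ (2 ^ s))    ≡⟨ cong (e ℚ.*_) (natℚ-* 6 (2 ^ s)) ⟨
  e ℚ.* natℚ (6 * 2 ^ s)
    ≤⟨ ℚ.*-monoˡ-≤-nonNeg e {{ℚ.nonNegative (0≤inverse E)}} (natℚ-mono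
         (ℕ.≤-trans (ℕ.*-monoʳ-≤ 6 (ℕ.^-monoʳ-≤ 2 s≤r)) 6·2^r≤E)) ⟩
  e ℚ.* natℚ E                       ≡⟨ cong (e ℚ.*_) (ℚ.*-identityʳ (natℚ E)) ⟨
  e ℚ.* (natℚ E ℚ.* 1ℚ)              ≤⟨ inverse*≤ E (ℚ.nonNegative⁻¹ 1ℚ) ⟩
  1ℚ                                 ∎)
  where
  open ℚ.≤-Reasoning
  e δ x : ℚ
  e = inverse E
  δ = (e ℚ.+ e) ℚ.+ e
  x = Walk.drift W δ s
  six : ∀ e p → natℚ 2 ℚ.* (p ℚ.* ((e ℚ.+ e) ℚ.+ e)) ≡ e ℚ.* (natℚ 6 ℚ.* p)
  six = solve 2 (λ e p → (con (natℚ 2) :* (p :* ((e :+ e) :+ e))) := (e :* (con (natℚ 6) :* p))) refl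

ContainsAllOnes-transpose : ∀ {t} {M : BoolMatrix m n} → ContainsAllOnes t (transpose M) → ContainsAllOnes t M
ContainsAllOnes-transpose (S , T , ∣S∣ , ∣T∣ , ones) = T , S , ∣T∣ , ∣S∣ , λ i∈ j∈ → ones j∈ i∈

Rich-transpose : {M : BoolMatrix m n} → ∀ {σ τ} → Rich c M σ τ → Rich c (transpose M) τ σ
Rich-transpose r = record { someRow = someCol ; someCol = someRow ; rows = cols ; cols = rows }
  where open Rich r

-- Orientations from factorizations

module SparseFromγ₂ {t : ℕ} (0<t : 0 < t) (g : ℕ) where

  -- `E` keeps the drift below one half through all rounds. The first summand of `D` serves the
  -- pigeonhole over 2^(32tE) column patterns, the second makes 32tE overlapping rows at most a
  -- fraction 1/E of every column degree.
  E D : ℕ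
  E = 6 * 2 ^ rounds g
  D = 2 * E * (t * 2 ^ (32 * t * E)) + E * (32 * t * E)

  0<E : 0 < E
  0<E = ℕ.*-mono-≤ {1} {6} (s≤s z≤n) (ℕ.m^n>0 2 (rounds g))

  module _ {m n} (M : BoolMatrix m n) (R : RationalFactorization g (inverse E) M)
    (free : ¬ ContainsAllOnes t M) where

    ¬Rich-if-regular : ∀ {c σ τ} → D ≤ suc c → Rich c M σ τ →
      ¬ (∀ i → σ i ≡ true → # (λ j → τ j ∧ M i j) ≤ 16 * suc c)
    ¬Rich-if-regular {c} {σ} {τ} D≤c rich regular =
      let (i , σi) = someRow
          (j , eq) = #-witness {f = λ j → τ j ∧ M i j} (ℕ.≤-<-trans z≤n (rows i σi))
      in no-edges i j (∧-true⁺ σi eq)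
      where
      open Rich rich
      open Mixing M 0<t 0<E free rich D≤c regular
      open EnergyDecrement {M = M} {W = W} R
        (λ i j eq → proj₂ (∧-true⁻ {τ j} (proj₂ (∧-true⁻ {σ i} eq))))
        {η} (0≤inverse E) 0≤η mixing (drift≤½ W (rounds g) 0<E ℕ.≤-refl)

    ¬Rich-if-wide : ∀ {c σ τ} → D ≤ c → Rich (4 * c) M σ τ → # τ ≤ # σ →
      ¬ Orientation (4 * suc c) M σ τ
    ¬Rich-if-wide D≤c rich #τ≤#σ o =
      let (_ , _ , rich′ , regular) = regular-rows M rich o #τ≤#σ
      in ¬Rich-if-regular (ℕ.m≤n⇒m≤1+n D≤c) rich′ regular

  -- If `M` has a `Rich (4 * D)` submatrix, then `c` is raised from `D` until `Rich (4 * suc c)`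
  -- fails for an orientation of `M`. There the lower bound on the degrees and the bound of the
  -- orientation match up to a constant, as `regular-rows` requires.
  sparse : ∀ {m n} (M : BoolMatrix m n) → RationalFactorization g (inverse E) M →
    ¬ ContainsAllOnes t M → Orientation (4 * D) M all all
  sparse {m} {n} M R free with dichotomy (4 * D) M all all
  ... | inj₂ o    = o
  ... | inj₁ rich = ⊥-elim (¬rich n D (ℕ.m≤m+n n D) ℕ.≤-refl rich)
    where
    -- `k` is fuel for raising `c`: a row has at most `n` ones, so no submatrix is `Rich (4 * c)`
    -- once `c` reaches `n`.
    ¬rich : ∀ k c → n ≤ k + c → D ≤ c → ¬ RichWithin (4 * c) M all all
    ¬rich k c n≤k+c D≤c (σ , τ , _ , _ , rich) with dichotomy (4 * suc c) M all all
    -- All hypotheses are symmetric under transposition, so the larger side of the submatrix can be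
    -- taken as its rows.
    ... | inj₂ o = [ (λ #τ≤#σ → ¬Rich-if-wide M R free D≤c rich #τ≤#σ o′)
                   , (λ #σ≤#τ → ¬Rich-if-wide (transpose M) (RationalFactorization-transpose R)
                        (free ∘ ContainsAllOnes-transpose) D≤c (Rich-transpose rich) #σ≤#τ
                        (Orientation-transpose o′)) ]′ (ℕ.≤-total (# τ) (# σ))
      where
      o′ : Orientation (4 * suc c) M σ τ
      o′ = Orientation-restrict (λ _ _ → refl) (λ _ _ → refl) o
    ¬rich zero c n≤c D≤c (σ , τ , _ , _ , rich) | inj₁ _ =
      let (i , σi) = Rich.someRow rich in
      ℕ.<⇒≱ (Rich.rows rich i σi) (ℕ.≤-trans (#≤n _) (ℕ.≤-trans n≤c (ℕ.m≤n*m c 4)))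
    ¬rich (suc k) c n≤k+c D≤c _ | inj₁ richer =
      ¬rich k (suc c) (ℕ.≤-trans n≤k+c (ℕ.≤-reflexive (sym (ℕ.+-suc k c)))) (ℕ.m≤n⇒m≤1+n D≤c) richer

γ₂⇒Orientation : ∀ {t} → 0 < t → (γ : ℝ) → ∃ λ c → ∀ {m n} (M : BoolMatrix m n) →
  ¬ ContainsAllOnes t M → γ₂[ toReal M ]≤ γ → Orientation c M all all
γ₂⇒Orientation 0<t γ =
  let (g , factor) = γ₂⇒RationalFactorization γ
      open SparseFromγ₂ 0<t g
  in 4 * D , λ M free γ₂≤γ → sparse M (factor (inverse E) (0<inverse 0<E) M γ₂≤γ) free
  where
  0<inverse : ∀ {E} → 0 < E → 0ℚ ℚ.< inverse E
  0<inverse {suc e} _ = 0<mesh e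

-- The equivalences

corollary1p3 :
  ∀ {ℓ} (t : ℕ) → 0 < t →
  (𝓜 : MatrixFamily ℓ) →
  (∀ {m n} (M : BoolMatrix m n) → M ∈ 𝓜 m n → ¬ ContainsAllOnes t M) →
  let [1] = ∃ λ (γ : ℝ) → ∀ {m n} (M : BoolMatrix m n) → M ∈ 𝓜 m n → γ₂[ toReal M ]≤ γ
      [2] = ∃ λ (b : ℕ) → ∀ {m n} (M : BoolMatrix m n) → M ∈ 𝓜 m n → IsSumOfThinBlocky≤ b M
      [3] = ∃ λ (d : ℕ) → ∀ {m n} (M : BoolMatrix m n) → M ∈ 𝓜 m n → DegeneracyAtMost M d
  in ([1] ⇔ [2]) × ([2] ⇔ [3])
corollary1p3 t 0<t 𝓜 free =
    mk⇔ (λ (γ , h) → let (c , o) = γ₂⇒Orientation 0<t γ in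
          c + c , λ M M∈ → Orientation⇒thinSum (o M (free M M∈) (h M M∈)))
        (λ (b , h) → fromℚ (natℚ (suc (b + b))) , λ M M∈ → Orientation⇒γ₂ (thinSum⇒Orientation (h M M∈)))
  , mk⇔ (λ (b , h) → (b + b) + (b + b) , λ M M∈ → Orientation⇒degeneracy (thinSum⇒Orientation (h M M∈)))
        (λ (d , h) → d + d , λ M M∈ → Orientation⇒thinSum (degeneracy⇒Orientation (h M M∈)))
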